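{- Let $n\ge 0$ and $m\ge 2$ be integers and let $N=n2^n+\varepsilon_1+\varepsilon_2\, m!$ for some choice of signs $\varepsilon_1,\varepsilon_2\in\{1,-1\}$. If $N$ is nonzero and every prime divisor of $N$ is at most $7$ (i.e. $P(N)\le 7$), then $n\le 8$ and $m\le 7$. Moreover, the solution with the largest $n$ is $(8\cdot 2^8+1)-4!=3^4\cdot 5^2$, and the solution with the largest $m$ is $4\cdot 2^4-1+7!=4\cdot2^4-1+5040=3^6\cdot 7$.
   Context: For a nonzero integer $N$, $P(N)$ denotes the largest prime factor of $N$. The numbers $n2^n+1$ are Cullen numbers and $n2^n-1$ are Woodall numbers. -}

module Defs where

open import Data.Nat as ℕ using (ℕ; _≤_; _^_)
open import Data.Nat.Divisibility using (_∣_)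
open import Data.Nat.Primality using (Prime)

open import Data.Integer as ℤ using (ℤ; +_; -_; ∣_∣)
open import Data.Sum using (_⊎_)
open import Data.Product using (_×_)
open import Relation.Binary.PropositionalEquality using (_≡_)
open import Relation.Nullary using (¬_)

Sign : ℤ → Set
Sign ε = ε ≡ + 1 ⊎ ε ≡ - (+ 1)

bigN : ℕ → ℤ → ℤ → ℕ → ℤ
bigN n ε₁ ε₂ m = + (n ℕ.* 2 ^ n) ℤ.+ ε₁ ℤ.+ ε₂ ℤ.* + (m ℕ.!)

LargestPrimeFactor≤7 : ℤ → Set
LargestPrimeFactor≤7 N = ∀ p → Prime p → p ∣ ∣ N ∣ → p ≤ 7

Solution : ℕ → ℕ → ℤ → ℤ → Set
Solution n m ε₁ ε₂ =
  2 ≤ m × Sign ε₁ × Sign ε₂ × ¬ (bigN n ε₁ ε₂ m ≡ + 0)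
  × LargestPrimeFactor≤7 (bigN n ε₁ ε₂ m)

{-# OPTIONS --safe #-}

-- N is odd, so ∣N∣ = 3ᵃ 5ᵇ 7ᶜ.  A p-adic Gelfond–Schneider argument bounds the p-adic valuation of n 2ⁿ - w,
-- for w ≠ 0, by a constant times (log n)⁵ log ∣w∣.  With w = -ε₁ it shows that if m exceeds a constant times
-- (log n)⁶ then a, b, c are so small that N ≡ ε₁ modulo a power of 2 larger than ∣N∣ + 1; so N = ε₁ and n 2ⁿ = m!,
-- which is absurd because a high power of 3 divides m!.  For smaller m the same bound with w = -(ε₁ + ε₂ m!)
-- makes ∣N∣ smaller than 2ⁿ.  All this works for n ≥ 2²¹⁰.
--
-- For n < 2²¹⁰, the congruence n 2ⁿ ≡ w (mod pᶠ) determines n modulo pᶠ once n is known modulo the order of 2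
-- mod p.  Computing these residues and seeing that they are not below 2²¹⁰ bounds a, b, c, hence n and m.
-- Repeating this brings n below 337 and m below 58, and then all cases are tried.
module Submission where

import Data.Nat.Properties as ℕₚ
open import Data.Nat.Primality using (Prime; euclidsLemma; prime?; prime⇒irreducible; prime⇒nonTrivial; prime⇒nonZero)
import Data.Integer.Properties as ℤₚ
open import Data.Unit using (⊤; tt)
open import Data.Product using (_×_; _,_; proj₁; proj₂; ∃)
open import Data.Sum using (inj₁; inj₂)
open import Data.Empty using (⊥; ⊥-elim)
open import Function using (_∘_)
open import Relation.Nullary using (¬_; Dec; yes; no)
open import Relation.Binary.PropositionalEquality

-- For each p choose q with 2^q = G ≡ 1 (mod p²) and write n = r + s q with r < q. Then n 2ⁿ = u Gˢ
-- with u = n 2ʳ of size n up to a constant, so a deep congruence n 2ⁿ ≡ w makes Gˢ congruent to w /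
-- u, whose terms are small compared with Gˢ. Hence x and Gˣ are both under control at all points a
-- + b s, which is what a Gelfond-Schneider argument needs. The modulus p² has two tasks: one factor
-- p pays for the denominators t! in the binomial series of Gˣ, and the other makes this series a
-- polynomial in p x, so that every zero divided out in the Schwarz lemma gains a factor p. The
-- p-adic numbers themselves never appear: every analytic statement is a congruence of integers
-- modulo a fixed power of p. With t close to log₂ n, the case w = -ε₁ leaves m of order at most t⁶,
-- so log m! has order t⁷, and the second use of the bound makes log ∣N∣ of order t¹². Comparing t¹²
-- and its constant with n is what leads to 2²¹⁰.

module PadicInterpolation where
  open import Data.Nat as ℕ using (ℕ; zero; suc; _≤_; _<_; s≤s; z≤n; _!)
  import Data.Nat.Divisibility as ℕ∣
  open import Data.Nat.DivMod as DivMod using (_/_; _%_)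
  open import Data.Nat.Coprimality using (Coprime; coprime-Bézout)
  open import Data.Nat.GCD using (module Bézout)
  open import Data.Nat.Tactic.RingSolver renaming (solve-∀ to solveℕ)
  open import Data.Integer as ℤ using (ℤ; +_; -_; ∣_∣; _+_; _-_; _*_; _^_; 0ℤ; 1ℤ)
  open import Data.Integer.DivMod using (_%ℕ_; _/ℕ_; n%ℕd<d; a≡a%ℕn+[a/ℕn]*n)
  open import Data.Integer.Divisibility.Signed hiding (quotient)
  open import Data.Integer.Tactic.RingSolver using (solve-∀)
  open import Data.Fin using (Fin; zero; suc; toℕ; fromℕ<; combine; quotient; remainder; finToFun; funToFin)
  import Data.Fin.Properties as Finₚ
  open import Data.List using (List; []; _∷_; length; map; applyUpTo)
  import Data.List.Properties as Listₚ
  open import Data.List.Relation.Unary.All as All using (All; []; _∷_)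
  import Data.List.Relation.Unary.All.Properties as Allₚ
  open import Data.List.Relation.Unary.AllPairs using ([]; _∷_)
  open import Data.List.Relation.Unary.Unique.Propositional using (Unique)
  import Data.List.Relation.Unary.Unique.Propositional.Properties as Uniqueₚ

  -- Polynomials with a prescribed number of coefficients, and their roots

  -- Indexing by `Fin n` serves the unknowns of Siegel's lemma, whose number matters. Interpolating
  -- polynomials, whose degree does not matter, are the lists of `eval`.
  ev : ∀ {n} → (Fin n → ℤ) → ℤ → ℤ
  ev {zero}  c y = 0ℤ
  ev {suc n} c y = c zero + y * ev (c ∘ suc) y

  -- Synthetic division by y - ξ: the coefficients of the quotient are the intermediate values of
  -- Horner's scheme at ξ.
  quo : ∀ {n} → (Fin (suc n) → ℤ) → ℤ → Fin n → ℤ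
  quo {suc n} c ξ zero    = ev (c ∘ suc) ξ
  quo {suc n} c ξ (suc i) = quo (c ∘ suc) ξ i

  ev-quo : ∀ {n} (c : Fin (suc n) → ℤ) ξ y → ev c y ≡ ev c ξ + (y - ξ) * ev (quo c ξ) y
  ev-quo {zero} c ξ y = lem (c zero) ξ y
    where
    lem : ∀ c ξ y → c + y * 0ℤ ≡ c + ξ * 0ℤ + (y - ξ) * 0ℤ
    lem = solve-∀
  ev-quo {suc n} c ξ y =
    trans (cong (λ t → c zero + y * t) (ev-quo (c ∘ suc) ξ y))
          (lem (c zero) ξ y (ev (c ∘ suc) ξ) (ev (quo (c ∘ suc) ξ) y))
    where
    lem : ∀ c ξ y a b → c + y * (a + (y - ξ) * b) ≡ c + ξ * a + (y - ξ) * (a + y * b)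
    lem = solve-∀

  quo-zero⇒zero : ∀ {n} (c : Fin (suc n) → ℤ) ξ → ev c ξ ≡ 0ℤ → (∀ i → quo c ξ i ≡ 0ℤ) → ∀ i → c i ≡ 0ℤ
  quo-zero⇒zero {zero} c ξ e q zero = trans (lem (c zero) ξ) e
    where
    lem : ∀ c ξ → c ≡ c + ξ * 0ℤ
    lem = solve-∀
  quo-zero⇒zero {suc n} c ξ e q zero =
    trans (lem (c zero) ξ) (trans (cong (λ t → c zero + ξ * t) (sym (q zero))) e)
    where
    lem : ∀ c ξ → c ≡ c + ξ * 0ℤ
    lem = solve-∀
  quo-zero⇒zero {suc n} c ξ e q (suc i) = quo-zero⇒zero (c ∘ suc) ξ (q zero) (q ∘ suc) i

  roots⇒zero : ∀ {n} (c : Fin n → ℤ) (ξs : List ℤ) → n ≤ length ξs → Unique ξs →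
               All (λ ξ → ev c ξ ≡ 0ℤ) ξs → ∀ i → c i ≡ 0ℤ
  roots⇒zero {suc n} c (ξ ∷ ξs) (s≤s n≤) (ξ∉ ∷ uq) (e ∷ es) =
    quo-zero⇒zero c ξ e (roots⇒zero (quo c ξ) ξs n≤ uq (All.zipWith step (ξ∉ , es)))
    where
    step : ∀ {η} → ξ ≢ η × ev c η ≡ 0ℤ → ev (quo c ξ) η ≡ 0ℤ
    step {η} (ξ≢η , eη) with ℤₚ.i*j≡0⇒i≡0∨j≡0 (η - ξ)
        (trans (lem (ev c ξ) ((η - ξ) * ev (quo c ξ) η))
        (cong₂ _-_ (trans (sym (ev-quo c ξ η)) eη) e))
      where
      lem : ∀ a b → b ≡ a + b - a
      lem = solve-∀
    ... | inj₁ z = ⊥-elim (ξ≢η (sym (ℤₚ.i-j≡0⇒i≡j η ξ z)))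
    ... | inj₂ z = z

  -- Polynomials as coefficient lists

  eval : List ℤ → ℤ → ℤ
  eval []       y = 0ℤ
  eval (a ∷ as) y = a + y * eval as y

  eval-divide : ∀ R ξ → ∃ λ Q → ∀ y → eval R y ≡ eval R ξ + (y - ξ) * eval Q y
  eval-divide [] ξ = [] , λ y → lem ξ y
    where
    lem : ∀ ξ y → 0ℤ ≡ 0ℤ + (y - ξ) * 0ℤ
    lem = solve-∀
  eval-divide (a ∷ R) ξ with eval-divide R ξ
  ... | Q , eq = eval R ξ ∷ Q , λ y →
    trans (cong (λ t → a + y * t) (eq y)) (lem a ξ y (eval R ξ) (eval Q y))
    where
    lem : ∀ c ξ y a b → c + y * (a + (y - ξ) * b) ≡ c + ξ * a + (y - ξ) * (a + y * b)
    lem = solve-∀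

  coef : List ℤ → ℕ → ℤ
  coef []       _       = 0ℤ
  coef (a ∷ _)  zero    = a
  coef (_ ∷ as) (suc t) = coef as t

  _⊞_ : List ℤ → List ℤ → List ℤ
  []       ⊞ bs       = bs
  (a ∷ as) ⊞ []       = a ∷ as
  (a ∷ as) ⊞ (b ∷ bs) = a + b ∷ as ⊞ bs

  eval-⊞ : ∀ as bs y → eval (as ⊞ bs) y ≡ eval as y + eval bs y
  eval-⊞ []       bs       y = sym (ℤₚ.+-identityˡ _)
  eval-⊞ (a ∷ as) []       y = sym (ℤₚ.+-identityʳ _)
  eval-⊞ (a ∷ as) (b ∷ bs) y =
    trans (cong (λ t → a + b + y * t) (eval-⊞ as bs y)) (lem a b y (eval as y) (eval bs y))
    where
    lem : ∀ a b y s t → a + b + y * (s + t) ≡ a + y * s + (b + y * t)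
    lem = solve-∀

  coef-⊞ : ∀ as bs t → coef (as ⊞ bs) t ≡ coef as t + coef bs t
  coef-⊞ []       bs       t       = sym (ℤₚ.+-identityˡ _)
  coef-⊞ (a ∷ as) []       t       = sym (ℤₚ.+-identityʳ _)
  coef-⊞ (a ∷ as) (b ∷ bs) zero    = refl
  coef-⊞ (a ∷ as) (b ∷ bs) (suc t) = coef-⊞ as bs t

  eval-scale : ∀ c as y → eval (map (c *_) as) y ≡ c * eval as y
  eval-scale c []       y = sym (ℤₚ.*-zeroʳ c)
  eval-scale c (a ∷ as) y =
    trans (cong (λ t → c * a + y * t) (eval-scale c as y)) (lem c a y (eval as y))
    where
    lem : ∀ c a y t → c * a + y * (c * t) ≡ c * (a + y * t)
    lem = solve-∀

  coef-scale : ∀ c as t → coef (map (c *_) as) t ≡ c * coef as t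
  coef-scale c []       t       = sym (ℤₚ.*-zeroʳ c)
  coef-scale c (a ∷ as) zero    = refl
  coef-scale c (a ∷ as) (suc t) = coef-scale c as t

  shift : ℕ → List ℤ → List ℤ
  shift zero    as = as
  shift (suc i) as = 0ℤ ∷ shift i as

  eval-shift : ∀ i as y → eval (shift i as) y ≡ y ^ i * eval as y
  eval-shift zero    as y = sym (ℤₚ.*-identityˡ _)
  eval-shift (suc i) as y =
    trans (cong (λ t → 0ℤ + y * t) (eval-shift i as y)) (lem y (y ^ i) (eval as y))
    where
    lem : ∀ y s t → 0ℤ + y * (s * t) ≡ y * s * t
    lem = solve-∀

  ∣-0 : ∀ {k} → k ∣ 0ℤ
  ∣-0 = divides 0ℤ refl

  ^-monoʳ-∣ : ∀ k {d e} → d ≤ e → k ^ d ∣ k ^ e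
  ^-monoʳ-∣ k {d} {e} d≤e = divides (k ^ (e ℕ.∸ d))
    (trans (cong (k ^_) (sym (ℕₚ.m∸n+n≡m d≤e))) (ℤₚ.^-distribˡ-+-* k (e ℕ.∸ d) d))

  -- The term of index t carries `k ^ t` anyway, so only the first e coefficients need a condition.
  -- In `go`, d is the number of factors k that the remaining tail still has to supply.
  eval-small : ∀ k x R {e} → (∀ t → t < e → k ^ e ∣ coef R t) → k ^ e ∣ eval R (k * x)
  eval-small k x R {e} = go R e ℕₚ.≤-refl
    where
    go : ∀ R d → d ≤ e → (∀ t → t < d → k ^ e ∣ coef R t) → k ^ d ∣ eval R (k * x)
    go []      d       _   _ = ∣-0
    go (a ∷ R) zero    _   _ = ∣-trans (divides (a + k * x * eval R (k * x)) (sym (ℤₚ.*-identityʳ _))) ∣-refl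
    go (a ∷ R) (suc d) d≤e h = ∣m∣n⇒∣m+n
      (∣-trans (^-monoʳ-∣ k d≤e) (h zero (s≤s z≤n)))
      (subst (k ^ suc d ∣_) (lem k x (eval R (k * x)))
        (∣n⇒∣m*n x (*-monoʳ-∣ k (go R d (ℕₚ.<⇒≤ d≤e) λ t t<d → h (suc t) (s≤s t<d)))))
      where
      lem : ∀ k x t → x * (k * t) ≡ k * x * t
      lem = solve-∀

  -- Cancellation modulo prime powers and the Schwarz lemma

  p^-mono-∣ : ∀ p {d e} → d ≤ e → p ℕ.^ d ℕ∣.∣ p ℕ.^ e
  p^-mono-∣ p {d} {e} d≤e = ℕ∣.divides (p ℕ.^ (e ℕ.∸ d))
    (trans (cong (p ℕ.^_) (sym (ℕₚ.m∸n+n≡m d≤e))) (ℕₚ.^-distribˡ-+-* p (e ℕ.∸ d) d))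

  ∤-cancel : ∀ {p} → Prime p → ∀ {d} → ¬ p ℕ∣.∣ d → ∀ e {t} → p ℕ.^ e ℕ∣.∣ d ℕ.* t → p ℕ.^ e ℕ∣.∣ t
  ∤-cancel pp p∤d zero h = ℕ∣.1∣_ _
  ∤-cancel {p} pp {d} p∤d (suc e) {t} h with euclidsLemma d t pp (ℕ∣.∣-trans (ℕ∣.m∣m*n _) h)
  ... | inj₁ p∣d = ⊥-elim (p∤d p∣d)
  ... | inj₂ (ℕ∣.divides t′ refl) =
    subst (p ℕ.^ suc e ℕ∣.∣_) (ℕₚ.*-comm p t′) (ℕ∣.*-monoʳ-∣ p (∤-cancel pp p∤d e (ℕ∣.*-cancelˡ-∣ p {{prime⇒nonZero pp}}
      (subst (p ℕ.* p ℕ.^ e ℕ∣.∣_) (trans (sym (ℕₚ.*-assoc d t′ p)) (ℕₚ.*-comm (d ℕ.* t′) p)) h))))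

  -- A nonzero d below `p ^ λ′` contains fewer than λ′ factors p, so cancelling it costs at most λ′
  -- of them.
  small-cancel : ∀ {p} → Prime p → ∀ λ′ e {d t} → d ≢ 0 → d < p ℕ.^ λ′ → p ℕ.^ (e ℕ.+ λ′) ℕ∣.∣ d ℕ.* t → p ℕ.^ e ℕ∣.∣ t
  small-cancel pp zero e d≢0 d<1 h = ⊥-elim (d≢0 (ℕₚ.n<1⇒n≡0 d<1))
  small-cancel {p} pp (suc λ′) e {d} {t} d≢0 d< h with p ℕ∣.∣? d
  ... | no p∤d = ∤-cancel pp p∤d e (ℕ∣.∣-trans (p^-mono-∣ p (ℕₚ.m≤m+n e (suc λ′))) h)
  ... | yes (ℕ∣.divides d′ refl) = small-cancel pp λ′ e (λ { refl → d≢0 refl })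
    (ℕₚ.*-cancelˡ-< p d′ _ (subst (_< p ℕ.^ suc λ′) (ℕₚ.*-comm d′ p) d<))
    (ℕ∣.*-cancelˡ-∣ p {{prime⇒nonZero pp}} (subst₂ ℕ∣._∣_ (cong (p ℕ.^_) (ℕₚ.+-suc e λ′))
       (trans (cong (ℕ._* t) (ℕₚ.*-comm d′ p)) (ℕₚ.*-assoc p d′ t)) h))

  abs-^ : ∀ i e → ∣ i ^ e ∣ ≡ ∣ i ∣ ℕ.^ e
  abs-^ i zero    = refl
  abs-^ i (suc e) = trans (ℤₚ.abs-* i (i ^ e)) (cong (∣ i ∣ ℕ.*_) (abs-^ i e))

  ∣⇒∣ℕ : ∀ p e {t} → (+ p) ^ e ∣ t → p ℕ.^ e ℕ∣.∣ ∣ t ∣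
  ∣⇒∣ℕ p e {t} h = subst (ℕ∣._∣ ∣ t ∣) (abs-^ (+ p) e) (∣⇒∣ᵤ h)

  ∣ℕ⇒∣ : ∀ p e {t} → p ℕ.^ e ℕ∣.∣ ∣ t ∣ → (+ p) ^ e ∣ t
  ∣ℕ⇒∣ p e {t} h = ∣ᵤ⇒∣ (subst (ℕ∣._∣ ∣ t ∣) (sym (abs-^ (+ p) e)) h)

  unit-cancel : ∀ {p} → Prime p → ∀ {u} → ¬ p ℕ∣.∣ ∣ u ∣ → ∀ e {t} → (+ p) ^ e ∣ u * t → (+ p) ^ e ∣ t
  unit-cancel {p} pp {u} p∤u e {t} h =
    ∣ℕ⇒∣ p e (∤-cancel pp p∤u e (subst (p ℕ.^ e ℕ∣.∣_) (ℤₚ.abs-* u t) (∣⇒∣ℕ p e h)))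

  diff-cancel : ∀ {p} → Prime p → ∀ λ′ e {a b t} → a ≢ b → a < p ℕ.^ λ′ → b < p ℕ.^ λ′ →
                (+ p) ^ (e ℕ.+ λ′) ∣ (+ a - + b) * t → (+ p) ^ e ∣ t
  diff-cancel {p} pp λ′ e {a} {b} {t} a≢b a< b< h =
    ∣ℕ⇒∣ p e (small-cancel pp λ′ e (λ z → a≢b (ℤₚ.+-injective (ℤₚ.i-j≡0⇒i≡j (+ a) (+ b) (ℤₚ.∣i∣≡0⇒i≡0 z))))
      (ℕₚ.≤-<-trans (subst (_≤ a ℕ.⊔ b) (sym (cong ∣_∣ (ℤₚ.m-n≡m⊖n a b))) (ℤₚ.∣m⊝n∣≤m⊔n a b))
         (ℕₚ.⊔-lub a< b<))
      (subst (p ℕ.^ (e ℕ.+ λ′) ℕ∣.∣_) (ℤₚ.abs-* (+ a - + b) t) (∣⇒∣ℕ p (e ℕ.+ λ′) h)))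

  -- Dividing R by y - pξ leaves the factor p (x - ξ) in front of the quotient, a gain of one p per
  -- node at every x. The price is paid at the other nodes η: recovering Q from R there cancels p (η
  -- - ξ), which loses one p and at most λ′ more. This is why the hypothesis reserves `suc λ′`
  -- powers for each node.
  schwarz : ∀ {p} → Prime p → ∀ λ′ k R (ξs : List ℕ) → Unique ξs → All (_< p ℕ.^ λ′) ξs →
    All (λ ξ → (+ p) ^ (k ℕ.+ length ξs ℕ.* suc λ′) ∣ eval R (+ p * + ξ)) ξs →
    ∀ e → e ≤ k → e ≤ length ξs → ∀ x → (+ p) ^ e ∣ eval R (+ p * + x)
  schwarz pp λ′ k R ξs uq bd zs zero _ _ x = ∣-trans (divides (eval R _) (sym (ℤₚ.*-identityʳ _))) ∣-refl
  schwarz {p} pp λ′ k R (ξ ∷ ξs) (ξ∉ ∷ uq) (ξ< ∷ bd) (z ∷ zs) (suc e) e≤k (s≤s e≤) x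
    with eval-divide R (+ p * + ξ)
  ... | Q , eq = subst ((+ p) ^ suc e ∣_) (sym (eq (+ p * + x)))
    (∣m∣n⇒∣m+n (∣-trans (^-monoʳ-∣ (+ p) (ℕₚ.≤-trans e≤k (ℕₚ.m≤m+n k _))) z)
      (subst ((+ p) ^ suc e ∣_) (lem (+ p) (+ x) (+ ξ) (eval Q (+ p * + x)))
        (∣n⇒∣m*n (+ x - + ξ) (*-monoʳ-∣ (+ p)
          (schwarz pp λ′ k Q ξs uq bd (All.zipWith step (All.zip (bd , ξ∉) , zs)) e (ℕₚ.<⇒≤ e≤k) e≤ x)))))
    where
    lem : ∀ p x ξ t → (x - ξ) * (p * t) ≡ (p * x - p * ξ) * t
    lem = solve-∀
    lem₂ : ∀ p x ξ t a → a + (p * x - p * ξ) * t - a ≡ p * ((x - ξ) * t)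
    lem₂ = solve-∀
    M = length ξs ℕ.* suc λ′
    step : ∀ {η} → (η < p ℕ.^ λ′ × ξ ≢ η) × (+ p) ^ (k ℕ.+ (suc λ′ ℕ.+ M)) ∣ eval R (+ p * + η) →
           (+ p) ^ (k ℕ.+ M) ∣ eval Q (+ p * + η)
    step {η} ((η< , ξ≢η) , zη) = diff-cancel pp λ′ (k ℕ.+ M) (ξ≢η ∘ sym) η< ξ<
      (*-cancelˡ-∣ (+ p) {{prime⇒nonZero pp}} (subst₂ _∣_ (cong ((+ p) ^_) ee) refl
        (subst ((+ p) ^ (k ℕ.+ (suc λ′ ℕ.+ M)) ∣_) (lem₂ (+ p) (+ η) (+ ξ) (eval Q (+ p * + η)) (eval R (+ p * + ξ)))
          (∣m∣n⇒∣m-n (subst ((+ p) ^ (k ℕ.+ (suc λ′ ℕ.+ M)) ∣_) (eq (+ p * + η)) zη) z))))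
      where
      ee : k ℕ.+ (suc λ′ ℕ.+ M) ≡ suc (k ℕ.+ M ℕ.+ λ′)
      ee = trans (ℕₚ.+-suc k (λ′ ℕ.+ M)) (cong suc (trans (cong (k ℕ.+_) (ℕₚ.+-comm λ′ M)) (sym (ℕₚ.+-assoc k M λ′))))

  -- Homogeneous evaluation and sizes of values

  -- The form U^(n-1) f(W/U), by which the value of f at a fraction is replaced by an integer.
  hev : ∀ {n} → (Fin n → ℤ) → ℤ → ℤ → ℤ
  hev {zero}  f W U = 0ℤ
  hev {suc n} f W U = f zero * U ^ n + W * hev (f ∘ suc) W U

  hev-1 : ∀ {n} (f : Fin n → ℤ) Y → hev f Y 1ℤ ≡ ev f Y
  hev-1 {zero}  f Y = refl
  hev-1 {suc n} f Y = cong₂ (λ s t → s + Y * t)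
    (trans (cong (f zero *_) (ℤₚ.^-zeroˡ n)) (ℤₚ.*-identityʳ (f zero))) (hev-1 (f ∘ suc) Y)

  -- The extra factor U on the left turns the exponent n - 1 into n, so that the recursion also
  -- works for n = 0.
  hev-cong : ∀ {k U W Y} → k ∣ W - U * Y → ∀ {n} (f : Fin n → ℤ) → k ∣ U * hev f W U - U ^ n * ev f Y
  hev-cong {k} {U} h {zero} f = subst (k ∣_) (lem U) ∣-0
    where
    lem : ∀ U → 0ℤ ≡ U * 0ℤ - 1ℤ * 0ℤ
    lem = solve-∀
  hev-cong {k} {U} {W} {Y} h {suc n} f = subst (k ∣_)
    (lem U W Y (f zero) (U ^ n) (hev (f ∘ suc) W U) (ev (f ∘ suc) Y))
    (∣m∣n⇒∣m+n (∣n⇒∣m*n W (hev-cong {k} {U} {W} {Y} h (f ∘ suc))) (∣m⇒∣m*n (U ^ n * ev (f ∘ suc) Y) h))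
    where
    lem : ∀ U W Y a u r s → W * (U * r - u * s) + (W - U * Y) * (u * s) ≡
                            U * (a * u + W * r) - U * u * (a + Y * s)
    lem = solve-∀

  ∣hev∣≤ : ∀ {C D W U} → 1 ≤ D → ∣ W ∣ ≤ D → ∣ U ∣ ≤ D → ∀ {n} (f : Fin n → ℤ) → (∀ i → ∣ f i ∣ ≤ C) →
           ∣ hev f W U ∣ ≤ n ℕ.* (C ℕ.* D ℕ.^ n)
  ∣hev∣≤ 1≤D W≤ U≤ {zero} f h = z≤n
  ∣hev∣≤ {C} {D} {W} {U} 1≤D W≤ U≤ {suc n} f h = begin
    ∣ f zero * U ^ n + W * hev (f ∘ suc) W U ∣
      ≤⟨ ℤₚ.∣i+j∣≤∣i∣+∣j∣ (f zero * U ^ n) _ ⟩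
    ∣ f zero * U ^ n ∣ ℕ.+ ∣ W * hev (f ∘ suc) W U ∣
      ≡⟨ cong₂ ℕ._+_ (trans (ℤₚ.abs-* (f zero) (U ^ n)) (cong (∣ f zero ∣ ℕ.*_) (abs-^ U n))) (ℤₚ.abs-* W _) ⟩
    ∣ f zero ∣ ℕ.* ∣ U ∣ ℕ.^ n ℕ.+ ∣ W ∣ ℕ.* ∣ hev (f ∘ suc) W U ∣
      ≤⟨ ℕₚ.+-mono-≤ (ℕₚ.*-mono-≤ (h zero) (ℕₚ.≤-trans (ℕₚ.^-monoˡ-≤ n U≤) (ℕₚ.m≤n*m (D ℕ.^ n) D {{ℕ.>-nonZero 1≤D}})))
           (ℕₚ.*-mono-≤ W≤ (∣hev∣≤ 1≤D W≤ U≤ (f ∘ suc) (h ∘ suc))) ⟩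
    C ℕ.* D ℕ.^ suc n ℕ.+ D ℕ.* (n ℕ.* (C ℕ.* D ℕ.^ n))
      ≡⟨ cong (C ℕ.* D ℕ.^ suc n ℕ.+_) (lem D n C (D ℕ.^ n)) ⟩
    suc n ℕ.* (C ℕ.* D ℕ.^ suc n) ∎
    where
    open ℕₚ.≤-Reasoning
    lem : ∀ D n C d → D ℕ.* (n ℕ.* (C ℕ.* d)) ≡ n ℕ.* (C ℕ.* (D ℕ.* d))
    lem D n C d = trans (ℕₚ.*-comm D _) (trans (ℕₚ.*-assoc n _ D)
      (cong (n ℕ.*_) (trans (ℕₚ.*-assoc C d D) (cong (C ℕ.*_) (ℕₚ.*-comm d D)))))

  ∣ev∣≤ : ∀ {C D Y} → 1 ≤ D → ∣ Y ∣ ≤ D → ∀ {n} (f : Fin n → ℤ) → (∀ i → ∣ f i ∣ ≤ C) →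
          ∣ ev f Y ∣ ≤ n ℕ.* (C ℕ.* D ℕ.^ n)
  ∣ev∣≤ {Y = Y} 1≤D Y≤ f h = subst (λ t → ∣ t ∣ ≤ _) (hev-1 f Y) (∣hev∣≤ 1≤D Y≤ 1≤D f h)

  -- Uniqueness of expansions in base Y: the lowest digit is a multiple of Y and smaller than ∣Y∣,
  -- hence zero, and Y can be divided out.
  digits-zero : ∀ {Y n} (f : Fin n → ℤ) → (∀ i → ∣ f i ∣ < ∣ Y ∣) → ev f Y ≡ 0ℤ → ∀ i → f i ≡ 0ℤ
  digits-zero {Y} {suc n} f h e = λ where
      zero    → trans (trans (lem (f zero) Y) (cong (λ t → f zero + Y * t) (sym rest0))) e
      (suc i) → digits-zero (f ∘ suc) (h ∘ suc) rest0 i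
    where
    r = ev (f ∘ suc) Y
    lem : ∀ a Y → a ≡ a + Y * 0ℤ
    lem = solve-∀
    lem₂ : ∀ a b → a ≡ (a + b) - b
    lem₂ = solve-∀
    size : ∣ f zero ∣ ≡ ∣ Y ∣ ℕ.* ∣ r ∣
    size = trans (cong ∣_∣ (trans (lem₂ (f zero) (Y * r)) (trans (cong (_- Y * r) e) (ℤₚ.+-identityˡ (- (Y * r))))))
           (trans (ℤₚ.∣-i∣≡∣i∣ (Y * r)) (ℤₚ.abs-* Y r))
    small : ∀ b → ∣ Y ∣ ℕ.* b < ∣ Y ∣ → b ≡ 0
    small zero    _ = refl
    small (suc b) l = ⊥-elim (ℕₚ.<⇒≱ l (ℕₚ.m≤m*n ∣ Y ∣ (suc b)))
    rest0 : r ≡ 0ℤ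
    rest0 = ℤₚ.∣i∣≡0⇒i≡0 (small ∣ r ∣ (subst (_< ∣ Y ∣) size (h zero)))

  -- Inverses modulo prime powers and the valuation of factorials

  pos-^ : ∀ p e → + (p ℕ.^ e) ≡ (+ p) ^ e
  pos-^ p zero    = refl
  pos-^ p (suc e) = trans (ℤₚ.pos-* p (p ℕ.^ e)) (cong (+ p *_) (pos-^ p e))

  ∤⇒coprime : ∀ {p m} → Prime p → ¬ p ℕ∣.∣ m → Coprime m p
  ∤⇒coprime pp p∤m (d∣m , d∣p) with prime⇒irreducible pp d∣p
  ... | inj₁ d≡1  = d≡1
  ... | inj₂ refl = ⊥-elim (p∤m d∣m)

  inverse-mod : ∀ {p} → Prime p → ∀ {m} → ¬ p ℕ∣.∣ m → ∃ λ u → + p ∣ + m * u - 1ℤ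
  inverse-mod {p} pp {m} p∤m with coprime-Bézout (∤⇒coprime pp p∤m)
  ... | Bézout.+- x y eq = + x , divides (+ y)
    (trans (cong (_- 1ℤ) (trans (sym (ℤₚ.pos-* m x)) (trans (cong +_ (trans (ℕₚ.*-comm m x) (sym eq)))
       (cong (λ i → 1ℤ + i) (ℤₚ.pos-* y p))))) (lem (+ y * + p)))
    where
    lem : ∀ a → 1ℤ + a - 1ℤ ≡ a
    lem = solve-∀
  ... | Bézout.-+ x y eq = - (+ x) , divides (- (+ y))
    (trans (lem (+ m) (+ x)) (trans (cong -_ (trans (cong (λ i → 1ℤ + i) (sym (ℤₚ.pos-* x m)))
       (trans (cong +_ eq) (ℤₚ.pos-* y p)))) (ℤₚ.neg-distribˡ-* (+ y) (+ p))))
    where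
    lem : ∀ m x → m * - x - 1ℤ ≡ - (1ℤ + x * m)
    lem = solve-∀

  -- If a and b invert m with errors m a - 1 and m b - 1, then a + b - m a b inverts it with minus
  -- the product of these errors.
  inverse-mod-^ : ∀ {p} → Prime p → ∀ e {m} → ¬ p ℕ∣.∣ m → ∃ λ u → (+ p) ^ e ∣ + m * u - 1ℤ
  inverse-mod-^ pp zero {m} p∤m = 0ℤ , divides (+ m * 0ℤ - 1ℤ) (sym (ℤₚ.*-identityʳ _))
  inverse-mod-^ {p} pp (suc e) {m} p∤m with inverse-mod pp p∤m | inverse-mod-^ pp e p∤m
  ... | a , divides s sq | b , divides t tq = a + b - + m * a * b ,
    divides (- (s * t)) (trans (lem (+ m) a b) (trans (cong₂ (λ x y → - (x * y)) sq tq) (lem₂ s t (+ p) ((+ p) ^ e))))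
    where
    lem : ∀ m a b → m * (a + b - m * a * b) - 1ℤ ≡ - ((m * a - 1ℤ) * (m * b - 1ℤ))
    lem = solve-∀
    lem₂ : ∀ s t p q → - (s * p * (t * q)) ≡ - (s * t) * (p * q)
    lem₂ = solve-∀

  ∤-* : ∀ {p} → Prime p → ∀ {a b} → ¬ p ℕ∣.∣ a → ¬ p ℕ∣.∣ b → ¬ p ℕ∣.∣ a ℕ.* b
  ∤-* pp {a} {b} pa pb h with euclidsLemma a b pp h
  ... | inj₁ x = pa x
  ... | inj₂ x = pb x

  prime∤1 : ∀ {p} → Prime p → ¬ p ℕ∣.∣ 1
  prime∤1 pp h = ℕₚ.<⇒≢ (ℕ.nonTrivial⇒n>1 _ {{prime⇒nonTrivial pp}}) (sym (ℕ∣.∣1⇒≡1 h))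

  !-split : ∀ {p} → Prime p → ∀ t → ∃ λ q → ∃ λ r → ∃ λ m →
    t ≡ p ℕ.* q ℕ.+ r × r < p × t ! ≡ p ℕ.^ q ℕ.* (q !) ℕ.* m × ¬ p ℕ∣.∣ m
  !-split {p} pp zero = 0 , 0 , 1 , sym (trans (ℕₚ.+-identityʳ (p ℕ.* 0)) (ℕₚ.*-zeroʳ p)) ,
    ℕₚ.<-trans (s≤s z≤n) (ℕ.nonTrivial⇒n>1 p {{prime⇒nonTrivial pp}}) , refl , prime∤1 pp
  !-split {p} pp (suc t) with !-split pp t
  ... | q , r , m , teq , r<p , feq , p∤m with suc r ℕ.<? p
  ... | yes r+1<p = q , suc r , (suc t) ℕ.* m , seq , r+1<p ,
        trans (cong (suc t ℕ.*_) feq) (lem (suc t) (p ℕ.^ q ℕ.* (q !)) m) ,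
        ∤-* pp (λ h → ℕₚ.<⇒≱ r+1<p (ℕ∣.∣⇒≤ (ℕ∣.∣m+n∣m⇒∣n (subst (p ℕ∣.∣_) seq h) (ℕ∣.m∣m*n q)))) p∤m
    where
    seq : suc t ≡ p ℕ.* q ℕ.+ suc r
    seq = trans (cong suc teq) (sym (ℕₚ.+-suc (p ℕ.* q) r))
    lem : ∀ a b c → a ℕ.* (b ℕ.* c) ≡ b ℕ.* (a ℕ.* c)
    lem = solveℕ
  ... | no r+1≮p = suc q , 0 , m , seq , ℕₚ.<-trans (s≤s z≤n) (ℕ.nonTrivial⇒n>1 p {{prime⇒nonTrivial pp}}) ,
        trans (cong₂ ℕ._*_ (trans seq (ℕₚ.+-identityʳ _)) feq) (lem p q (p ℕ.^ q) (q !) m) , p∤m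
    where
    r+1≡p : suc r ≡ p
    r+1≡p = ℕₚ.≤-antisym r<p (ℕₚ.≮⇒≥ r+1≮p)
    seq : suc t ≡ p ℕ.* suc q ℕ.+ 0
    seq = trans (cong suc teq) (trans (sym (ℕₚ.+-suc (p ℕ.* q) r)) (trans (cong (p ℕ.* q ℕ.+_) r+1≡p)
      (trans (ℕₚ.+-comm (p ℕ.* q) p) (trans (sym (ℕₚ.*-suc p q)) (sym (ℕₚ.+-identityʳ _))))))
    lem : ∀ p q x y m → p ℕ.* suc q ℕ.* (x ℕ.* y ℕ.* m) ≡ p ℕ.* x ℕ.* (suc q ℕ.* y) ℕ.* m
    lem = solveℕ

  -- A crude form of Legendre's formula. By `!-split` the valuation is q + v with 3 q ≤ t and v ≤ q,
  -- so three times it is at most 6 q ≤ 2 t. It suffices because p^t / t! then has valuation at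
  -- least t / 3, which tends to infinity.
  !-valuation : ∀ {p} → Prime p → 3 ≤ p → ∀ t → ∃ λ v → ∃ λ m →
    t ! ≡ p ℕ.^ v ℕ.* m × ¬ p ℕ∣.∣ m × 3 ℕ.* v ≤ 2 ℕ.* t
  !-valuation {p} pp 3≤p t = go t t ℕₚ.≤-refl
    where
    go : ∀ n t → t ≤ n → ∃ λ v → ∃ λ m → t ! ≡ p ℕ.^ v ℕ.* m × ¬ p ℕ∣.∣ m × 3 ℕ.* v ≤ 2 ℕ.* t
    go n       zero    _ = 0 , 1 , refl , prime∤1 pp , z≤n
    go (suc n) (suc t) (s≤s t≤n) with !-split pp (suc t)
    ... | q , r , m , teq , r<p , feq , p∤m = merge (go n q (ℕₚ.≤-trans (q≤t q 3q≤) t≤n))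
      where
      3q≤ : 3 ℕ.* q ≤ suc t
      3q≤ = ℕₚ.≤-trans (ℕₚ.*-monoˡ-≤ q 3≤p) (subst (p ℕ.* q ≤_) (sym teq) (ℕₚ.m≤m+n _ r))
      q≤t : ∀ q → 3 ℕ.* q ≤ suc t → q ≤ t
      q≤t zero    _ = z≤n
      q≤t (suc q) h = ℕₚ.≤-trans (ℕₚ.≤-trans (ℕₚ.m≤m+n (suc q) (suc (q ℕ.+ q)))
                        (ℕₚ.≤-reflexive (lem₀ q))) (ℕₚ.≤-pred h)
        where
        lem₀ : ∀ q → suc q ℕ.+ suc (q ℕ.+ q) ≡ q ℕ.+ (suc q ℕ.+ (suc q ℕ.+ 0))
        lem₀ = solveℕ
      lem : ∀ a b c d → a ℕ.* (b ℕ.* c) ℕ.* d ≡ a ℕ.* b ℕ.* (c ℕ.* d)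
      lem = solveℕ
      merge : (∃ λ v → ∃ λ m → q ! ≡ p ℕ.^ v ℕ.* m × ¬ p ℕ∣.∣ m × 3 ℕ.* v ≤ 2 ℕ.* q) →
              ∃ λ v → ∃ λ m → suc t ! ≡ p ℕ.^ v ℕ.* m × ¬ p ℕ∣.∣ m × 3 ℕ.* v ≤ 2 ℕ.* suc t
      merge (v , m′ , qeq , p∤m′ , 3v≤) = q ℕ.+ v , m′ ℕ.* m ,
          trans feq (trans (cong (λ x → p ℕ.^ q ℕ.* x ℕ.* m) qeq)
            (trans (lem (p ℕ.^ q) (p ℕ.^ v) m′ m) (cong (ℕ._* (m′ ℕ.* m)) (sym (ℕₚ.^-distribˡ-+-* p q v))))) ,
          ∤-* pp p∤m′ p∤m , bd
        where
        open ℕₚ.≤-Reasoning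
        bd : 3 ℕ.* (q ℕ.+ v) ≤ 2 ℕ.* suc t
        bd = begin
          3 ℕ.* (q ℕ.+ v)         ≡⟨ ℕₚ.*-distribˡ-+ 3 q v ⟩
          3 ℕ.* q ℕ.+ 3 ℕ.* v     ≤⟨ ℕₚ.+-monoʳ-≤ (3 ℕ.* q) (ℕₚ.≤-trans 3v≤ (ℕₚ.*-monoˡ-≤ q (s≤s (s≤s (z≤n {1}))))) ⟩
          3 ℕ.* q ℕ.+ 3 ℕ.* q     ≤⟨ ℕₚ.+-mono-≤ 3q≤ 3q≤ ⟩
          suc t ℕ.+ suc t         ≡⟨ cong (suc t ℕ.+_) (sym (ℕₚ.+-identityʳ (suc t))) ⟩
          2 ℕ.* suc t             ∎

  -- Newton interpolation of p-adic powers

  abstract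
    -- Newton coefficients pᵗ/t! of p-adic (1 + p²z)ˣ, approximated by integers modulo p^B.
    newton-coef : ∀ {p} → Prime p → 3 ≤ p → ∀ B t → ∃ λ d →
      (+ p) ^ (t ℕ.+ B) ∣ + (t !) * d - (+ p) ^ t × (3 ℕ.* B ≤ t → (+ p) ^ B ∣ d)
    newton-coef {p} pp 3≤p B t with !-valuation pp 3≤p t
    ... | v , m , feq , p∤m , 3v≤2t with inverse-mod-^ pp B p∤m
    ... | u , divides s sq = (+ p) ^ (t ℕ.∸ v) * u , divides s eq , λ 3B≤t →
          ∣m⇒∣m*n u (^-monoʳ-∣ (+ p) (ℕₚ.m+n≤o⇒m≤o∸n B (subst (_≤ t) (ℕₚ.+-comm v B) (ℕₚ.*-cancelˡ-≤ 3 (B≤ 3B≤t)))))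
      where
      v≤t : v ≤ t
      v≤t = ℕₚ.*-cancelˡ-≤ 3 (ℕₚ.≤-trans 3v≤2t (ℕₚ.*-monoˡ-≤ t (s≤s (s≤s (z≤n {1})))))
      B≤ : 3 ℕ.* B ≤ t → 3 ℕ.* (v ℕ.+ B) ≤ 3 ℕ.* t
      B≤ 3B≤t = ℕₚ.≤-trans (ℕₚ.≤-reflexive (ℕₚ.*-distribˡ-+ 3 v B))
        (ℕₚ.≤-trans (ℕₚ.+-mono-≤ 3v≤2t 3B≤t) (ℕₚ.≤-reflexive (ℕₚ.+-comm (2 ℕ.* t) t)))
      πt : (+ p) ^ t ≡ (+ p) ^ v * (+ p) ^ (t ℕ.∸ v)
      πt = trans (cong ((+ p) ^_) (sym (ℕₚ.m+[n∸m]≡n v≤t))) (ℤₚ.^-distribˡ-+-* (+ p) v (t ℕ.∸ v))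
      lem : ∀ a b m u → a * m * (b * u) - a * b ≡ a * b * (m * u - 1ℤ)
      lem = solve-∀
      lem₂ : ∀ a s q → a * (s * q) ≡ s * (a * q)
      lem₂ = solve-∀
      open ≡-Reasoning
      eq : + (t !) * ((+ p) ^ (t ℕ.∸ v) * u) - (+ p) ^ t ≡ s * (+ p) ^ (t ℕ.+ B)
      eq = begin
        + (t !) * ((+ p) ^ (t ℕ.∸ v) * u) - (+ p) ^ t
          ≡⟨ cong₂ (λ f e → f * ((+ p) ^ (t ℕ.∸ v) * u) - e)
              (trans (cong +_ feq) (trans (ℤₚ.pos-* (p ℕ.^ v) m) (cong (_* + m) (pos-^ p v)))) πt ⟩
        (+ p) ^ v * + m * ((+ p) ^ (t ℕ.∸ v) * u) - (+ p) ^ v * (+ p) ^ (t ℕ.∸ v)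
          ≡⟨ lem ((+ p) ^ v) ((+ p) ^ (t ℕ.∸ v)) (+ m) u ⟩
        (+ p) ^ v * (+ p) ^ (t ℕ.∸ v) * (+ m * u - 1ℤ)
          ≡⟨ cong₂ _*_ (sym πt) sq ⟩
        (+ p) ^ t * (s * (+ p) ^ B)
          ≡⟨ lem₂ ((+ p) ^ t) s ((+ p) ^ B) ⟩
        s * ((+ p) ^ t * (+ p) ^ B)
          ≡⟨ cong (s *_) (sym (ℤₚ.^-distribˡ-+-* (+ p) t B)) ⟩
        s * (+ p) ^ (t ℕ.+ B) ∎

  -- The product y (y - k) ... (y - (t - 1) k). For k = p and y = p x it is p^t x (x - 1) ... (x - t
  -- + 1), so the binomial term (p² z)^t C(x, t) equals (p^t / t!) z^t times it.
  fallingPoly : ℤ → ℕ → List ℤ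
  fallingPoly k zero    = 1ℤ ∷ []
  fallingPoly k (suc t) = shift 1 (fallingPoly k t) ⊞ map (- (+ t * k) *_) (fallingPoly k t)

  eval-falling : ∀ k t y → eval (fallingPoly k (suc t)) y ≡ (y - + t * k) * eval (fallingPoly k t) y
  eval-falling k t y = trans (eval-⊞ (shift 1 F) (map (- (+ t * k) *_) F) y)
    (trans (cong₂ _+_ (eval-shift 1 F y) (eval-scale (- (+ t * k)) F y)) (lem y (+ t * k) (eval F y)))
    where
    F = fallingPoly k t
    lem : ∀ y a e → y * 1ℤ * e + - a * e ≡ (y - a) * e
    lem = solve-∀

  falling-shift : ∀ k t y → eval (fallingPoly k (suc t)) (y + k) ≡ (y + k) * eval (fallingPoly k t) y
  falling-shift k zero y = trans (eval-falling k 0 (y + k)) (lem k y)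
    where
    lem : ∀ k y → (y + k - 0ℤ * k) * (1ℤ + (y + k) * 0ℤ) ≡ (y + k) * (1ℤ + y * 0ℤ)
    lem = solve-∀
  falling-shift k (suc t) y = trans (eval-falling k (suc t) (y + k))
    (trans (cong (λ s → (y + k - + suc t * k) * s) (falling-shift k t y))
    (trans (lem k y (+ t) (eval (fallingPoly k t) y)) (cong ((y + k) *_) (sym (eval-falling k t y)))))
    where
    lem : ∀ k y t e → (y + k - (1ℤ + t) * k) * ((y + k) * e) ≡ (y + k) * ((y - t * k) * e)
    lem = solve-∀

  falling-Δ : ∀ k t y → eval (fallingPoly k (suc t)) (y + k) - eval (fallingPoly k (suc t)) y
                        ≡ + suc t * k * eval (fallingPoly k t) y
  falling-Δ k t y = trans (cong₂ _-_ (falling-shift k t y) (eval-falling k t y)) (lem k y (+ t) (eval (fallingPoly k t) y))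
    where
    lem : ∀ k y t e → (y + k) * e - (y - t * k) * e ≡ (1ℤ + t) * k * e
    lem = solve-∀

  falling-0 : ∀ k t → eval (fallingPoly k (suc t)) 0ℤ ≡ 0ℤ
  falling-0 k zero = trans (eval-falling k 0 0ℤ) (lem k)
    where
    lem : ∀ k → (0ℤ - 0ℤ * k) * (1ℤ + 0ℤ * 0ℤ) ≡ 0ℤ
    lem = solve-∀
  falling-0 k (suc t) = trans (eval-falling k (suc t) 0ℤ)
    (trans (cong ((0ℤ - + suc t * k) *_) (falling-0 k t)) (ℤₚ.*-zeroʳ (0ℤ - + suc t * k)))

  module Newton {p} (pp : Prime p) (3≤p : 3 ≤ p) (B : ℕ) (z : ℤ) (d : ℕ → ℤ)
    (d-val : ∀ t → (+ p) ^ (t ℕ.+ B) ∣ + (t !) * d t - (+ p) ^ t)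
    (d-small : ∀ t → 3 ℕ.* B ≤ t → (+ p) ^ B ∣ d t) where
    private
      π = + p

    -- For d t = p^t / t! this would be an equality. The approximations satisfy it after
    -- multiplication by t! = p^v m; the surplus t in the exponent of `d-val` covers p^v, and m is a
    -- unit.
    newton-rec : ∀ t → π ^ B ∣ + suc t * d (suc t) - π * d t
    newton-rec t with !-valuation pp 3≤p t
    ... | v , m , feq , p∤m , 3v≤2t =
      unit-cancel pp {+ m} p∤m B
        (*-cancelˡ-∣ (π ^ v) {{ℤ.≢-nonZero (λ e → ℕ.≢-nonZero⁻¹ p {{prime⇒nonZero pp}} (ℤₚ.+-injective (ℤₚ.i^n≡0⇒i≡0 π v e)))}}
          (subst₂ _∣_ (ℤₚ.^-distribˡ-+-* π v B) eq
            (∣-trans (^-monoʳ-∣ π (ℕₚ.+-monoˡ-≤ B (ℕₚ.≤-trans v≤t (ℕₚ.n≤1+n t))))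
              (∣m∣n⇒∣m-n (d-val (suc t))
                 (*-monoʳ-∣ π (d-val t))))))
      where
      v≤t : v ≤ t
      v≤t = ℕₚ.*-cancelˡ-≤ 3 (ℕₚ.≤-trans 3v≤2t (ℕₚ.*-monoˡ-≤ t (s≤s (s≤s (z≤n {1})))))
      lem : ∀ T s f x y π → T * f * x - π * s - π * (f * y - s) ≡ f * (T * x - π * y)
      lem = solve-∀
      eq : + (suc t !) * d (suc t) - π ^ suc t - π * (+ (t !) * d t - π ^ t) ≡ π ^ v * (+ m * (+ suc t * d (suc t) - π * d t))
      eq = trans (cong (λ F → F * d (suc t) - π ^ suc t - π * (+ (t !) * d t - π ^ t)) (ℤₚ.pos-* (suc t) (t !)))
           (trans (lem (+ suc t) (π ^ t) (+ (t !)) (d (suc t)) (d t) π)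
           (trans (cong (_* (+ suc t * d (suc t) - π * d t)) (trans (cong +_ feq)
               (trans (ℤₚ.pos-* (p ℕ.^ v) m) (cong (_* + m) (pos-^ p v)))))
             (ℤₚ.*-assoc (π ^ v) (+ m) _)))

    newtonPoly : ℕ → List ℤ
    newtonPoly zero    = []
    newtonPoly (suc t) = newtonPoly t ⊞ map (d t * z ^ t *_) (fallingPoly π t)

    eval-newton : ∀ t y → eval (newtonPoly (suc t)) y ≡ eval (newtonPoly t) y + d t * z ^ t * eval (fallingPoly π t) y
    eval-newton t y = trans (eval-⊞ (newtonPoly t) (map (d t * z ^ t *_) (fallingPoly π t)) y) (cong (_+_ (eval (newtonPoly t) y)) (eval-scale (d t * z ^ t) (fallingPoly π t) y))

    -- The difference operator lowers the index of a falling polynomial by one, and `newton-rec`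
    -- matches the resulting coefficients. This is the discrete analogue of the differential
    -- equation of an exponential.
    newton-Δ : ∀ t y → π ^ B ∣ eval (newtonPoly (suc t)) (y + π) - eval (newtonPoly (suc t)) y - π * π * z * eval (newtonPoly t) y
    newton-Δ zero y = subst (π ^ B ∣_) (lem π y (d 0) z) ∣-0
      where
      lem : ∀ π y d z → 0ℤ ≡ d * 1ℤ * 1ℤ + (y + π) * 0ℤ - (d * 1ℤ * 1ℤ + y * 0ℤ) - π * π * z * 0ℤ
      lem = solve-∀
    newton-Δ (suc t) y = subst (π ^ B ∣_) (sym eq)
      (∣m∣n⇒∣m+n (newton-Δ t y) (∣m⇒∣m*n (z * z ^ t * π * eval (fallingPoly π t) y) (newton-rec t)))
      where
      N = λ t y → eval (newtonPoly t) y
      f = λ t y → eval (fallingPoly π t) y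
      lem : ∀ a b c d z z′ π T d′ e g h → a + d * (z * z′) * e - (b + d * (z * z′) * g) - π * π * z * (c + d′ * z′ * h)
             ≡ a - b - π * π * z * c + (d * (z * z′) * (e - g) - π * π * z * (d′ * z′ * h))
      lem = solve-∀
      lem₂ : ∀ X d z z′ π T d′ h → X + (d * (z * z′) * (T * π * h) - π * π * z * (d′ * z′ * h))
             ≡ X + (T * d - π * d′) * (z * z′ * π * h)
      lem₂ = solve-∀
      eq : N (suc (suc t)) (y + π) - N (suc (suc t)) y - π * π * z * N (suc t) y ≡
           N (suc t) (y + π) - N (suc t) y - π * π * z * N t y + (+ suc t * d (suc t) - π * d t) * (z * z ^ t * π * f t y)
      eq = trans (cong₂ _-_ (cong₂ _-_ (eval-newton (suc t) (y + π)) (eval-newton (suc t) y)) (cong (π * π * z *_) (eval-newton t y)))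
           (trans (lem (N (suc t) (y + π)) (N (suc t) y) (N t y) (d (suc t)) z (z ^ t) π (+ suc t) (d t) (f (suc t) (y + π)) (f (suc t) y) (f t y))
           (trans (cong (λ D → N (suc t) (y + π) - N (suc t) y - π * π * z * N t y + (d (suc t) * (z * z ^ t) * D - π * π * z * (d t * z ^ t * f t y)))
              (falling-Δ π t y))
           (lem₂ (N (suc t) (y + π) - N (suc t) y - π * π * z * N t y) (d (suc t)) z (z ^ t) π (+ suc t) (d t) (f t y))))

    newton-0 : ∀ t → eval (newtonPoly (suc t)) 0ℤ ≡ d 0
    newton-0 zero    = lem (d 0)
      where
      lem : ∀ d → d * 1ℤ * 1ℤ + 0ℤ * 0ℤ ≡ d
      lem = solve-∀
    newton-0 (suc t) = trans (eval-newton (suc t) 0ℤ)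
      (trans (cong₂ (λ a b → a + d (suc t) * z ^ suc t * b) (newton-0 t) (falling-0 π t))
        (trans (cong (_+_ (d 0)) (ℤₚ.*-zeroʳ (d (suc t) * z ^ suc t))) (ℤₚ.+-identityʳ (d 0))))

    -- By `newton-Δ`, a step from x to x + 1 multiplies E by G up to the last term of the Newton
    -- sum. Cutting at T = 3 B makes the coefficient d T of that term divisible by p^B, so induction
    -- on x applies.
    power-polynomial : ∃ λ E → ∀ x → π ^ B ∣ eval E (π * + x) - (1ℤ + π * π * z) ^ x
    power-polynomial = E , go
      where
      T = 3 ℕ.* B
      E = newtonPoly (suc T)
      G = 1ℤ + π * π * z
      d0 : π ^ B ∣ d 0 - 1ℤ
      d0 = subst (π ^ B ∣_) (cong (_- 1ℤ) (ℤₚ.*-identityˡ (d 0))) (d-val 0)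
      go : ∀ x → π ^ B ∣ eval E (π * + x) - G ^ x
      go zero = subst (π ^ B ∣_) (sym (cong (_- 1ℤ) (trans (cong (eval E) (ℤₚ.*-zeroʳ π)) (newton-0 T)))) d0
      go (suc x) = subst (π ^ B ∣_)
        (trans (lem (eval E (y + π)) (eval E y) (eval (newtonPoly T) y) (G ^ x) π z (d T) (z ^ T) (eval (fallingPoly π T) y))
          (trans (cong (λ D → eval E (y + π) - G * G ^ x - π * π * z * (eval (newtonPoly T) y + d T * z ^ T * eval (fallingPoly π T) y - D)) (eval-newton T y))
          (trans (lem₃ (eval E (y + π) - G * G ^ x) (π * π * z) (eval (newtonPoly T) y + d T * z ^ T * eval (fallingPoly π T) y))
          (cong (λ y′ → eval E y′ - G ^ suc x) (lem₂ π (+ x))))))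
        (∣m∣n⇒∣m-n (∣m∣n⇒∣m+n (newton-Δ T y) (∣n⇒∣m*n G (go x)))
           (∣n⇒∣m*n (π * π * z) (∣m⇒∣m*n (eval (fallingPoly π T) y) (∣m⇒∣m*n (z ^ T) (d-small T ℕₚ.≤-refl)))))
        where
        y = π * + x
        lem : ∀ A e n g π z d q f → A - e - π * π * z * n + (1ℤ + π * π * z) * (e - g) - π * π * z * (d * q * f)
              ≡ A - (1ℤ + π * π * z) * g - π * π * z * (n + d * q * f - e)
        lem = solve-∀
        lem₂ : ∀ π x → π * x + π ≡ π * (1ℤ + x)
        lem₂ = solve-∀
        lem₃ : ∀ A k n → A - k * (n - n) ≡ A
        lem₃ = solve-∀

  abstract
    power-poly : ∀ {p} → Prime p → 3 ≤ p → ∀ B z →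
      ∃ λ E → ∀ x → (+ p) ^ B ∣ eval E (+ p * + x) - (1ℤ + + p * + p * z) ^ x
    power-poly pp 3≤p B z = Newton.power-polynomial pp 3≤p B z (λ t → proj₁ (newton-coef pp 3≤p B t))
      (λ t → proj₁ (proj₂ (newton-coef pp 3≤p B t))) (λ t → proj₂ (proj₂ (newton-coef pp 3≤p B t)))

  -- Siegel's lemma and the auxiliary polynomial

  %ℕ≡⇒∣ : ∀ d .{{_ : ℕ.NonZero d}} a b → a %ℕ d ≡ b %ℕ d → + d ∣ a - b
  %ℕ≡⇒∣ d a b eq = divides (a /ℕ d - b /ℕ d)
    (trans (cong₂ _-_ (a≡a%ℕn+[a/ℕn]*n a d) (a≡a%ℕn+[a/ℕn]*n b d))
    (trans (cong (λ r → + (a %ℕ d) + (a /ℕ d) * + d - (+ r + (b /ℕ d) * + d)) (sym eq))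
      (lem (+ (a %ℕ d)) (a /ℕ d) (b /ℕ d) (+ d))))
    where
    lem : ∀ r x y d → r + x * d - (r + y * d) ≡ (x - y) * d
    lem = solve-∀

  finToFun-injective : ∀ {m n} (i j : Fin (m ℕ.^ n)) → (∀ x → finToFun {m} {n} i x ≡ finToFun {m} {n} j x) → i ≡ j
  finToFun-injective {m} {zero}  zero zero h = refl
  finToFun-injective {m} {suc n} i j h =
    trans (sym (Finₚ.combine-remQuot {m} (m ℕ.^ n) i))
    (trans (cong₂ combine (h zero) (finToFun-injective {m} {n} (remainder {m} (m ℕ.^ n) i) (remainder {m} (m ℕ.^ n) j) (h ∘ suc)))
           (Finₚ.combine-remQuot {m} (m ℕ.^ n) j))

  -- There are more vectors with entries below X than residue vectors modulo D, so two of them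
  -- collide, and their difference is the solution. Compatibility of r with differences is all the
  -- linearity that this takes.
  siegel : ∀ X D .{{_ : ℕ.NonZero D}} N H (r : (Fin N → ℤ) → ℕ → ℤ) →
    (∀ a b t → r (λ i → a i - b i) t ≡ r a t - r b t) → D ℕ.^ H < X ℕ.^ N →
    ∃ λ (c : Fin N → ℤ) → ¬ (∀ i → c i ≡ 0ℤ) × (∀ i → ∣ c i ∣ ≤ X) × (∀ t → t < H → + D ∣ r c t)
  siegel X D N H r r-sub lt with Finₚ.pigeonhole lt residues
    where
    vec : Fin (X ℕ.^ N) → Fin N → ℤ
    vec k i = + toℕ (finToFun {X} {N} k i)
    residues : Fin (X ℕ.^ N) → Fin (D ℕ.^ H)
    residues k = funToFin {H} {D} (λ t → fromℕ< (n%ℕd<d (r (vec k) (toℕ t)) D))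
  ... | k , l , k<l , eq = c , nz , small , div
    where
    vec : Fin (X ℕ.^ N) → Fin N → ℤ
    vec k i = + toℕ (finToFun {X} {N} k i)
    c : Fin N → ℤ
    c i = vec k i - vec l i
    nz : ¬ (∀ i → c i ≡ 0ℤ)
    nz z = ℕₚ.<⇒≢ k<l (cong toℕ (finToFun-injective {X} {N} k l
      (λ i → Finₚ.toℕ-injective (ℤₚ.+-injective (ℤₚ.i-j≡0⇒i≡j (vec k i) (vec l i) (z i))))))
    small : ∀ i → ∣ c i ∣ ≤ X
    small i = subst (λ t → ∣ t ∣ ≤ X) (sym (ℤₚ.m-n≡m⊖n (toℕ (finToFun {X} {N} k i)) (toℕ (finToFun {X} {N} l i))))
      (ℕₚ.≤-trans (ℤₚ.∣m⊝n∣≤m⊔n (toℕ (finToFun {X} {N} k i)) (toℕ (finToFun {X} {N} l i)))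
        (ℕₚ.⊔-lub (ℕₚ.<⇒≤ (Finₚ.toℕ<n (finToFun {X} {N} k i))) (ℕₚ.<⇒≤ (Finₚ.toℕ<n (finToFun {X} {N} l i)))))
    res : Fin (X ℕ.^ N) → Fin H → Fin D
    res k t = fromℕ< (n%ℕd<d (r (vec k) (toℕ t)) D)
    div : ∀ t → t < H → + D ∣ r c t
    div t t<H = subst (+ D ∣_) (sym (r-sub (vec k) (vec l) t))
      (%ℕ≡⇒∣ D (r (vec k) t) (r (vec l) t)
        (trans (cong (λ x → r (vec k) x %ℕ D) (sym (Finₚ.toℕ-fromℕ< t<H)))
        (trans (trans (sym (Finₚ.toℕ-fromℕ< (n%ℕd<d (r (vec k) (toℕ τ)) D)))
          (trans (cong toℕ same) (Finₚ.toℕ-fromℕ< (n%ℕd<d (r (vec l) (toℕ τ)) D))))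
        (cong (λ x → r (vec l) x %ℕ D) (Finₚ.toℕ-fromℕ< t<H)))))
      where
      τ = fromℕ< t<H
      same : res k τ ≡ res l τ
      same = trans (sym (Finₚ.finToFun-funToFin {H} {D} (res k) τ))
        (trans (cong (λ e → finToFun {D} {H} e τ) eq) (Finₚ.finToFun-funToFin {H} {D} (res l) τ))

  mulPoly : ∀ {K} → (Fin K → ℤ) → List ℤ → List ℤ
  mulPoly {zero}  c E = []
  mulPoly {suc K} c E = map (c zero *_) E ⊞ shift 1 (mulPoly (c ∘ suc) E)

  eval-mulPoly : ∀ {K} (c : Fin K → ℤ) E y → eval (mulPoly c E) y ≡ ev c y * eval E y
  eval-mulPoly {zero}  c E y = refl
  eval-mulPoly {suc K} c E y = trans (eval-⊞ (map (c zero *_) E) _ y)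
    (trans (cong₂ _+_ (eval-scale (c zero) E y)
       (trans (eval-shift 1 (mulPoly (c ∘ suc) E) y) (cong (y ^ 1 *_) (eval-mulPoly (c ∘ suc) E y))))
     (lem (c zero) y (ev (c ∘ suc) y) (eval E y)))
    where
    lem : ∀ c y v e → c * e + y * 1ℤ * (v * e) ≡ (c + y * v) * e
    lem = solve-∀

  coef-mulPoly-sub : ∀ {K} (a b : Fin K → ℤ) E t →
    coef (mulPoly (λ i → a i - b i) E) t ≡ coef (mulPoly a E) t - coef (mulPoly b E) t
  coef-mulPoly-sub {zero}  a b E t = refl
  coef-mulPoly-sub {suc K} a b E t =
    trans (coef-⊞ (map ((a zero - b zero) *_) E) _ t)
    (trans (cong₂ _+_ (coef-scale (a zero - b zero) E t) (shifted t))
    (trans (lem (a zero) (b zero) (coef E t) (coef (shift 1 (mulPoly (a ∘ suc) E)) t) (coef (shift 1 (mulPoly (b ∘ suc) E)) t))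
    (cong₂ _-_ (sym (part a)) (sym (part b)))))
    where
    lem : ∀ a b e x y → (a - b) * e + (x - y) ≡ a * e + x - (b * e + y)
    lem = solve-∀
    part : ∀ (a : Fin (suc K) → ℤ) → coef (mulPoly a E) t ≡ a zero * coef E t + coef (shift 1 (mulPoly (a ∘ suc) E)) t
    part a = trans (coef-⊞ (map (a zero *_) E) _ t) (cong (_+ coef (shift 1 (mulPoly (a ∘ suc) E)) t) (coef-scale (a zero) E t))
    shifted : ∀ t → coef (shift 1 (mulPoly (λ i → a (suc i) - b (suc i)) E)) t ≡
                    coef (shift 1 (mulPoly (a ∘ suc) E)) t - coef (shift 1 (mulPoly (b ∘ suc) E)) t
    shifted zero    = refl
    shifted (suc t) = coef-mulPoly-sub (a ∘ suc) (b ∘ suc) E t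

  auxPoly : ∀ {L K} → (Fin L → Fin K → ℤ) → (ℕ → List ℤ) → List ℤ
  auxPoly {zero}  c E = []
  auxPoly {suc L} c E = mulPoly (c zero) (E 0) ⊞ auxPoly (c ∘ suc) (E ∘ suc)

  coef-auxPoly-sub : ∀ {L K} (a b : Fin L → Fin K → ℤ) E t →
    coef (auxPoly (λ j i → a j i - b j i) E) t ≡ coef (auxPoly a E) t - coef (auxPoly b E) t
  coef-auxPoly-sub {zero}  a b E t = refl
  coef-auxPoly-sub {suc L} a b E t =
    trans (coef-⊞ (mulPoly (λ i → a zero i - b zero i) (E 0)) _ t)
    (trans (cong₂ _+_ (coef-mulPoly-sub (a zero) (b zero) (E 0) t) (coef-auxPoly-sub (a ∘ suc) (b ∘ suc) (E ∘ suc) t))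
    (trans (lem (coef (mulPoly (a zero) (E 0)) t) (coef (mulPoly (b zero) (E 0)) t) (coef (auxPoly (a ∘ suc) (E ∘ suc)) t) (coef (auxPoly (b ∘ suc) (E ∘ suc)) t))
    (cong₂ _-_ (sym (coef-⊞ (mulPoly (a zero) (E 0)) _ t)) (sym (coef-⊞ (mulPoly (b zero) (E 0)) _ t)))))
    where
    lem : ∀ a b x y → a - b + (x - y) ≡ a + x - (b + y)
    lem = solve-∀

  -- The offset o records how many polynomials `E` have been split off, since the tail of the family
  -- starts at a higher power of Y.
  eval-auxPoly : ∀ {L K} (c : Fin L → Fin K → ℤ) E {k y Y} o → (∀ j → k ∣ eval (E j) y - Y ^ (o ℕ.+ j)) →
    k ∣ eval (auxPoly c E) y - Y ^ o * ev (λ j → ev (c j) y) Y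
  eval-auxPoly {zero}  c E {k} {y} {Y} o h = subst (k ∣_) (lem (Y ^ o)) ∣-0
    where
    lem : ∀ Y → 0ℤ ≡ 0ℤ - Y * 0ℤ
    lem = solve-∀
  eval-auxPoly {suc L} c E {k} {y} {Y} o h = subst (k ∣_) eq
    (∣m∣n⇒∣m+n (∣n⇒∣m*n f (subst (λ e → k ∣ eval (E 0) y - Y ^ e) (ℕₚ.+-identityʳ o) (h 0)))
      (eval-auxPoly (c ∘ suc) (E ∘ suc) {k} {y} {Y} (suc o) (λ j → subst (λ e → k ∣ eval (E (suc j)) y - Y ^ e) (ℕₚ.+-suc o j) (h (suc j)))))
    where
    f = ev (c zero) y
    g = ev (λ j → ev (c (suc j)) y) Y
    lem : ∀ f e q r g Y → f * (e - q) + (r - Y * q * g) ≡ f * e + r - q * (f + Y * g)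
    lem = solve-∀
    eq : f * (eval (E 0) y - Y ^ o) + (eval (auxPoly (c ∘ suc) (E ∘ suc)) y - Y * Y ^ o * g) ≡
         eval (auxPoly c E) y - Y ^ o * (f + Y * g)
    eq = trans (lem f (eval (E 0) y) (Y ^ o) (eval (auxPoly (c ∘ suc) (E ∘ suc)) y) g Y)
      (cong (_- Y ^ o * (f + Y * g)) (sym (trans (eval-⊞ (mulPoly (c zero) (E 0)) _ y)
        (cong (_+ eval (auxPoly (c ∘ suc) (E ∘ suc)) y) (eval-mulPoly (c zero) (E 0) y)))))

  -- The Gelfond-Schneider argument

  small∣⇒0 : ∀ {p} e {t} → (+ p) ^ e ∣ t → ∣ t ∣ < p ℕ.^ e → t ≡ 0ℤ
  small∣⇒0 {p} e {t} h lt with ∣ t ∣ in eq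
  ... | zero  = ℤₚ.∣i∣≡0⇒i≡0 eq
  ... | suc n = ⊥-elim (ℕₚ.<⇒≱ lt (ℕ∣.∣⇒≤ (subst (p ℕ.^ e ℕ∣.∣_) eq (∣⇒∣ℕ p e h))))

  ^-cong-∣ : ∀ {k x y} → k ∣ x - y → ∀ b → k ∣ x ^ b - y ^ b
  ^-cong-∣ h zero = ∣-0
  ^-cong-∣ {k} {x} {y} h (suc b) = subst (k ∣_) (lem x y (x ^ b) (y ^ b))
    (∣m∣n⇒∣m+n (∣n⇒∣m*n x (^-cong-∣ h b)) (∣m⇒∣m*n (y ^ b) h))
    where
    lem : ∀ x y a b → x * (a - b) + (x - y) * b ≡ x * a - y * b
    lem = solve-∀

  ^-distrib-* : ∀ a b e → (a * b) ^ e ≡ a ^ e * b ^ e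
  ^-distrib-* a b zero    = refl
  ^-distrib-* a b (suc e) = trans (cong (a * b *_) (^-distrib-* a b e)) (lem a b (a ^ e) (b ^ e))
    where
    lem : ∀ a b x y → a * b * (x * y) ≡ a * x * (b * y)
    lem = solve-∀

  1mod-^ : ∀ k z j → ∃ λ z′ → (1ℤ + k * z) ^ j ≡ 1ℤ + k * z′
  1mod-^ k z zero = 0ℤ , sym (cong (_+_ 1ℤ) (ℤₚ.*-zeroʳ k))
  1mod-^ k z (suc j) with 1mod-^ k z j
  ... | z′ , eq = z + z′ + k * z * z′ , trans (cong ((1ℤ + k * z) *_) eq) (lem k z z′)
    where
    lem : ∀ k z w → (1ℤ + k * z) * (1ℤ + k * w) ≡ 1ℤ + k * (z + w + k * z * w)
    lem = solve-∀

  ∤-^ : ∀ {p} → Prime p → ∀ {u} → ¬ p ℕ∣.∣ ∣ u ∣ → ∀ b → ¬ p ℕ∣.∣ ∣ u ^ b ∣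
  ∤-^ pp {u} p∤u zero    = prime∤1 pp
  ∤-^ {p} pp {u} p∤u (suc b) = λ h → ∤-* pp p∤u (∤-^ pp {u} p∤u b) (subst (p ℕ∣.∣_) (ℤₚ.abs-* u (u ^ b)) h)

  -- Lists the points a + b s with a < S and b < T by a single index below S T. For S ≤ s the list
  -- increases, so the points are distinct.
  node : ∀ S .{{_ : ℕ.NonZero S}} → ℕ → ℕ → ℕ
  node S s i = i % S ℕ.+ (i / S) ℕ.* s

  node-mono : ∀ S .{{_ : ℕ.NonZero S}} {s} → S ≤ s → ∀ {i j} → i < j → node S s i < node S s j
  node-mono S {s} S≤s {i} {j} i<j = subst₂ _<_ (sym (alt i)) (sym (alt j))
    (ℕₚ.+-mono-<-≤ i<j (ℕₚ.*-monoˡ-≤ (s ℕ.∸ S) (DivMod./-monoˡ-≤ S (ℕₚ.<⇒≤ i<j))))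
    where
    open ≡-Reasoning
    alt : ∀ i → node S s i ≡ i ℕ.+ (i / S) ℕ.* (s ℕ.∸ S)
    alt i = begin
      i % S ℕ.+ (i / S) ℕ.* s                                ≡⟨ cong (λ x → i % S ℕ.+ (i / S) ℕ.* x) (sym (ℕₚ.m+[n∸m]≡n S≤s)) ⟩
      i % S ℕ.+ (i / S) ℕ.* (S ℕ.+ (s ℕ.∸ S))                ≡⟨ cong (i % S ℕ.+_) (ℕₚ.*-distribˡ-+ (i / S) S (s ℕ.∸ S)) ⟩
      i % S ℕ.+ ((i / S) ℕ.* S ℕ.+ (i / S) ℕ.* (s ℕ.∸ S))    ≡⟨ sym (ℕₚ.+-assoc (i % S) _ _) ⟩
      i % S ℕ.+ (i / S) ℕ.* S ℕ.+ (i / S) ℕ.* (s ℕ.∸ S)      ≡⟨ cong (ℕ._+ (i / S) ℕ.* (s ℕ.∸ S)) (sym (DivMod.m≡m%n+[m/n]*n i S)) ⟩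
      i ℕ.+ (i / S) ℕ.* (s ℕ.∸ S)                            ∎

  module _ {p} (pp : Prime p) (3≤p : 3 ≤ p) (z : ℤ) where
    private
      π = + p
      G = 1ℤ + π * π * z

    -- G^j is again congruent to 1 modulo p², so the interpolation of powers applies with base G^j.
    power-polys : ∀ k j → ∃ λ E → ∀ x → π ^ k ∣ eval E (π * + x) - (G ^ x) ^ j
    power-polys k j with 1mod-^ (π * π) z j
    ... | z′ , eq with power-poly pp 3≤p k z′
    ... | E , h = E , λ x → subst (λ t → π ^ k ∣ eval E (π * + x) - t)
      (trans (cong (_^ x) (sym eq)) (trans (ℤₚ.^-*-assoc G j x) (trans (cong (G ^_) (ℕₚ.*-comm j x)) (sym (ℤₚ.^-*-assoc G x j))))) (h x)

    -- Put F(x) = Σ c_ij (p x)ⁱ Gʲˣ with i < K, j < L.  Siegel's lemma yields small c_ij, not all zero, such that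
    -- p^H divides every F(x).  As Gˢ ≡ w/u, the value F(a + b s) becomes, after clearing u, an integer of moderate
    -- size modulo pᵏ; being divisible by p^H it vanishes for a < S, b < T.  Then F is divisible by pᵏ at S T nodes,
    -- so by the Schwarz lemma p^(S T) divides every F(x).  Hence F(x) = 0 for A ≤ x < A + K, and since Gˣ is
    -- larger than the inner sums, these vanish as well: polynomials of degree < K with K roots.
    gelfond : ∀ k (E : ℕ → List ℤ) → (∀ j x → π ^ k ∣ eval (E j) (π * + x) - (G ^ x) ^ j) →
      ∀ (u w : ℤ) s (L K H h S T λ′ M A : ℕ) .{{_ : ℕ.NonZero S}} →
      π ^ k ∣ u * G ^ s - w → ¬ p ℕ∣.∣ ∣ u ∣ → ∣ u ∣ ≤ M → ∣ w ∣ ≤ M → 1 ≤ M →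
      (p ℕ.^ H) ℕ.^ H < (p ℕ.^ h) ℕ.^ (L ℕ.* K) →
      H ≤ k → S ≤ s → S ℕ.+ T ℕ.* s ≤ p ℕ.^ λ′ → S ℕ.* T ℕ.+ S ℕ.* T ℕ.* suc λ′ ≤ k → 1 ≤ ∣ G ∣ →
      L ℕ.* ((K ℕ.* (p ℕ.^ h ℕ.* (p ℕ.^ suc λ′) ℕ.^ K)) ℕ.* (∣ G ∣ ℕ.^ S ℕ.* M ℕ.^ T) ℕ.^ L) < p ℕ.^ H →
      K ℕ.* (p ℕ.^ h ℕ.* (p ℕ.* (A ℕ.+ K)) ℕ.^ K) < ∣ G ∣ ℕ.^ A →
      L ℕ.* ((K ℕ.* (p ℕ.^ h ℕ.* (p ℕ.* (A ℕ.+ K)) ℕ.^ K)) ℕ.* (∣ G ∣ ℕ.^ (A ℕ.+ K)) ℕ.^ L) < p ℕ.^ (S ℕ.* T) →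
      1 ≤ A → ⊥
    gelfond k E E≈ u w s L K H h S T λ′ M A cong-k p∤u u≤ w≤ 1≤M count H≤k S≤s range depth 1≤G size₁ size₂ size₃ 1≤A
      with siegel (p ℕ.^ h) (p ℕ.^ H) {{ℕₚ.m^n≢0 p H {{prime⇒nonZero pp}}}} (L ℕ.* K) H
             (λ c t → coef (auxPoly {L} {K} (λ j i → c (combine j i)) E) t)
             (λ a b t → coef-auxPoly-sub {L} {K} (λ j i → a (combine j i)) (λ j i → b (combine j i)) E t)
             count
    ... | c₀ , c₀≢0 , c₀≤ , R-small = c₀≢0 λ ν → trans (cong c₀ (sym (Finₚ.combine-remQuot {L} K ν))) (c-zero (quotient K ν) (remainder {L} K ν))
      where
      instance p≢0 = prime⇒nonZero pp
      c : Fin L → Fin K → ℤ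
      c j i = c₀ (combine j i)
      R = auxPoly c E
      F : ℕ → ℤ
      F x = ev (λ j → ev (c j) (π * + x)) (G ^ x)
      F≈R : ∀ x → π ^ k ∣ eval R (π * + x) - F x
      F≈R x = subst (λ t → π ^ k ∣ eval R (π * + x) - t) (ℤₚ.*-identityˡ (F x))
        (eval-auxPoly c E {π ^ k} {π * + x} {G ^ x} 0 (λ j → E≈ j x))
      R⇒F : ∀ {e} x → e ≤ k → π ^ e ∣ eval R (π * + x) → π ^ e ∣ F x
      R⇒F {e} x e≤k h = subst (π ^ e ∣_) (lem (eval R (π * + x)) (F x)) (∣m∣n⇒∣m-n h (∣-trans (^-monoʳ-∣ π e≤k) (F≈R x)))
        where
        lem : ∀ a b → a - (a - b) ≡ b
        lem = solve-∀
      F⇒R : ∀ x → π ^ k ∣ F x → π ^ k ∣ eval R (π * + x)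
      F⇒R x h = subst (π ^ k ∣_) (lem (eval R (π * + x)) (F x)) (∣m∣n⇒∣m+n (F≈R x) h)
        where
        lem : ∀ a b → a - b + b ≡ a
        lem = solve-∀
      F-small : ∀ x → π ^ H ∣ F x
      F-small x = R⇒F x H≤k (eval-small π (+ x) R (λ t t<H → subst (_∣ coef R t) (pos-^ p H) (R-small t t<H)))
      row-bound : ∀ {D x} → 1 ≤ D → p ℕ.* x ≤ D → ∀ j → ∣ ev (c j) (π * + x) ∣ ≤ K ℕ.* (p ℕ.^ h ℕ.* D ℕ.^ K)
      row-bound {D} {x} 1≤D x≤ j = ∣ev∣≤ {Y = π * + x} 1≤D (subst (_≤ D) (sym (ℤₚ.abs-* π (+ x))) x≤) (c j) (λ i → c₀≤ (combine j i))
      F-node : ∀ a b → a < S → b < T → π ^ k ∣ eval R (π * + (a ℕ.+ b ℕ.* s))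
      F-node a b a<S b<T = F⇒R x (unit-cancel pp {U ^ L} (∤-^ pp {U} p∤U L) k
          (subst (π ^ k ∣_) (trans (cong (λ t → U * t - (U * t - U ^ L * F x)) hev≡0) (lem (U ^ L * F x) U))
            (∣m∣n⇒∣m-n (subst (λ t → π ^ k ∣ U * t) (sym hev≡0) (subst (π ^ k ∣_) (sym (ℤₚ.*-zeroʳ U)) ∣-0)) key)))
        where
        x = a ℕ.+ b ℕ.* s
        U = u ^ b
        W = G ^ a * w ^ b
        f : Fin L → ℤ
        f j = ev (c j) (π * + x)
        p∤U = ∤-^ pp {u} p∤u b
        lem : ∀ t U → U * 0ℤ - (U * 0ℤ - t) ≡ t
        lem = solve-∀
        lem₂ : ∀ g x y → - (g * (x - y)) ≡ g * y - g * x
        lem₂ = solve-∀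
        lem₃ : ∀ g x y → g * (x * y) ≡ x * (g * y)
        lem₃ = solve-∀
        lem₄ : ∀ a b → a - b + b ≡ a
        lem₄ = solve-∀
        -- From u Gˢ ≡ w follows u^b G^(b s) ≡ w^b, so the fraction W / U stands for Gˣ at x = a + b
        -- s.
        W≈ : π ^ k ∣ W - U * G ^ x
        W≈ = subst (π ^ k ∣_) (trans (lem₂ (G ^ a) ((u * G ^ s) ^ b) (w ^ b)) (cong (_-_ W)
            (trans (cong (G ^ a *_) (trans (^-distrib-* u (G ^ s) b) (cong (U *_)
              (trans (ℤₚ.^-*-assoc G s b) (cong (G ^_) (ℕₚ.*-comm s b))))))
             (trans (lem₃ (G ^ a) U (G ^ (b ℕ.* s))) (cong (U *_) (sym (ℤₚ.^-distribˡ-+-* G a (b ℕ.* s))))))))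
          (∣m⇒∣-m (∣n⇒∣m*n (G ^ a) (^-cong-∣ cong-k b)))
        key : π ^ k ∣ U * hev f W U - U ^ L * F x
        key = hev-cong {π ^ k} {U} {W} {G ^ x} W≈ f
        hev-div : π ^ H ∣ hev f W U
        hev-div = unit-cancel pp {U} p∤U H (subst (π ^ H ∣_) (lem₄ (U * hev f W U) (U ^ L * F x))
          (∣m∣n⇒∣m+n (∣-trans (^-monoʳ-∣ π H≤k) key) (∣n⇒∣m*n (U ^ L) (F-small x))))
        D = ∣ G ∣ ℕ.^ S ℕ.* M ℕ.^ T
        1≤^ : ∀ {m} e → 1 ≤ m → 1 ≤ m ℕ.^ e
        1≤^ {m} e 1≤m = ℕₚ.m^n>0 m {{ℕ.>-nonZero 1≤m}} e
        pow≤ : ∀ {n m e d} → 1 ≤ m → n ≤ m → e ≤ d → n ℕ.^ e ≤ m ℕ.^ d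
        pow≤ {n} {m} {e} {d} 1≤m n≤m e≤d = ℕₚ.≤-trans (ℕₚ.^-monoˡ-≤ e n≤m) (ℕₚ.^-monoʳ-≤ m {{ℕ.>-nonZero 1≤m}} e≤d)
        W≤ : ∣ W ∣ ≤ D
        W≤ = subst (_≤ D) (sym (trans (ℤₚ.abs-* (G ^ a) (w ^ b)) (cong₂ ℕ._*_ (abs-^ G a) (abs-^ w b))))
          (ℕₚ.*-mono-≤ (pow≤ 1≤G ℕₚ.≤-refl (ℕₚ.<⇒≤ a<S)) (pow≤ 1≤M w≤ (ℕₚ.<⇒≤ b<T)))
        U≤ : ∣ U ∣ ≤ D
        U≤ = subst (_≤ D) (sym (abs-^ u b)) (ℕₚ.≤-trans (pow≤ 1≤M u≤ (ℕₚ.<⇒≤ b<T))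
          (ℕₚ.m≤n*m (M ℕ.^ T) (∣ G ∣ ℕ.^ S) {{ℕ.>-nonZero (1≤^ S 1≤G)}}))
        x≤ : x ≤ p ℕ.^ λ′
        x≤ = ℕₚ.≤-trans (ℕₚ.+-mono-≤ (ℕₚ.<⇒≤ a<S) (ℕₚ.*-monoˡ-≤ s (ℕₚ.<⇒≤ b<T))) range
        hev≡0 : hev f W U ≡ 0ℤ
        hev≡0 = small∣⇒0 H hev-div (ℕₚ.≤-<-trans
          (∣hev∣≤ (ℕₚ.*-mono-≤ (1≤^ S 1≤G) (1≤^ T 1≤M)) W≤ U≤ f
            (row-bound (ℕₚ.m^n>0 p (suc λ′)) (ℕₚ.*-monoʳ-≤ p x≤))) size₁)
      ξs = applyUpTo (node S s) (S ℕ.* T)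
      F-deep : ∀ x → π ^ (S ℕ.* T) ∣ F x
      F-deep x = R⇒F {S ℕ.* T} x (ℕₚ.≤-trans (ℕₚ.m≤m+n (S ℕ.* T) (S ℕ.* T ℕ.* suc λ′)) depth)
        (schwarz pp λ′ (S ℕ.* T) R ξs
          (Uniqueₚ.applyUpTo⁺₁ (node S s) (S ℕ.* T) (λ i<j _ → ℕₚ.<⇒≢ (node-mono S S≤s i<j)))
          (Allₚ.applyUpTo⁺₁ (node S s) (S ℕ.* T) (λ i< → node< i<))
          (Allₚ.applyUpTo⁺₁ (node S s) (S ℕ.* T) (λ {i} i< →
            ∣-trans (^-monoʳ-∣ π (subst (λ n → S ℕ.* T ℕ.+ n ℕ.* suc λ′ ≤ k) (sym (Listₚ.length-applyUpTo (node S s) (S ℕ.* T))) depth))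
              (F-node (i % S) (i / S) (DivMod.m%n<n i S) (quot< i<))))
          (S ℕ.* T) ℕₚ.≤-refl (ℕₚ.≤-reflexive (sym (Listₚ.length-applyUpTo (node S s) (S ℕ.* T)))) x)
        where
        quot< : ∀ {i} → i < S ℕ.* T → i / S < T
        quot< {i} i< = DivMod.m<n*o⇒m/o<n (subst (i <_) (ℕₚ.*-comm S T) i<)
        node< : ∀ {i} → i < S ℕ.* T → node S s i < p ℕ.^ λ′
        node< {i} i< = ℕₚ.<-≤-trans (ℕₚ.+-mono-<-≤ (DivMod.m%n<n i S) (ℕₚ.*-monoˡ-≤ s (ℕₚ.<⇒≤ (quot< i<)))) range
      rows-zero : ∀ {i} → i < K → ∀ j → ev (c j) (π * + (A ℕ.+ i)) ≡ 0ℤ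
      rows-zero {i} i<K = digits-zero {G ^ x} f (λ j → ℕₚ.≤-<-trans (f≤ j) (ℕₚ.<-≤-trans size₂ G≥)) F≡0
        where
        x = A ℕ.+ i
        f : Fin L → ℤ
        f j = ev (c j) (π * + x)
        x≤ : x ≤ A ℕ.+ K
        x≤ = ℕₚ.+-monoʳ-≤ A (ℕₚ.<⇒≤ i<K)
        f≤ : ∀ j → ∣ f j ∣ ≤ K ℕ.* (p ℕ.^ h ℕ.* (p ℕ.* (A ℕ.+ K)) ℕ.^ K)
        f≤ = row-bound (ℕₚ.*-mono-≤ (ℕₚ.≤-trans (s≤s z≤n) 3≤p) (ℕₚ.≤-trans 1≤A (ℕₚ.m≤m+n A K))) (ℕₚ.*-monoʳ-≤ p x≤)
        G≥ : ∣ G ∣ ℕ.^ A ≤ ∣ G ^ x ∣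
        G≥ = subst (∣ G ∣ ℕ.^ A ≤_) (sym (abs-^ G x)) (ℕₚ.^-monoʳ-≤ ∣ G ∣ {{ℕ.>-nonZero 1≤G}} (ℕₚ.m≤m+n A i))
        G≤ : ∣ G ^ x ∣ ≤ ∣ G ∣ ℕ.^ (A ℕ.+ K)
        G≤ = subst (_≤ ∣ G ∣ ℕ.^ (A ℕ.+ K)) (sym (abs-^ G x)) (ℕₚ.^-monoʳ-≤ ∣ G ∣ {{ℕ.>-nonZero 1≤G}} x≤)
        F≡0 : F x ≡ 0ℤ
        F≡0 = small∣⇒0 (S ℕ.* T) (F-deep x) (ℕₚ.≤-<-trans
          (∣ev∣≤ {Y = G ^ x} (ℕₚ.m^n>0 ∣ G ∣ {{ℕ.>-nonZero 1≤G}} (A ℕ.+ K)) G≤ f f≤) size₃)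
      c-zero : ∀ j i → c j i ≡ 0ℤ
      c-zero j = roots⇒zero (c j) (applyUpTo root K) (ℕₚ.≤-reflexive (sym (Listₚ.length-applyUpTo root K)))
        (Uniqueₚ.applyUpTo⁺₁ root K (λ {i} {i′} i<i′ _ eq → ℕₚ.<⇒≢ i<i′ (ℕₚ.+-cancelˡ-≡ A i i′ (ℤₚ.+-injective
          (ℤₚ.*-cancelˡ-≡ π (+ (A ℕ.+ i)) (+ (A ℕ.+ i′)) eq)))))
        (Allₚ.applyUpTo⁺₁ root K (λ i<K → rows-zero i<K j))
        where
        root : ℕ → ℤ
        root i = π * + (A ℕ.+ i)

open PadicInterpolation

open import Defs
open import Data.Nat using (ℕ; zero; suc; pred; _+_; _*_; _∸_; _^_; _!; _≤_; _<_; s≤s; z≤n; NonZero; >-nonZero; ≢-nonZero; _≡ᵇ_; _≤ᵇ_)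
open import Data.Nat.Divisibility as ℕ∣ using () renaming (_∣_ to _∣ℕ_)
open import Data.Nat.DivMod using (_/_; _%_; m≡m%n+[m/n]*n; m%n<n; m%n≤m; /-monoˡ-≤; m*n/n≡m; m/n≤m; m%n%n≡m%n; [m+kn]%n≡m%n)
open import Data.Nat.ListAction using (product)
open import Data.Nat.Primality.Factorisation using (PrimeFactorisation; factorise)
open import Data.Nat.Tactic.RingSolver using (solve-∀)
open import Data.Integer as ℤ using (ℤ; +_; -_; ∣_∣; 0ℤ; 1ℤ)
open import Data.Integer.Divisibility.Signed as ℤ∣ using () renaming (_∣_ to _∣ℤ_)
open import Data.Integer.Tactic.RingSolver renaming (solve-∀ to solveℤ)
open import Data.Bool using (Bool; true; false; _∧_; if_then_else_) renaming (T to True)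
open import Data.Bool.Properties using (∧-conicalˡ; ∧-conicalʳ)
open import Data.List using (List; []; _∷_)
open import Data.List.Relation.Unary.All using (All; []; _∷_)
open import Relation.Nullary.Decidable using (toWitness; toWitnessFalse; _×-dec_; _→-dec_; ⌊_⌋)

-- Choice of the parameters

^-*-≤ : ∀ p a b {x y} → x ≤ p ^ a → y ≤ p ^ b → x * y ≤ p ^ (a + b)
^-*-≤ p a b h k = ℕₚ.≤-trans (ℕₚ.*-mono-≤ h k) (ℕₚ.≤-reflexive (sym (ℕₚ.^-distribˡ-+-* p a b)))

^-^-≤ : ∀ p a n {x} → x ≤ p ^ a → x ^ n ≤ p ^ (a * n)
^-^-≤ p a n h = ℕₚ.≤-trans (ℕₚ.^-monoˡ-≤ n h) (ℕₚ.≤-reflexive (ℕₚ.^-*-assoc p a n))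

^-<-≤ : ∀ {p x a b} → 2 ≤ p → x ≤ p ^ a → a < b → x < p ^ b
^-<-≤ {p} 2≤p h a<b = ℕₚ.≤-<-trans h (ℕₚ.^-monoʳ-< p 2≤p a<b)

module _ {p} (pp : Prime p) (3≤p : 3 ≤ p) (z : ℤ) where
  private
    G = 1ℤ ℤ.+ + p ℤ.* + p ℤ.* z

  -- With c = Λ + 1 take L = 64 c, K = 576 μ κ, S = μ κ, T = 9 κ, H = 16 c K and X = p^h with h ≈ H/4: then the
  -- exponents of p in the size of the values at the nodes are 4 c K (from X), c K (from xⁱ) and 2 c K (from Gˢ and
  -- Mᵀ), less than H, and S T exceeds the exponent of order c² K needed for F(x) with x < A + K once κ is of order c².
  gelfond-bound : p ^ 2 ≤ ∣ G ∣ → ∣ G ∣ ≤ p ^ 9 → ∀ (μ Λ κ k : ℕ) (u w : ℤ) s → 1 ≤ μ → 1 ≤ s →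
    2396672 * (suc Λ * suc Λ) < κ → ∣ u ∣ ≤ 2 ^ μ → ∣ w ∣ ≤ 2 ^ μ → ¬ p ∣ℕ ∣ u ∣ →
    64 * suc Λ * (576 * (μ * κ)) ≤ 2 ^ Λ → μ * κ + 9 * κ * s ≤ 2 ^ Λ → μ * κ ≤ s →
    μ * κ * (9 * κ) * suc (suc Λ) ≤ k → ¬ (+ p) ℤ.^ k ∣ℤ u ℤ.* G ℤ.^ s ℤ.- w
  gelfond-bound G≥ G≤ μ Λ κ k u w s 1≤μ 1≤s κ> u≤ w≤ p∤u N≤ range S≤s k≥ dvd =
    gelfond pp 3≤p z k (λ j → proj₁ (power-polys pp 3≤p z k j)) (λ j → proj₂ (power-polys pp 3≤p z k j)) u w s L K H h S T Λ (2 ^ μ) N {{>-nonZero 1≤S}} dvd p∤u u≤ w≤ (ℕₚ.m^n>0 2 μ)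
      count H≤k S≤s (ℕₚ.≤-trans range (ℕₚ.^-monoˡ-≤ Λ 2≤p)) depth 1≤G size₁ size₂ size₃ 1≤N
    where
    c = suc Λ
    S = μ * κ
    -- This balances 9 S = μ T, the exponents bounding ∣G∣^S and (2^μ)^T. With 576 = 9 * 64 their
    -- joint contribution (9 S + μ T) L is exactly 2 c K.
    T = 9 * κ
    K = 576 * S
    L = 64 * c
    N = L * K
    H = 16 * (c * K)
    -- Since H² = 4 c K * N, the summand 1 is what makes h N exceed H², as the pigeonhole principle
    -- requires.
    h = 4 * (c * K) + 1
    2≤p : 2 ≤ p
    2≤p = ℕₚ.≤-trans (s≤s (s≤s z≤n)) 3≤p
    1≤κ : 1 ≤ κ
    1≤κ = ℕₚ.≤-trans (s≤s z≤n) κ>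
    1≤S : 1 ≤ S
    1≤S = ℕₚ.*-mono-≤ 1≤μ 1≤κ
    1≤K : 1 ≤ K
    1≤K = ℕₚ.*-mono-≤ {1} {576} (s≤s z≤n) 1≤S
    1≤L : 1 ≤ L
    1≤L = ℕₚ.*-mono-≤ {1} {64} {1} {c} (s≤s z≤n) (s≤s z≤n)
    1≤N : 1 ≤ N
    1≤N = ℕₚ.*-mono-≤ 1≤L 1≤K
    1≤G : 1 ≤ ∣ G ∣
    1≤G = ℕₚ.≤-trans (ℕₚ.m^n>0 p {{prime⇒nonZero pp}} 2) G≥
    c≤cK : c ≤ c * K
    c≤cK = ℕₚ.m≤m*n c K {{>-nonZero 1≤K}}
    K≤cK : K ≤ c * K
    K≤cK = ℕₚ.m≤n*m K c
    1≤cK : 1 ≤ c * K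
    1≤cK = ℕₚ.≤-trans 1≤K K≤cK
    N≤p : N ≤ p ^ Λ
    N≤p = ℕₚ.≤-trans N≤ (ℕₚ.^-monoˡ-≤ Λ 2≤p)
    L≤p : L ≤ p ^ Λ
    L≤p = ℕₚ.≤-trans (ℕₚ.m≤m*n L K {{>-nonZero 1≤K}}) N≤p
    K≤p : K ≤ p ^ Λ
    K≤p = ℕₚ.≤-trans (ℕₚ.m≤n*m K L {{>-nonZero 1≤L}}) N≤p
    M≤p : 2 ^ μ ≤ p ^ μ
    M≤p = ℕₚ.^-monoˡ-≤ μ 2≤p
    open ℕₚ.≤-Reasoning
    count : (p ^ H) ^ H < (p ^ h) ^ N
    count = subst₂ _<_ (sym (ℕₚ.^-*-assoc p H H)) (sym (ℕₚ.^-*-assoc p h N)) (ℕₚ.^-monoʳ-< p 2≤p (begin-strict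
      H * H                                   <⟨ ℕₚ.m<m+n (H * H) {N} 1≤N ⟩
      16 * (c * K) * (16 * (c * K)) + N       ≡⟨ lem c K ⟩
      h * N                                   ∎))
      where
      lem′ : ∀ a c K → a * a * (c * K) * (a * a * (c * K)) + a * a * a * c * K ≡ (a * (c * K) + 1) * (a * a * a * c * K)
      lem′ = solve-∀
      lem : ∀ c K → 16 * (c * K) * (16 * (c * K)) + 64 * c * K ≡ (4 * (c * K) + 1) * (64 * c * K)
      lem = lem′ 4
    depth : S * T + S * T * c ≤ k
    depth = ℕₚ.≤-trans (ℕₚ.≤-reflexive (sym (ℕₚ.*-suc (S * T) c))) k≥
    c≤cc : c ≤ c * c
    c≤cc = ℕₚ.m≤m*n c c
    H≤k : H ≤ k
    H≤k = begin
      16 * (c * K)               ≡⟨ lem c S ⟩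
      S * (9 * (1024 * c))       ≤⟨ ℕₚ.*-monoʳ-≤ S (ℕₚ.*-monoʳ-≤ 9 (ℕₚ.≤-trans (ℕₚ.*-mono-≤ {1024} {2396672} (ℕₚ.≤ᵇ⇒≤ 1024 2396672 _) c≤cc) (ℕₚ.<⇒≤ κ>))) ⟩
      S * T                      ≤⟨ ℕₚ.m≤m+n (S * T) (S * T * c) ⟩
      S * T + S * T * c          ≤⟨ depth ⟩
      k                          ∎
      where
      lem′ : ∀ a b d c S → a * (c * (b * d * S)) ≡ S * (b * (a * d * c))
      lem′ = solve-∀
      lem : ∀ c S → 16 * (c * (576 * S)) ≡ S * (9 * (1024 * c))
      lem = lem′ 16 9 64
    size₁ : L * ((K * (p ^ h * (p ^ suc Λ) ^ K)) * (∣ G ∣ ^ S * (2 ^ μ) ^ T) ^ L) < p ^ H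
    size₁ = ^-<-≤ 2≤p (^-*-≤ p Λ (Λ + (h + c * K) + (9 * S + μ * T) * L) L≤p
      (^-*-≤ p (Λ + (h + c * K)) ((9 * S + μ * T) * L)
        (^-*-≤ p Λ (h + c * K) K≤p (^-*-≤ p h (c * K) ℕₚ.≤-refl (^-^-≤ p c K ℕₚ.≤-refl)))
        (^-^-≤ p (9 * S + μ * T) L (^-*-≤ p (9 * S) (μ * T) (^-^-≤ p 9 S G≤) (^-^-≤ p μ T M≤p))))) (begin-strict
        Λ + (Λ + (h + c * K) + (9 * S + μ * T) * L)   ≡⟨ lem Λ c μ κ ⟩
        Λ + (Λ + 1) + 7 * (c * K)                     <⟨ ℕₚ.+-monoˡ-< (7 * (c * K)) (ℕₚ.+-mono-<-≤ (ℕₚ.n<1+n Λ) (ℕₚ.≤-reflexive (ℕₚ.+-comm Λ 1))) ⟩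
        c + c + 7 * (c * K)                           ≤⟨ ℕₚ.+-monoˡ-≤ (7 * (c * K)) (ℕₚ.+-mono-≤ c≤cK c≤cK) ⟩
        c * K + c * K + 7 * (c * K)                   ≡⟨ lem₂ (c * K) ⟩
        9 * (c * K)                                   ≤⟨ ℕₚ.*-monoˡ-≤ (c * K) (ℕₚ.≤ᵇ⇒≤ 9 16 _) ⟩
        H                                             ∎)
      where
      lem′ : ∀ a b Λ c μ κ → Λ + (Λ + (4 * (c * (a * b * (μ * κ))) + 1 + c * (a * b * (μ * κ))) + (a * (μ * κ) + μ * (a * κ)) * (b * c))
                        ≡ Λ + (Λ + 1) + 7 * (c * (a * b * (μ * κ)))
      lem′ = solve-∀
      lem : ∀ Λ c μ κ → Λ + (Λ + (4 * (c * (576 * (μ * κ))) + 1 + c * (576 * (μ * κ))) + (9 * (μ * κ) + μ * (9 * κ)) * (64 * c))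
                        ≡ Λ + (Λ + 1) + 7 * (c * (576 * (μ * κ)))
      lem = lem′ 9 64
      lem₂ : ∀ x → x + x + 7 * x ≡ 9 * x
      lem₂ = solve-∀
    AK≤ : p * (N + K) ≤ p ^ (2 + Λ)
    AK≤ = ℕₚ.*-monoʳ-≤ p (begin
      N + K        ≤⟨ ℕₚ.+-mono-≤ N≤p K≤p ⟩
      p ^ Λ + p ^ Λ ≡⟨ cong (_+_ (p ^ Λ)) (sym (ℕₚ.+-identityʳ (p ^ Λ))) ⟩
      2 * p ^ Λ    ≤⟨ ℕₚ.*-monoˡ-≤ (p ^ Λ) 2≤p ⟩
      p * p ^ Λ    ∎)
    row : K * (p ^ h * (p * (N + K)) ^ K) ≤ p ^ (Λ + (h + (2 + Λ) * K))
    row = ^-*-≤ p Λ (h + (2 + Λ) * K) K≤p (^-*-≤ p h ((2 + Λ) * K) ℕₚ.≤-refl (^-^-≤ p (2 + Λ) K AK≤))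
    row-exp : Λ + (h + (2 + Λ) * K) ≤ 7 * (c * K)
    row-exp = begin
      Λ + (4 * (c * K) + 1 + (2 + Λ) * K)   ≡⟨ lem Λ K ⟩
      c + K + 5 * (c * K)                   ≤⟨ ℕₚ.+-monoˡ-≤ (5 * (c * K)) (ℕₚ.+-mono-≤ c≤cK K≤cK) ⟩
      c * K + c * K + 5 * (c * K)           ≡⟨ lem₂ (c * K) ⟩
      7 * (c * K)                           ∎
      where
      lem : ∀ Λ K → Λ + (4 * ((1 + Λ) * K) + 1 + (2 + Λ) * K) ≡ 1 + Λ + K + 5 * ((1 + Λ) * K)
      lem = solve-∀
      lem₂ : ∀ x → x + x + 5 * x ≡ 7 * x
      lem₂ = solve-∀
    -- The points used for the final vanishing start at A = N: there Gˣ is at least p^(2 N) = p^(128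
    -- c K), whereas the inner sums stay below p^(7 c K).
    size₂ : K * (p ^ h * (p * (N + K)) ^ K) < ∣ G ∣ ^ N
    size₂ = ℕₚ.<-≤-trans (^-<-≤ 2≤p row (begin-strict
        Λ + (h + (2 + Λ) * K)    ≤⟨ row-exp ⟩
        7 * (c * K)              <⟨ ℕₚ.*-monoˡ-< (c * K) {{>-nonZero 1≤cK}} (ℕₚ.≤ᵇ⇒≤ 8 128 _) ⟩
        128 * (c * K)            ≡⟨ lem c K ⟩
        2 * N                    ∎))
      (ℕₚ.≤-trans (ℕₚ.≤-reflexive (sym (ℕₚ.^-*-assoc p 2 N))) (ℕₚ.^-monoˡ-≤ N G≥))
      where
      lem′ : ∀ a b c K → a * b * (c * K) ≡ a * (b * c * K)
      lem′ = solve-∀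
      lem : ∀ c K → 128 * (c * K) ≡ 2 * (64 * c * K)
      lem = lem′ 2 64
    -- This inequality fixes the lower bound on κ: after division by 9 S c² the left side is at most
    -- 8 * 64 + 576 * 64 * 65 = 2396672.
    size₃ : L * ((K * (p ^ h * (p * (N + K)) ^ K)) * (∣ G ∣ ^ (N + K)) ^ L) < p ^ (S * T)
    size₃ = ^-<-≤ 2≤p (^-*-≤ p Λ (Λ + (h + (2 + Λ) * K) + 9 * (N + K) * L) L≤p
      (^-*-≤ p (Λ + (h + (2 + Λ) * K)) (9 * (N + K) * L) row (^-^-≤ p (9 * (N + K)) L (^-^-≤ p 9 (N + K) G≤)))) (begin-strict
        Λ + (Λ + (h + (2 + Λ) * K) + 9 * (N + K) * L)     ≤⟨ ℕₚ.+-mono-≤ (ℕₚ.≤-trans (ℕₚ.n≤1+n Λ) c≤cK) (ℕₚ.+-monoˡ-≤ _ row-exp) ⟩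
        c * K + (7 * (c * K) + 9 * (N + K) * L)           ≡⟨ lem c K ⟩
        8 * (c * K) + 576 * c * (64 * (c * K) + K)        ≤⟨ ℕₚ.+-mono-≤ (ℕₚ.*-monoʳ-≤ 8 (ℕₚ.m≤n*m (c * K) c)) (ℕₚ.*-monoʳ-≤ (576 * c) (ℕₚ.+-monoʳ-≤ (64 * (c * K)) K≤cK)) ⟩
        8 * (c * (c * K)) + 576 * c * (64 * (c * K) + c * K) ≡⟨ lem₂ c S ⟩
        S * (9 * (2396672 * (c * c)))                  <⟨ ℕₚ.*-monoʳ-< S {{>-nonZero 1≤S}} (ℕₚ.*-monoʳ-< 9 κ>) ⟩
        S * T                                             ∎)
      where
      lem′ : ∀ a b c K → c * K + (7 * (c * K) + a * (b * c * K + K) * (b * c)) ≡ 8 * (c * K) + a * b * c * (b * (c * K) + K)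
      lem′ = solve-∀
      lem : ∀ c K → c * K + (7 * (c * K) + 9 * (64 * c * K + K) * (64 * c)) ≡ 8 * (c * K) + 576 * c * (64 * (c * K) + K)
      lem = lem′ 9 64
      lem₂′ : ∀ a b d c S → a * (c * (c * (b * S))) + b * c * (d * (c * (b * S)) + c * (b * S)) ≡ S * (b * (a + b * (d + 1)) * (c * c))
      lem₂′ = solve-∀
      lem₂ : ∀ c S → 8 * (c * (c * (576 * S))) + 576 * c * (64 * (c * (576 * S)) + c * (576 * S)) ≡ S * (9 * (2396672 * (c * c)))
      lem₂ c S = trans (lem₂′ 8 576 64 c S) (cong (S *_) (ℕₚ.*-assoc 9 2396672 (c * c)))

-- Powers of 2 congruent to 1 modulo 9, 25 and 49

-- The orders of 2 modulo 9, 25 and 49 are 6, 20 and 21. The exponent in `upper` is set by p = 5,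
-- because 5^8 < 2^20 < 5^9.
record Base (p : ℕ) : Set where
  field
    isPrime : Prime p
    3≤p     : 3 ≤ p
    q       : ℕ
    {{q≢0}} : NonZero q
    q≤21    : q ≤ 21
    z       : ℤ
    2^q     : (+ 2) ℤ.^ q ≡ 1ℤ ℤ.+ + p ℤ.* + p ℤ.* z
    lower   : p ^ 2 ≤ 2 ^ q
    upper   : 2 ^ q ≤ p ^ 9

base₃ : Base 3
base₃ = record { isPrime = toWitness {a? = prime? 3} _ ; 3≤p = ℕₚ.≤ᵇ⇒≤ 3 3 _ ; q = 6 ; q≤21 = ℕₚ.≤ᵇ⇒≤ 6 21 _ ; z = + 7
               ; 2^q = refl ; lower = ℕₚ.≤ᵇ⇒≤ (3 ^ 2) (2 ^ 6) _ ; upper = ℕₚ.≤ᵇ⇒≤ (2 ^ 6) (3 ^ 9) _ }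

base₅ : Base 5
base₅ = record { isPrime = toWitness {a? = prime? 5} _ ; 3≤p = ℕₚ.≤ᵇ⇒≤ 3 5 _ ; q = 20 ; q≤21 = ℕₚ.≤ᵇ⇒≤ 20 21 _ ; z = + 41943
               ; 2^q = refl ; lower = ℕₚ.≤ᵇ⇒≤ (5 ^ 2) (2 ^ 20) _ ; upper = ℕₚ.≤ᵇ⇒≤ (2 ^ 20) (5 ^ 9) _ }

base₇ : Base 7
base₇ = record { isPrime = toWitness {a? = prime? 7} _ ; 3≤p = ℕₚ.≤ᵇ⇒≤ 3 7 _ ; q = 21 ; q≤21 = ℕₚ.≤ᵇ⇒≤ 21 21 _ ; z = + 42799
               ; 2^q = refl ; lower = ℕₚ.≤ᵇ⇒≤ (7 ^ 2) (2 ^ 21) _ ; upper = ℕₚ.≤ᵇ⇒≤ (2 ^ 21) (7 ^ 9) _ }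

-- The valuation bound for n between consecutive powers of 2

Growth : ℕ → ℕ → Set
Growth a x = a * suc x ^ 12 ≤ 2 ^ x

^-distribʳ-* : ∀ m n e → (m * n) ^ e ≡ m ^ e * n ^ e
^-distribʳ-* m n zero    = refl
^-distribʳ-* m n (suc e) = trans (cong (m * n *_) (^-distribʳ-* m n e)) (lem m n (m ^ e) (n ^ e))
  where
  lem : ∀ a b x y → a * b * (x * y) ≡ a * x * (b * y)
  lem = solve-∀

pow-ratio : ∀ a b x y e .{{_ : NonZero a}} → a * y ≤ b * x → b ^ e ≤ a ^ e * 2 → y ^ e ≤ 2 * x ^ e
pow-ratio a b x y e ay≤bx h = ℕₚ.*-cancelˡ-≤ (a ^ e) {{ℕₚ.m^n≢0 a e}} (begin
  a ^ e * y ^ e        ≡⟨ sym (^-distribʳ-* a y e) ⟩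
  (a * y) ^ e          ≤⟨ ℕₚ.^-monoˡ-≤ e ay≤bx ⟩
  (b * x) ^ e          ≡⟨ ^-distribʳ-* b x e ⟩
  b ^ e * x ^ e        ≤⟨ ℕₚ.*-monoˡ-≤ (x ^ e) h ⟩
  a ^ e * 2 * x ^ e    ≡⟨ ℕₚ.*-assoc (a ^ e) 2 (x ^ e) ⟩
  a ^ e * (2 * x ^ e)  ∎)
  where open ℕₚ.≤-Reasoning

growth-step : ∀ a x y Q → a * x ≤ Q → y ≤ 2 * x → a * y ≤ 2 * Q
growth-step a x y Q ax≤Q y≤2x = ℕₚ.≤-trans (ℕₚ.*-monoʳ-≤ a y≤2x)
  (ℕₚ.≤-trans (ℕₚ.≤-reflexive (lem a x)) (ℕₚ.*-monoʳ-≤ 2 ax≤Q))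
  where
  lem : ∀ a x → a * (2 * x) ≡ 2 * (a * x)
  lem = solve-∀

ratio-25/24 : ∀ x → 24 ≤ x → 24 * suc x ≤ 25 * x
ratio-25/24 x h = subst (_≤ 25 * x) (sym (ℕₚ.*-suc 24 x)) (ℕₚ.+-monoˡ-≤ (24 * x) h)

growth-suc : ∀ a x → 24 ≤ x → Growth a x → Growth a (suc x)
growth-suc a x 24≤x g = growth-step a (suc x ^ 12) (suc (suc x) ^ 12) (2 ^ x) g
  (pow-ratio 24 25 (suc x) (suc (suc x)) 12 (ratio-25/24 (suc x) (ℕₚ.≤-trans 24≤x (ℕₚ.n≤1+n x)))
    (ℕₚ.≤ᵇ⇒≤ (25 ^ 12) (24 ^ 12 * 2) _))

growth-+ : ∀ a x → 24 ≤ x → Growth a x → ∀ d → Growth a (d + x)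
growth-+ a x 24≤x g zero    = g
growth-+ a x 24≤x g (suc d) = growth-suc a (d + x) (ℕₚ.≤-trans 24≤x (ℕₚ.m≤n+m x d)) (growth-+ a x 24≤x g d)

-- Passing from x to x + 1 multiplies the left side by at most (25/24)^12 < 2, so the numerical
-- check at x = 210 is enough. The exponent 12 is the one reached by `F` in `LargeN`.
growth : ∀ x → 210 ≤ x → Growth (2 * 10 ^ 33) x
growth x h = subst (Growth (2 * 10 ^ 33)) (ℕₚ.m∸n+n≡m h)
  (growth-+ (2 * 10 ^ 33) 210 (ℕₚ.≤ᵇ⇒≤ 24 210 _) (ℕₚ.≤ᵇ⇒≤ (2 * 10 ^ 33 * 211 ^ 12) (2 ^ 210) _) (x ∸ 210))

log-range : ∀ n → 1 ≤ n → ∃ λ t → 2 ^ t ≤ n × n < 2 ^ suc t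
log-range (suc zero)    _ = 0 , s≤s z≤n , s≤s (s≤s z≤n)
log-range (suc (suc n)) _ with log-range (suc n) (s≤s z≤n)
... | t , lo , hi with suc (suc n) ℕₚ.<? 2 ^ suc t
... | yes h = t , ℕₚ.≤-trans lo (ℕₚ.n≤1+n _) , h
... | no  h = suc t , ℕₚ.≮⇒≥ h , ℕₚ.<-≤-trans (s≤s hi)
    (ℕₚ.+-mono-≤ (ℕₚ.m^n>0 2 (suc t)) (ℕₚ.m≤m+n (2 ^ suc t) 0))

poly≤ : ∀ A a j t Q → A * t ^ 12 ≤ Q → a ≤ A → j ≤ 12 → 1 ≤ t → a * t ^ j ≤ Q
poly≤ A a j t Q h a≤A j≤ 1≤t = ℕₚ.≤-trans (ℕₚ.*-mono-≤ a≤A (ℕₚ.^-monoʳ-≤ t {{>-nonZero 1≤t}} j≤)) h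

-- Here κ = k₀ t² and μ ≤ m₀ t⁷, where 2ᵗ⁻¹ ≤ n < 2ᵗ.  The constants are parameters because the type checker
-- could otherwise unfold such large numerals in unary.
module Window (k₀ m₀ A : ℕ)
  (k₀-large : 2396672 * 4 < k₀)
  (c₁ : 64 * 2 * 576 * m₀ * k₀ ≤ A) (c₂ : m₀ * k₀ ≤ A) (c₃ : 18 * k₀ ≤ A) (c₄ : 21 * (m₀ * k₀) ≤ A) (c₅ : 2 ^ 21 ≤ A)
  {p} (b : Base p) (x : ℕ) (g : Growth A x) where
  private
    module b = Base b
    instance q≢0 = b.q≢0
    t = suc x
    Q = 2 ^ x
    κ = k₀ * (t * t)
    π = + p
    G = 1ℤ ℤ.+ π ℤ.* π ℤ.* b.z
    1≤t : 1 ≤ t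
    1≤t = s≤s z≤n
    poly : ∀ a j → a ≤ A → j ≤ 12 → a * t ^ j ≤ Q
    poly a j a≤ j≤ = poly≤ A a j t Q g a≤ j≤ 1≤t
    ∣G∣ : ∣ G ∣ ≡ 2 ^ b.q
    ∣G∣ = trans (cong ∣_∣ (sym b.2^q)) (abs-^ (+ 2) b.q)

  bound₁ : ∀ μ → μ ≤ m₀ * t ^ 7 → 64 * (t + t) * (576 * (μ * κ)) ≤ Q
  bound₁ μ h = ℕₚ.≤-trans (ℕₚ.*-monoʳ-≤ (64 * (t + t)) (ℕₚ.*-monoʳ-≤ 576 (ℕₚ.*-monoˡ-≤ κ h)))
    (ℕₚ.≤-trans (ℕₚ.≤-reflexive (lem 64 576 m₀ k₀ t (t ^ 7))) (poly (64 * 2 * 576 * m₀ * k₀) 10 c₁ (ℕₚ.m≤m+n 10 2)))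
    where
    lem : ∀ a b m k t s → a * (t + t) * (b * (m * s * (k * (t * t)))) ≡ a * 2 * b * m * k * (t * (t * (t * s)))
    lem = solve-∀

  bound₂ : ∀ μ → μ ≤ m₀ * t ^ 7 → ∀ a → a * (m₀ * k₀) ≤ A → a * (μ * κ) ≤ Q
  bound₂ μ h a a≤ = ℕₚ.≤-trans (ℕₚ.*-monoʳ-≤ a (ℕₚ.*-monoˡ-≤ κ h))
    (ℕₚ.≤-trans (ℕₚ.≤-reflexive (lem a m₀ k₀ t (t ^ 7))) (poly (a * (m₀ * k₀)) 9 a≤ (ℕₚ.m≤m+n 9 3)))
    where
    lem : ∀ a m k t s → a * (m * s * (k * (t * t))) ≡ a * (m * k) * (t * (t * s))
    lem = solve-∀

  bound₃ : 18 * κ ≤ Q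
  bound₃ = ℕₚ.≤-trans (ℕₚ.≤-reflexive (lem 18 k₀ t)) (poly (18 * k₀) 2 c₃ (ℕₚ.m≤m+n 2 10))
    where
    lem : ∀ a k t → a * (k * (t * t)) ≡ a * k * (t * (t * 1))
    lem = solve-∀

  bound₄ : ∀ μ → μ * κ * (9 * κ) * suc (t + t) ≤ 27 * (k₀ * k₀) * (μ * t ^ 5)
  bound₄ μ = ℕₚ.≤-trans (ℕₚ.*-monoʳ-≤ (μ * κ * (9 * κ)) three)
    (ℕₚ.≤-reflexive (lem 9 μ k₀ t))
    where
    three : suc (t + t) ≤ 3 * t
    three = ℕₚ.≤-trans (ℕₚ.+-monoˡ-≤ (t + t) 1≤t) (ℕₚ.≤-reflexive (cong (λ y → t + (t + y)) (sym (ℕₚ.+-identityʳ t))))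
    lem : ∀ a μ k t → μ * (k * (t * t)) * (a * (k * (t * t))) * (3 * t) ≡ a * 3 * (k * k) * (μ * (t * (t * (t * (t * (t * 1))))))
    lem = solve-∀

  κ-large : 2396672 * ((t + t) * (t + t)) < κ
  κ-large = subst (_< κ) (lem 2396672 t) (ℕₚ.*-monoˡ-< (t * t) {{ℕₚ.m*n≢0 t t}} k₀-large)
    where
    lem : ∀ a t → a * 4 * (t * t) ≡ a * ((t + t) * (t + t))
    lem = solve-∀

  -- Splitting n = r + s q turns n′ 2ⁿ into u Gˢ with u = n′ 2ʳ prime to p. The factor n′ is kept
  -- apart from the exponent n because dividing out p changes only the former. The nodes stay below
  -- 2 Q² = 2^(x + t), hence Λ = x + t and c = 2 t; the condition 2 t ≤ μ makes room for u, as n′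
  -- and 2ʳ are each at most 2^t.
  not-deep-unit : ∀ n n′ μ k (w : ℤ) → Q ≤ n → n < 2 * Q → n′ ≤ n → ¬ p ∣ℕ n′ → t + t ≤ μ → μ ≤ m₀ * t ^ 7 →
    ∣ w ∣ ≤ 2 ^ μ → 27 * (k₀ * k₀) * (μ * t ^ 5) ≤ k → ¬ π ℤ.^ k ∣ℤ + (n′ * 2 ^ n) ℤ.- w
  not-deep-unit n n′ μ k w lo hi n′≤n p∤n′ μ≥ μ≤ w≤ k≥ dvd =
    gelfond-bound b.isPrime b.3≤p b.z (subst (p ^ 2 ≤_) (sym ∣G∣) b.lower) (subst (_≤ p ^ 9) (sym ∣G∣) b.upper)
      μ (x + t) κ k (+ (n′ * 2 ^ r)) w s (ℕₚ.≤-trans (s≤s z≤n) μ≥)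
      (ℕₚ.≤-trans (ℕₚ.*-mono-≤ {1} {μ} {1} {κ} (ℕₚ.≤-trans (s≤s z≤n) μ≥) (ℕₚ.≤-trans (s≤s z≤n) κ-large)) μκ≤s)
      κ-large u≤ w≤ p∤u
      (ℕₚ.≤-trans (bound₁ μ μ≤) Q≤) range μκ≤s (ℕₚ.≤-trans (bound₄ μ) k≥)
      (subst (λ a → π ℤ.^ k ∣ℤ a ℤ.- w) split dvd)
    where
    r = n % b.q
    s = n / b.q
    1≤Q : 1 ≤ Q
    1≤Q = ℕₚ.m^n>0 2 x
    2^Λ : 2 ^ (x + t) ≡ Q * (2 * Q)
    2^Λ = ℕₚ.^-distribˡ-+-* 2 x t
    Q≤ : Q ≤ 2 ^ (x + t)
    Q≤ = ℕₚ.^-monoʳ-≤ 2 (ℕₚ.m≤m+n x t)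
    μκ≤s : μ * κ ≤ s
    μκ≤s = subst (_≤ s) (m*n/n≡m (μ * κ) b.q) (/-monoˡ-≤ b.q
      (ℕₚ.≤-trans (ℕₚ.*-monoʳ-≤ (μ * κ) b.q≤21)
      (ℕₚ.≤-trans (ℕₚ.≤-reflexive (ℕₚ.*-comm (μ * κ) 21)) (ℕₚ.≤-trans (bound₂ μ μ≤ 21 c₄) lo))))
    range : μ * κ + 9 * κ * s ≤ 2 ^ (x + t)
    range = subst (μ * κ + 9 * κ * s ≤_) (sym (trans 2^Λ (lem Q))) (ℕₚ.+-mono-≤
      (ℕₚ.≤-trans (subst (_≤ Q) (ℕₚ.*-identityˡ (μ * κ)) (bound₂ μ μ≤ 1 (subst (_≤ A) (sym (ℕₚ.*-identityˡ (m₀ * k₀))) c₂)))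
        (ℕₚ.m≤m*n Q Q {{>-nonZero 1≤Q}}))
      (ℕₚ.≤-trans (ℕₚ.*-monoʳ-≤ (9 * κ) (ℕₚ.≤-trans (m/n≤m n b.q) (ℕₚ.<⇒≤ hi)))
        (ℕₚ.≤-trans (ℕₚ.≤-reflexive (lem₂ 9 κ Q)) (ℕₚ.*-monoˡ-≤ Q bound₃))))
      where
      lem : ∀ Q → Q * (2 * Q) ≡ Q * Q + Q * Q
      lem = solve-∀
      lem₂ : ∀ a κ Q → a * κ * (2 * Q) ≡ a * 2 * κ * Q
      lem₂ = solve-∀
    u≤ : n′ * 2 ^ r ≤ 2 ^ μ
    u≤ = ℕₚ.≤-trans (ℕₚ.*-mono-≤ (ℕₚ.≤-trans n′≤n (ℕₚ.<⇒≤ hi))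
           (ℕₚ.≤-trans (ℕₚ.^-monoʳ-≤ 2 (ℕₚ.≤-trans (ℕₚ.<⇒≤ (m%n<n n b.q)) b.q≤21))
             (ℕₚ.≤-trans (subst (_≤ Q) (ℕₚ.*-identityʳ (2 ^ 21)) (poly (2 ^ 21) 0 c₅ z≤n)) (ℕₚ.m≤n*m Q 2))))
         (ℕₚ.≤-trans (ℕₚ.≤-reflexive (sym (ℕₚ.^-distribˡ-+-* 2 t t))) (ℕₚ.^-monoʳ-≤ 2 μ≥))
    p∤u : ¬ p ∣ℕ n′ * 2 ^ r
    p∤u = ∤-* b.isPrime p∤n′ (subst (λ a → ¬ p ∣ℕ a) (abs-^ (+ 2) r) (∤-^ b.isPrime {+ 2}
      (λ h → ℕₚ.<⇒≱ b.3≤p (ℕ∣.∣⇒≤ h)) r))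
    split : + (n′ * 2 ^ n) ≡ + (n′ * 2 ^ r) ℤ.* G ℤ.^ s
    split = trans (cong (λ e → + (n′ * 2 ^ e)) (m≡m%n+[m/n]*n n b.q))
      (trans (cong +_ (trans (cong (n′ *_) (ℕₚ.^-distribˡ-+-* 2 r (s * b.q))) (sym (ℕₚ.*-assoc n′ (2 ^ r) _))))
      (trans (ℤₚ.pos-* (n′ * 2 ^ r) (2 ^ (s * b.q))) (cong (+ (n′ * 2 ^ r) ℤ.*_)
        (trans (pos-^ 2 (s * b.q)) (trans (cong ((+ 2) ℤ.^_) (ℕₚ.*-comm s b.q))
          (trans (sym (ℤₚ.^-*-assoc (+ 2) b.q s)) (cong (ℤ._^ s) b.2^q)))))))

  -- A common factor p of n′ and w is divided out; this happens fewer than j times because |w| < pʲ.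
  not-deep : ∀ j n n′ μ k (w : ℤ) → Q ≤ n → n < 2 * Q → n′ ≤ n → w ≢ 0ℤ → ∣ w ∣ < p ^ j → t + t ≤ μ → μ ≤ m₀ * t ^ 7 →
    ∣ w ∣ ≤ 2 ^ μ → 27 * (k₀ * k₀) * (μ * t ^ 5) ≤ k → ¬ π ℤ.^ (k + j) ∣ℤ + (n′ * 2 ^ n) ℤ.- w
  not-deep zero n n′ μ k w lo hi n′≤n w≢0 w< μ≥ μ≤ w≤ k≥ dvd = w≢0 (ℤₚ.∣i∣≡0⇒i≡0 (ℕₚ.n<1⇒n≡0 w<))
  not-deep (suc j) n n′ μ k w lo hi n′≤n w≢0 w< μ≥ μ≤ w≤ k≥ dvd with p ℕ∣.∣? n′
  ... | no p∤n′ = not-deep-unit n n′ μ k w lo hi n′≤n p∤n′ μ≥ μ≤ w≤ k≥ (ℤ∣.∣-trans (^-monoʳ-∣ π (ℕₚ.m≤m+n k (suc j))) dvd)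
  ... | yes (ℕ∣.divides n″ refl) = divided p∣w
    where
    instance p≢0 = prime⇒nonZero b.isPrime
    eq : + (n″ * p * 2 ^ n) ≡ π ℤ.* + (n″ * 2 ^ n)
    eq = trans (cong +_ (lem n″ p (2 ^ n))) (ℤₚ.pos-* p (n″ * 2 ^ n))
      where
      lem : ∀ a b c → a * b * c ≡ b * (a * c)
      lem = solve-∀
    dvd′ : π ℤ.^ suc (k + j) ∣ℤ π ℤ.* + (n″ * 2 ^ n) ℤ.- w
    dvd′ = subst₂ (λ e a → π ℤ.^ e ∣ℤ a ℤ.- w) (ℕₚ.+-suc k j) eq dvd
    p∣w : π ∣ℤ w
    p∣w = subst (π ∣ℤ_) (lem (π ℤ.* + (n″ * 2 ^ n)) w)
      (ℤ∣.∣m∣n⇒∣m-n (ℤ∣.∣m⇒∣m*n (+ (n″ * 2 ^ n)) ℤ∣.∣-refl) (ℤ∣.∣-trans (ℤ∣.∣m⇒∣m*n (π ℤ.^ (k + j)) ℤ∣.∣-refl) dvd′))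
      where
      lem : ∀ a w → a ℤ.- (a ℤ.- w) ≡ w
      lem = solveℤ
    divided : π ∣ℤ w → ⊥
    divided (ℤ∣.divides w′ refl) = not-deep j n n″ μ k w′ lo hi (ℕₚ.≤-trans (ℕₚ.m≤m*n n″ p) n′≤n)
      (λ { refl → w≢0 refl })
      (ℕₚ.*-cancelˡ-< p ∣ w′ ∣ (p ^ j) (subst (_< p ^ suc j) (trans (ℤₚ.abs-* w′ π) (ℕₚ.*-comm ∣ w′ ∣ p)) w<)) μ≥ μ≤
      (ℕₚ.≤-trans (subst (∣ w′ ∣ ≤_) (sym (ℤₚ.abs-* w′ π)) (ℕₚ.m≤m*n ∣ w′ ∣ p)) w≤) k≥
      (ℤ∣.*-cancelˡ-∣ π (subst (π ℤ.^ suc (k + j) ∣ℤ_) (lem π (+ (n″ * 2 ^ n)) w′) dvd′))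
      where
      lem : ∀ π a w → π ℤ.* a ℤ.- w ℤ.* π ≡ π ℤ.* (a ℤ.- w)
      lem = solveℤ

-- Smoothness of N and its divisibility by prime powers

Smooth357 : ℕ → Set
Smooth357 M = ∃ λ a → ∃ λ b → ∃ λ c → M ≡ 3 ^ a * (5 ^ b * 7 ^ c)

smooth-* : ∀ {p M} → Prime p → p ≤ 7 → p ≢ 2 → Smooth357 M → Smooth357 (p * M)
smooth-* {3} _ _ _ (a , b , c , refl) = suc a , b , c , sym (ℕₚ.*-assoc 3 (3 ^ a) _)
smooth-* {5} _ _ _ (a , b , c , refl) = a , suc b , c , lem 5 (3 ^ a) (5 ^ b) (7 ^ c)
  where
  lem : ∀ p x y z → p * (x * (y * z)) ≡ x * (p * y * z)
  lem = solve-∀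
smooth-* {7} _ _ _ (a , b , c , refl) = a , b , suc c , lem 7 (3 ^ a) (5 ^ b) (7 ^ c)
  where
  lem : ∀ p x y z → p * (x * (y * z)) ≡ x * (y * (p * z))
  lem = solve-∀
smooth-* {0} pp _ _ _ = ⊥-elim (toWitnessFalse {a? = prime? 0} _ pp)
smooth-* {1} pp _ _ _ = ⊥-elim (toWitnessFalse {a? = prime? 1} _ pp)
smooth-* {2} _ _ p≢2 _ = ⊥-elim (p≢2 refl)
smooth-* {4} pp _ _ _ = ⊥-elim (toWitnessFalse {a? = prime? 4} _ pp)
smooth-* {6} pp _ _ _ = ⊥-elim (toWitnessFalse {a? = prime? 6} _ pp)
smooth-* {suc (suc (suc (suc (suc (suc (suc (suc p)))))))} _ h = ⊥-elim (ℕₚ.<⇒≱ (ℕₚ.m≤m+n 8 p) h)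

odd-smooth : ∀ M .{{_ : NonZero M}} → (∀ p → Prime p → p ∣ℕ M → p ≤ 7) → ¬ 2 ∣ℕ M → Smooth357 M
odd-smooth M ≤7 2∤M = subst Smooth357 (sym isFactorisation)
  (go factors (ℕ∣.∣-reflexive (sym isFactorisation)) factorsPrime)
  where
  open PrimeFactorisation (factorise M)
  go : ∀ as → product as ∣ℕ M → All Prime as → Smooth357 (product as)
  go [] _ _ = 0 , 0 , 0 , refl
  go (p ∷ as) d (pp ∷ pps) = smooth-* pp (≤7 p pp p∣M) (λ { refl → 2∤M p∣M }) (go as (ℕ∣.∣-trans (ℕ∣.n∣m*n p) d) pps)
    where
    p∣M : p ∣ℕ M
    p∣M = ℕ∣.∣-trans (ℕ∣.m∣m*n (product as)) d

∤^⇒^< : ∀ p {f a} M → 2 ≤ p → p ^ a ∣ℕ M → ¬ p ^ f ∣ℕ M → p ^ a < p ^ f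
∤^⇒^< p {f} {a} M 2≤p d nd with a ℕₚ.<? f
... | yes a<f = ℕₚ.^-monoʳ-< p 2≤p a<f
... | no  a≮f = ⊥-elim (nd (ℕ∣.∣-trans (p^-mono-∣ p (ℕₚ.≮⇒≥ a≮f)) d))

smooth-bound : ∀ {f₃ f₅ f₇} M → Smooth357 M → ¬ 3 ^ f₃ ∣ℕ M → ¬ 5 ^ f₅ ∣ℕ M → ¬ 7 ^ f₇ ∣ℕ M →
               M < 3 ^ f₃ * (5 ^ f₅ * 7 ^ f₇)
smooth-bound {f₃} {f₅} {f₇} M (a , b , c , refl) n₃ n₅ n₇ =
  ℕₚ.*-mono-< (∤^⇒^< 3 {f₃} {a} M (s≤s (s≤s z≤n)) (ℕ∣.m∣m*n _) n₃)
    (ℕₚ.*-mono-< (∤^⇒^< 5 {f₅} {b} M (s≤s (s≤s z≤n)) (ℕ∣.∣n⇒∣m*n (3 ^ a) (ℕ∣.m∣m*n (7 ^ c))) n₅)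
      (∤^⇒^< 7 {f₇} {c} M (s≤s (s≤s z≤n)) (ℕ∣.∣n⇒∣m*n (3 ^ a) (ℕ∣.n∣m*n (5 ^ b))) n₇))

!-mono-∣ : ∀ {m n} → m ≤ n → m ! ∣ℕ n !
!-mono-∣ {m} m≤n with ℕₚ.m≤n⇒∃[o]m+o≡n m≤n
... | o , refl = go o
  where
  go : ∀ o → m ! ∣ℕ (m + o) !
  go zero    = subst (λ e → m ! ∣ℕ e !) (sym (ℕₚ.+-identityʳ m)) ℕ∣.∣-refl
  go (suc o) = subst (λ e → m ! ∣ℕ e !) (sym (ℕₚ.+-suc m o)) (ℕ∣.∣n⇒∣m*n (suc (m + o)) (go o))

^∣! : ∀ d .{{_ : NonZero d}} f → d ^ f ∣ℕ (d * f) !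
^∣! d zero = ℕ∣.1∣ ((d * 0) !)
^∣! (suc d) (suc f) = subst (λ e → suc d ^ suc f ∣ℕ e !) (sym (ℕₚ.*-suc (suc d) f))
  (ℕ∣.*-pres-∣ (subst (suc d ∣ℕ_) (ℕₚ.*-suc (suc d) f) (ℕ∣.m∣m*n (suc f)))
    (ℕ∣.∣-trans (^∣! (suc d) f) (!-mono-∣ (ℕₚ.m≤n+m (suc d * f) d))))

sign-abs : ∀ {ε} → Sign ε → ∣ ε ∣ ≡ 1
sign-abs (inj₁ refl) = refl
sign-abs (inj₂ refl) = refl

sign-*-abs : ∀ {ε} → Sign ε → ∀ i → ∣ ε ℤ.* i ∣ ≡ ∣ i ∣
sign-*-abs {ε} s i = trans (ℤₚ.abs-* ε i) (trans (cong (_* ∣ i ∣) (sign-abs s)) (ℕₚ.*-identityˡ ∣ i ∣))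

2∣! : ∀ {m} → 2 ≤ m → + 2 ∣ℤ + (m !)
2∣! 2≤m = ℤ∣.∣ᵤ⇒∣ (!-mono-∣ 2≤m)

2∤bigN : ∀ n m {ε₁ ε₂} → 2 ≤ m → Sign ε₁ → ¬ 2 ∣ℕ ∣ bigN n ε₁ ε₂ m ∣
2∤bigN n m {ε₁} {ε₂} 2≤m s₁ d = ℕₚ.<⇒≱ (s≤s (s≤s z≤n)) (ℕ∣.∣⇒≤ (subst (2 ∣ℕ_) (sign-abs s₁) (ℤ∣.∣⇒∣ᵤ 2∣ε₁)))
  where
  even : ∀ n → + 2 ∣ℤ + (n * 2 ^ n)
  even zero    = ∣-0
  even (suc n) = ℤ∣.∣ᵤ⇒∣ (ℕ∣.∣n⇒∣m*n (suc n) (ℕ∣.m∣m*n (2 ^ n)))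
  lem : ∀ a e b → a ℤ.+ e ℤ.+ b ℤ.- (a ℤ.+ b) ≡ e
  lem = solveℤ
  2∣ε₁ : + 2 ∣ℤ ε₁
  2∣ε₁ = subst (+ 2 ∣ℤ_) (lem (+ (n * 2 ^ n)) ε₁ (ε₂ ℤ.* + (m !)))
    (ℤ∣.∣m∣n⇒∣m-n {m = bigN n ε₁ ε₂ m} (ℤ∣.∣ᵤ⇒∣ d) (ℤ∣.∣m∣n⇒∣m+n {m = + (n * 2 ^ n)} (even n) (ℤ∣.∣n⇒∣m*n ε₂ {+ (m !)} (2∣! 2≤m))))

Shallow : ℕ → ℕ → ℕ → ℤ → Set
Shallow p f n w = ¬ (+ p) ℤ.^ f ∣ℤ + (n * 2 ^ n) ℤ.- w

shallow-bigN : ∀ p f n m {ε₁ ε₂} → Shallow p f n (ℤ.- (ε₁ ℤ.+ ε₂ ℤ.* + (m !))) → ¬ p ^ f ∣ℕ ∣ bigN n ε₁ ε₂ m ∣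
shallow-bigN p f n m {ε₁} {ε₂} sh d = sh (subst ((+ p) ℤ.^ f ∣ℤ_) (lem (+ (n * 2 ^ n)) ε₁ (ε₂ ℤ.* + (m !))) (∣ℕ⇒∣ p f d))
  where
  lem : ∀ a e b → a ℤ.+ e ℤ.+ b ≡ a ℤ.- (ℤ.- (e ℤ.+ b))
  lem = solveℤ

shallow-bigN-! : ∀ p f n m {ε₁ ε₂} → p ^ f ∣ℕ m ! → Shallow p f n (ℤ.- ε₁) → ¬ p ^ f ∣ℕ ∣ bigN n ε₁ ε₂ m ∣
shallow-bigN-! p f n m {ε₁} {ε₂} p∣m! sh d = sh (subst ((+ p) ℤ.^ f ∣ℤ_) (lem (+ (n * 2 ^ n)) ε₁ (ε₂ ℤ.* + (m !)))
  (ℤ∣.∣m∣n⇒∣m-n {m = bigN n ε₁ ε₂ m} (∣ℕ⇒∣ p f d) (ℤ∣.∣n⇒∣m*n ε₂ {+ (m !)} (∣ℕ⇒∣ p f p∣m!))))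
  where
  lem : ∀ a e b → a ℤ.+ e ℤ.+ b ℤ.- b ≡ a ℤ.- (ℤ.- e)
  lem = solveℤ

bigN-smooth : ∀ n m {ε₁ ε₂} → Solution n m ε₁ ε₂ → Smooth357 ∣ bigN n ε₁ ε₂ m ∣
bigN-smooth n m {ε₁} {ε₂} (2≤m , s₁ , s₂ , N≢0 , ≤7) = odd-smooth ∣ bigN n ε₁ ε₂ m ∣
  {{≢-nonZero (λ e → N≢0 (ℤₚ.∣i∣≡0⇒i≡0 e))}} ≤7 (2∤bigN n m {ε₁} {ε₂} 2≤m s₁)

∣bigN∣-bound : ∀ n m {ε₁ ε₂} f₃ f₅ f₇ → Solution n m ε₁ ε₂ →
  ¬ 3 ^ f₃ ∣ℕ ∣ bigN n ε₁ ε₂ m ∣ → ¬ 5 ^ f₅ ∣ℕ ∣ bigN n ε₁ ε₂ m ∣ → ¬ 7 ^ f₇ ∣ℕ ∣ bigN n ε₁ ε₂ m ∣ →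
  ∣ bigN n ε₁ ε₂ m ∣ < 3 ^ f₃ * (5 ^ f₅ * 7 ^ f₇)
∣bigN∣-bound n m {ε₁} {ε₂} f₃ f₅ f₇ sol = smooth-bound {f₃} {f₅} {f₇} ∣ bigN n ε₁ ε₂ m ∣ (bigN-smooth n m sol)

-- If m is so large that m! is highly divisible by 2, 3, 5 and 7, then N ≡ ε₁ modulo a power of 2
-- exceeding ∣N∣ + 1, so that N = ε₁ and n 2ⁿ = m!.
large-m-impossible : ∀ n m {ε₁ ε₂} B e f₃ → Sign ε₁ → Sign ε₂ → ∣ bigN n ε₁ ε₂ m ∣ < B → B < 2 ^ e →
  2 ^ e ∣ℕ n * 2 ^ n → 2 ^ e ∣ℕ m ! → 3 ^ f₃ ∣ℕ m ! → n < 3 ^ f₃ → ⊥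
large-m-impossible n m {ε₁} {ε₂} B e f₃ s₁ s₂ N<B B<2^e 2∣n 2∣m 3∣m n<3 = m!≢0 (trans (sym n2ⁿ≡m!) (cong (_* 2 ^ n) n≡0))
  where
  N = bigN n ε₁ ε₂ m
  a = + (n * 2 ^ n)
  b = ε₂ ℤ.* + (m !)
  lem : ∀ a e b → a ℤ.+ b ≡ a ℤ.+ e ℤ.+ b ℤ.- e
  lem = solveℤ
  div : (+ 2) ℤ.^ e ∣ℤ a ℤ.+ b
  div = ℤ∣.∣m∣n⇒∣m+n {m = a} (∣ℕ⇒∣ 2 e 2∣n) (ℤ∣.∣n⇒∣m*n ε₂ {+ (m !)} (∣ℕ⇒∣ 2 e 2∣m))
  small : ∣ a ℤ.+ b ∣ < 2 ^ e
  small = subst (λ i → ∣ i ∣ < 2 ^ e) (sym (lem a ε₁ b)) (ℕₚ.≤-<-trans (ℤₚ.∣i-j∣≤∣i∣+∣j∣ N ε₁)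
    (ℕₚ.≤-<-trans (ℕₚ.≤-trans (ℕₚ.≤-reflexive (trans (cong (_+_ ∣ N ∣) (sign-abs s₁)) (ℕₚ.+-comm ∣ N ∣ 1))) N<B) B<2^e))
  zero-sum : a ℤ.+ b ≡ 0ℤ
  zero-sum = small∣⇒0 e div small
  n2ⁿ≡m! : n * 2 ^ n ≡ m !
  n2ⁿ≡m! = trans (cong ∣_∣ (trans (lem₂ a b) (trans (cong (ℤ._- b) zero-sum) (ℤₚ.+-identityˡ (ℤ.- b)))))
    (trans (ℤₚ.∣-i∣≡∣i∣ b) (sign-*-abs s₂ (+ (m !))))
    where
    lem₂ : ∀ a b → a ≡ a ℤ.+ b ℤ.- b
    lem₂ = solveℤ
  prime3 : Prime 3
  prime3 = toWitness {a? = prime? 3} _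
  -- As 2ⁿ is prime to 3, the power of 3 in m! = n 2ⁿ must come from n, which is too small unless it
  -- is zero; but m! is not zero.
  3∣n : 3 ^ f₃ ∣ℕ n
  3∣n = ∤-cancel prime3 {2 ^ n} (subst (λ x → ¬ 3 ∣ℕ x) (abs-^ (+ 2) n) (∤-^ prime3 {+ 2} (λ h → ℕₚ.<⇒≱ (ℕₚ.≤-refl {3}) (ℕ∣.∣⇒≤ h)) n)) f₃
    (subst (3 ^ f₃ ∣ℕ_) (trans (sym n2ⁿ≡m!) (ℕₚ.*-comm n (2 ^ n))) 3∣m)
  n≡0 : n ≡ 0
  n≡0 with n ℕₚ.≟ 0
  ... | yes z = z
  ... | no nz = ⊥-elim (ℕₚ.<⇒≱ n<3 (ℕ∣.∣⇒≤ {{≢-nonZero nz}} 3∣n))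
  m!≢0 : m ! ≢ 0
  m!≢0 h = ℕₚ.<⇒≢ (ℕₚ.1≤n! m) (sym h)

-- Excluding n ≥ 2²¹⁰

!≤^ : ∀ {m k} → m ≤ k → m ! ≤ k ^ m
!≤^ {zero}      _   = s≤s z≤n
!≤^ {suc m} {k} m<k = ℕₚ.*-mono-≤ m<k (!≤^ (ℕₚ.<⇒≤ m<k))

3ᶠ5ᶠ7ᶠ<2⁷ᶠ : ∀ f → 1 ≤ f → 3 ^ f * (5 ^ f * 7 ^ f) < 2 ^ (7 * f)
3ᶠ5ᶠ7ᶠ<2⁷ᶠ f 1≤f = subst₂ _<_
  (trans (^-distribʳ-* 3 35 f) (cong (3 ^ f *_) (^-distribʳ-* 5 7 f)))
  (ℕₚ.^-*-assoc 2 7 f) (ℕₚ.^-monoˡ-< f {{>-nonZero 1≤f}} (ℕₚ.≤ᵇ⇒≤ 106 128 _))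

!-sign≢0 : ∀ {m ε₁ ε₂} → 2 ≤ m → Sign ε₁ → Sign ε₂ → ε₁ ℤ.+ ε₂ ℤ.* + (m !) ≢ 0ℤ
!-sign≢0 {m} {ε₁} {ε₂} 2≤m s₁ s₂ eq = ℕₚ.<⇒≱ (s≤s (ℕₚ.≤-refl {1})) (ℕₚ.≤-trans (2≤! 2≤m) (ℕₚ.≤-reflexive m!≡1))
  where
  lem : ∀ a b → b ≡ a ℤ.+ b ℤ.- a
  lem = solveℤ
  2≤! : ∀ {m} → 2 ≤ m → 2 ≤ m !
  2≤! {m} 2≤m = ℕ∣.∣⇒≤ {{>-nonZero (ℕₚ.1≤n! m)}} (!-mono-∣ 2≤m)
  m!≡1 : m ! ≡ 1
  m!≡1 = trans (sym (sign-*-abs s₂ (+ (m !)))) (trans (cong ∣_∣ (lem ε₁ (ε₂ ℤ.* + (m !))))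
    (trans (cong (λ i → ∣ i ℤ.- ε₁ ∣) eq) (trans (cong ∣_∣ (ℤₚ.+-identityˡ (ℤ.- ε₁))) (trans (ℤₚ.∣-i∣≡∣i∣ ε₁) (sign-abs s₁)))))

∣sign+!∣≤ : ∀ {m ε₁ ε₂} → Sign ε₁ → Sign ε₂ → ∣ ε₁ ℤ.+ ε₂ ℤ.* + (m !) ∣ ≤ 1 + m !
∣sign+!∣≤ {m} {ε₁} {ε₂} s₁ s₂ = ℕₚ.≤-trans (ℤₚ.∣i+j∣≤∣i∣+∣j∣ ε₁ (ε₂ ℤ.* + (m !)))
  (ℕₚ.≤-reflexive (cong₂ _+_ (sign-abs s₁) (sign-*-abs s₂ (+ (m !)))))

n2ⁿ≤ : ∀ n m {ε₁ ε₂} → Sign ε₁ → Sign ε₂ → n * 2 ^ n ≤ ∣ bigN n ε₁ ε₂ m ∣ + (1 + m !)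
n2ⁿ≤ n m {ε₁} {ε₂} s₁ s₂ = begin
  n * 2 ^ n                                          ≡⟨ cong ∣_∣ (lem (+ (n * 2 ^ n)) ε₁ (ε₂ ℤ.* + (m !))) ⟩
  ∣ bigN n ε₁ ε₂ m ℤ.- (ε₁ ℤ.+ ε₂ ℤ.* + (m !)) ∣    ≤⟨ ℤₚ.∣i-j∣≤∣i∣+∣j∣ (bigN n ε₁ ε₂ m) (ε₁ ℤ.+ ε₂ ℤ.* + (m !)) ⟩
  ∣ bigN n ε₁ ε₂ m ∣ + ∣ ε₁ ℤ.+ ε₂ ℤ.* + (m !) ∣    ≤⟨ ℕₚ.+-monoʳ-≤ ∣ bigN n ε₁ ε₂ m ∣ (∣sign+!∣≤ {m} s₁ s₂) ⟩
  ∣ bigN n ε₁ ε₂ m ∣ + (1 + m !)                     ∎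
  where
  open ℕₚ.≤-Reasoning
  lem : ∀ a e b → a ≡ a ℤ.+ e ℤ.+ b ℤ.- (e ℤ.+ b)
  lem = solveℤ

module LargeN (k₀ m₀ A : ℕ)
  (k₀-large : 2396672 * 4 < k₀)
  (c₁ : 64 * 2 * 576 * m₀ * k₀ ≤ A) (c₂ : m₀ * k₀ ≤ A) (c₃ : 18 * k₀ ≤ A) (c₄ : 21 * (m₀ * k₀) ≤ A) (c₅ : 2 ^ 21 ≤ A)
  (c₆ : 770 * (k₀ * k₀) ≤ m₀) (c₇ : 196 * (k₀ * k₀) * m₀ ≤ A) (c₈ : m₀ ≤ A)
  (x : ℕ) (g : Growth A x) (n : ℕ) (lo : 2 ^ x ≤ n) (hi : n < 2 * 2 ^ x) where
  private
    t = suc x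
    Q = 2 ^ x
    kk = k₀ * k₀
    module W {p} (b : Base p) = Window k₀ m₀ A k₀-large c₁ c₂ c₃ c₄ c₅ b x g
    -- The depth that `not-deep` needs for w = -ε₁ with μ = 2 t; the 1 added in `f` is its j, as ∣w∣
    -- = 1 < p.
    k₁ = 27 * kk * ((t + t) * t ^ 5)
    f = k₁ + 1
    1≤t : 1 ≤ t
    1≤t = s≤s z≤n
    poly : ∀ a j → a ≤ A → j ≤ 12 → a * t ^ j ≤ Q
    poly a j a≤ j≤ = poly≤ A a j t Q g a≤ j≤ 1≤t
    1≤k₀ : 1 ≤ k₀
    1≤k₀ = ℕₚ.≤-trans (s≤s z≤n) k₀-large
    2≤k₀ : 2 ≤ k₀
    2≤k₀ = ℕₚ.≤-trans (ℕₚ.≤ᵇ⇒≤ 2 9586689 _) k₀-large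
    1≤kk : 1 ≤ kk
    1≤kk = ℕₚ.*-mono-≤ 1≤k₀ 1≤k₀
    2≤kk : 2 ≤ kk
    2≤kk = ℕₚ.*-mono-≤ {2} {k₀} {1} {k₀} 2≤k₀ 1≤k₀
    1≤t^ : ∀ j → 1 ≤ t ^ j
    1≤t^ j = ℕₚ.m^n>0 t j
    1≤f : 1 ≤ f
    1≤f = ℕₚ.m≤n+m 1 k₁

  f≤ : 14 * f ≤ 770 * kk * t ^ 6
  f≤ = ℕₚ.≤-trans (ℕₚ.*-monoʳ-≤ 14 (ℕₚ.+-monoʳ-≤ k₁ (ℕₚ.*-mono-≤ 1≤kk (1≤t^ 6))))
    (ℕₚ.≤-reflexive (trans (lem 14 27 kk t (t ^ 5)) (cong (λ a → a * kk * (t * t ^ 5)) const)))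
    where
    lem : ∀ a b k t s → a * (b * k * ((t + t) * s) + k * (t * s)) ≡ a * (b * 2 + 1) * k * (t * s)
    lem = solve-∀
    const : 14 * (27 * 2 + 1) ≡ 770
    const = refl

  14f≤Q : 14 * f ≤ Q
  14f≤Q = ℕₚ.≤-trans f≤ (poly (770 * kk) 6 (ℕₚ.≤-trans c₆ c₈) (ℕₚ.m≤m+n 6 6))

  t≤f : t ≤ f
  t≤f = ℕₚ.≤-trans (ℕₚ.≤-trans (ℕₚ.m≤m+n t t) (ℕₚ.≤-trans (ℕₚ.m≤m*n (t + t) (t ^ 5) {{>-nonZero (1≤t^ 5)}})
    (ℕₚ.m≤n*m _ (27 * kk) {{>-nonZero (ℕₚ.*-mono-≤ {1} {27} (s≤s z≤n) 1≤kk)}}))) (ℕₚ.m≤m+n k₁ 1)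

  -- For m < 14 f ≤ 2ˣ one has m! ≤ 2^(x m), hence 1 + m! ≤ 2^μ.
  μ : ℕ
  μ = t * (14 * f)

  μ≤ : μ ≤ m₀ * t ^ 7
  μ≤ = ℕₚ.≤-trans (ℕₚ.*-monoʳ-≤ t f≤) (ℕₚ.≤-trans (ℕₚ.≤-reflexive (lem (770 * kk) t (t ^ 6))) (ℕₚ.*-monoˡ-≤ (t ^ 7) c₆))
    where
    lem : ∀ a t s → t * (a * s) ≡ a * (t * s)
    lem = solve-∀

  2t≤μ : t + t ≤ μ
  2t≤μ = ℕₚ.≤-trans (ℕₚ.≤-reflexive (trans (cong (_+_ t) (sym (ℕₚ.+-identityʳ t))) (ℕₚ.*-comm 2 t)))
    (ℕₚ.*-monoʳ-≤ t (ℕₚ.*-mono-≤ {2} {14} {1} (ℕₚ.≤ᵇ⇒≤ 2 14 _) 1≤f))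

  shallow-sign : ∀ {p} → Base p → ∀ {ε} → Sign ε → Shallow p f n (ℤ.- ε)
  shallow-sign {p} b {ε} s = W.not-deep b 1 n n (t + t) k₁ (ℤ.- ε) lo hi ℕₚ.≤-refl
    (λ z → ℕₚ.<⇒≢ (s≤s (z≤n {0})) (sym (trans (sym ∣-ε∣) (cong ∣_∣ z))))
    (subst₂ _<_ (sym ∣-ε∣) (sym (ℕₚ.*-identityʳ p)) (ℕₚ.≤-trans (s≤s (s≤s z≤n)) (Base.3≤p b)))
    ℕₚ.≤-refl (ℕₚ.≤-trans 2t≤μ μ≤) (subst (_≤ 2 ^ (t + t)) (sym ∣-ε∣) (ℕₚ.m^n>0 2 (t + t))) ℕₚ.≤-refl
    where
    ∣-ε∣ : ∣ ℤ.- ε ∣ ≡ 1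
    ∣-ε∣ = trans (ℤₚ.∣-i∣≡∣i∣ ε) (sign-abs s)

  7f≤n : 7 * f ≤ n
  7f≤n = ℕₚ.≤-trans (ℕₚ.*-monoˡ-≤ f (ℕₚ.m≤m+n 7 7)) (ℕₚ.≤-trans 14f≤Q lo)

  n<3^f : n < 3 ^ f
  n<3^f = ℕₚ.<-≤-trans hi (ℕₚ.≤-trans (ℕₚ.^-monoˡ-≤ t (ℕₚ.n≤1+n 2)) (ℕₚ.^-monoʳ-≤ 3 t≤f))

  -- The factor 14 is 2 * 7: the bound on ∣N∣ is below 2^(7 f) because 105 < 2⁷, and 2^(7 f) divides
  -- (14 f)!. The powers 3^f, 5^f and 7^f then divide m! as well.
  large-m : ∀ m {ε₁ ε₂} → Solution n m ε₁ ε₂ → 14 * f ≤ m → ⊥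
  large-m m {ε₁} {ε₂} sol@(2≤m , s₁ , s₂ , _) 14f≤m = large-m-impossible n m (3 ^ f * (5 ^ f * 7 ^ f)) (7 * f) f s₁ s₂
    (∣bigN∣-bound n m f f f sol (nd base₃ (ℕₚ.≤ᵇ⇒≤ 3 14 _)) (nd base₅ (ℕₚ.≤ᵇ⇒≤ 5 14 _)) (nd base₇ (ℕₚ.≤ᵇ⇒≤ 7 14 _)))
    (3ᶠ5ᶠ7ᶠ<2⁷ᶠ f 1≤f) (ℕ∣.∣n⇒∣m*n n (p^-mono-∣ 2 7f≤n)) (ℕ∣.∣-trans (^∣! 2 (7 * f)) (!-mono-∣ (ℕₚ.≤-trans (ℕₚ.≤-reflexive (sym (ℕₚ.*-assoc 2 7 f))) 14f≤m)))
    (p∣ base₃ (ℕₚ.≤ᵇ⇒≤ 3 14 _)) n<3^f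
    where
    p∣ : ∀ {p} → Base p → p ≤ 14 → p ^ f ∣ℕ m !
    p∣ {p} b p≤14 = ℕ∣.∣-trans (^∣! p {{prime⇒nonZero (Base.isPrime b)}} f) (!-mono-∣ (ℕₚ.≤-trans (ℕₚ.*-monoˡ-≤ f p≤14) 14f≤m))
    nd : ∀ {p} → Base p → p ≤ 14 → ¬ p ^ f ∣ℕ ∣ bigN n ε₁ ε₂ m ∣
    nd {p} b p≤14 = shallow-bigN-! p f n m {ε₁} {ε₂} (p∣ b p≤14) (shallow-sign b s₁)

  -- The first summand is the depth for ∣w∣ ≤ 2^μ. The second provides for common factors p of n and
  -- w, of which there are at most μ.
  F : ℕ
  F = 27 * kk * (μ * t ^ 5) + suc μ

  7F≤n : 7 * F ≤ n
  7F≤n = begin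
    7 * F                                         ≤⟨ ℕₚ.*-monoʳ-≤ 7 (ℕₚ.+-monoʳ-≤ (27 * kk * (μ * t ^ 5)) sμ≤) ⟩
    7 * (27 * kk * (μ * t ^ 5) + kk * (μ * t ^ 5)) ≡⟨ lem 7 27 kk μ (t ^ 5) ⟩
    7 * (27 + 1) * kk * (μ * t ^ 5)               ≤⟨ ℕₚ.*-monoʳ-≤ (196 * kk) (ℕₚ.*-monoˡ-≤ (t ^ 5) μ≤) ⟩
    196 * kk * (m₀ * t ^ 7 * t ^ 5)               ≡⟨ trans (cong (196 * kk *_) (trans (ℕₚ.*-assoc m₀ (t ^ 7) (t ^ 5))
                                                       (cong (m₀ *_) (sym (ℕₚ.^-distribˡ-+-* t 7 5))))) (sym (ℕₚ.*-assoc (196 * kk) m₀ (t ^ 12))) ⟩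
    196 * kk * m₀ * t ^ 12                        ≤⟨ poly (196 * kk * m₀) 12 c₇ ℕₚ.≤-refl ⟩
    Q                                             ≤⟨ lo ⟩
    n                                             ∎
    where
    open ℕₚ.≤-Reasoning
    lem : ∀ a b k μ s → a * (b * k * (μ * s) + k * (μ * s)) ≡ a * (b + 1) * k * (μ * s)
    lem = solve-∀
    1≤μ : 1 ≤ μ
    1≤μ = ℕₚ.≤-trans (s≤s z≤n) 2t≤μ
    sμ≤ : suc μ ≤ kk * (μ * t ^ 5)
    sμ≤ = ℕₚ.≤-trans (ℕₚ.≤-trans (ℕₚ.+-monoˡ-≤ μ 1≤μ) (ℕₚ.≤-reflexive (cong (_+_ μ) (sym (ℕₚ.+-identityʳ μ)))))
      (ℕₚ.*-mono-≤ 2≤kk (ℕₚ.m≤m*n μ (t ^ 5) {{>-nonZero (1≤t^ 5)}}))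

  small-m : ∀ m {ε₁ ε₂} → Solution n m ε₁ ε₂ → m < 14 * f → ⊥
  small-m m {ε₁} {ε₂} sol@(2≤m , s₁ , s₂ , _) m<14f = ℕₚ.<⇒≱ total (begin
      2 ^ n + 2 ^ n    ≡⟨ cong (_+_ (2 ^ n)) (sym (ℕₚ.+-identityʳ (2 ^ n))) ⟩
      2 * 2 ^ n        ≤⟨ ℕₚ.*-monoˡ-≤ (2 ^ n) 2≤n ⟩
      n * 2 ^ n        ∎)
    where
    open ℕₚ.≤-Reasoning
    w = ℤ.- (ε₁ ℤ.+ ε₂ ℤ.* + (m !))
    1+m!≤ : 1 + m ! ≤ 2 ^ μ
    1+m!≤ = begin
      1 + m !            ≤⟨ ℕₚ.+-mono-≤ (ℕₚ.m^n>0 2 (x * m)) (ℕₚ.≤-trans (!≤^ (ℕₚ.≤-trans (ℕₚ.<⇒≤ m<14f) 14f≤Q)) (ℕₚ.≤-reflexive (trans (ℕₚ.^-*-assoc 2 x m) (sym (ℕₚ.+-identityʳ (2 ^ (x * m))))))) ⟩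
      2 ^ suc (x * m)    ≤⟨ ℕₚ.^-monoʳ-≤ 2 (ℕₚ.≤-trans (ℕₚ.+-mono-≤ {1} {suc m} (s≤s z≤n) (ℕₚ.*-monoʳ-≤ x (ℕₚ.n≤1+n m))) (ℕₚ.*-monoʳ-≤ t m<14f)) ⟩
      2 ^ μ              ∎
    w≤ : ∣ w ∣ ≤ 2 ^ μ
    w≤ = subst (_≤ 2 ^ μ) (sym (ℤₚ.∣-i∣≡∣i∣ (ε₁ ℤ.+ ε₂ ℤ.* + (m !)))) (ℕₚ.≤-trans (∣sign+!∣≤ {m} s₁ s₂) 1+m!≤)
    nd : ∀ {p} → Base p → ¬ p ^ F ∣ℕ ∣ bigN n ε₁ ε₂ m ∣
    nd {p} b = shallow-bigN p F n m {ε₁} {ε₂} (W.not-deep b (suc μ) n n μ (27 * kk * (μ * t ^ 5)) w lo hi ℕₚ.≤-refl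
      (λ z → !-sign≢0 {m} 2≤m s₁ s₂ (trans (sym (ℤₚ.neg-involutive _)) (cong ℤ.-_ z)))
      (ℕₚ.≤-<-trans w≤ (ℕₚ.<-≤-trans (ℕₚ.^-monoʳ-< 2 (s≤s (s≤s z≤n)) (ℕₚ.n<1+n μ)) (ℕₚ.^-monoˡ-≤ (suc μ) (ℕₚ.≤-trans (ℕₚ.n≤1+n 2) (Base.3≤p b)))))
      2t≤μ μ≤ w≤ ℕₚ.≤-refl)
    1≤F : 1 ≤ F
    1≤F = ℕₚ.≤-trans (s≤s z≤n) (ℕₚ.m≤n+m (suc μ) (27 * kk * (μ * t ^ 5)))
    2≤n : 2 ≤ n
    2≤n = ℕₚ.≤-trans (ℕₚ.*-mono-≤ {2} {7} (s≤s (s≤s z≤n)) 1≤F) 7F≤n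
    N< : ∣ bigN n ε₁ ε₂ m ∣ < 2 ^ n
    N< = ℕₚ.<-≤-trans (ℕₚ.<-trans (∣bigN∣-bound n m F F F sol (nd base₃) (nd base₅) (nd base₇)) (3ᶠ5ᶠ7ᶠ<2⁷ᶠ F 1≤F)) (ℕₚ.^-monoʳ-≤ 2 7F≤n)
    μ≤n : μ ≤ n
    μ≤n = ℕₚ.≤-trans (ℕₚ.≤-trans (ℕₚ.n≤1+n μ) (ℕₚ.≤-trans (ℕₚ.m≤n+m (suc μ) (27 * kk * (μ * t ^ 5))) (ℕₚ.m≤n*m F 7))) 7F≤n
    total : n * 2 ^ n < 2 ^ n + 2 ^ n
    total = ℕₚ.≤-<-trans (n2ⁿ≤ n m s₁ s₂) (ℕₚ.+-mono-<-≤ N< (ℕₚ.≤-trans 1+m!≤ (ℕₚ.^-monoʳ-≤ 2 μ≤n)))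

  no-solution : ∀ m {ε₁ ε₂} → Solution n m ε₁ ε₂ → ⊥
  no-solution m sol with m ℕₚ.<? 14 * f
  ... | yes h = small-m m sol h
  ... | no  h = large-m m sol (ℕₚ.≮⇒≥ h)

large-n-impossible : ∀ n m {ε₁ ε₂} → Solution n m ε₁ ε₂ → n < 2 ^ 210
large-n-impossible n m sol with n ℕₚ.<? 2 ^ 210
... | yes h = h
... | no  h with log-range n (ℕₚ.≤-trans (ℕₚ.m^n>0 2 210) (ℕₚ.≮⇒≥ h))
... | x , lo , hi = ⊥-elim (LargeN.no-solution k₀ m₀ A (le (2396672 * 4 + 1) k₀ _) (le (64 * 2 * 576 * m₀ * k₀) A _) (le (m₀ * k₀) A _)
        (le (18 * k₀) A _) (le (21 * (m₀ * k₀)) A _) (le (2 ^ 21) A _) (le (770 * (k₀ * k₀)) m₀ _) (le (196 * (k₀ * k₀) * m₀) A _) (le m₀ A _)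
        x (growth x x≥) n lo hi m sol)
  where
  -- `k₀` is the first power of ten above 4 * 2396672, the 4 coming from c² = 4 t². `m₀` is exactly
  -- 770 k₀². The strongest demand on `A` is 196 k₀² m₀, about 1.51 * 10^33.
  k₀ = 10 ^ 7
  m₀ = 77 * 10 ^ 15
  A = 2 * 10 ^ 33
  le = ℕₚ.≤ᵇ⇒≤
  x≥ : 210 ≤ x
  x≥ = ℕₚ.≮⇒≥ (λ x<210 → ℕₚ.<⇒≱ hi (ℕₚ.≤-trans (ℕₚ.^-monoʳ-≤ 2 x<210) (ℕₚ.≮⇒≥ h)))

-- Solutions of x 2ˣ ≡ W modulo prime powers, and their certified search

record Order (p q : ℕ) : Set where
  field
    isPrime : Prime p
    p∤2     : ¬ p ∣ℕ 2
    p∤q     : ¬ p ∣ℕ q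
    {{q≢0}} : NonZero q
    2^q     : + p ∣ℤ (+ 2) ℤ.^ q ℤ.- 1ℤ

geometric : ℤ → ℕ → ℤ
geometric y zero    = 0ℤ
geometric y (suc e) = 1ℤ ℤ.+ y ℤ.* geometric y e

geometric-* : ∀ y e → y ℤ.^ e ℤ.- 1ℤ ≡ (y ℤ.- 1ℤ) ℤ.* geometric y e
geometric-* y zero    = sym (ℤₚ.*-zeroʳ (y ℤ.- 1ℤ))
geometric-* y (suc e) = trans (lem y (y ℤ.^ e)) (trans (cong (λ a → y ℤ.- 1ℤ ℤ.+ y ℤ.* a) (geometric-* y e)) (lem₂ y (geometric y e)))
  where
  lem : ∀ y a → y ℤ.* a ℤ.- 1ℤ ≡ y ℤ.- 1ℤ ℤ.+ y ℤ.* (a ℤ.- 1ℤ)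
  lem = solveℤ
  lem₂ : ∀ y g → y ℤ.- 1ℤ ℤ.+ y ℤ.* ((y ℤ.- 1ℤ) ℤ.* g) ≡ (y ℤ.- 1ℤ) ℤ.* (1ℤ ℤ.+ y ℤ.* g)
  lem₂ = solveℤ

geometric-≡ : ∀ {k y} → k ∣ℤ y ℤ.- 1ℤ → ∀ e → k ∣ℤ geometric y e ℤ.- + e
geometric-≡ h zero    = ∣-0
geometric-≡ {k} {y} h (suc e) = subst (k ∣ℤ_) (lem y (geometric y e) (+ e))
  (ℤ∣.∣m∣n⇒∣m+n (ℤ∣.∣n⇒∣m*n y (geometric-≡ h e)) (ℤ∣.∣m⇒∣m*n (+ e) h))
  where
  lem : ∀ y g e → y ℤ.* (g ℤ.- e) ℤ.+ (y ℤ.- 1ℤ) ℤ.* e ≡ 1ℤ ℤ.+ y ℤ.* g ℤ.- (1ℤ ℤ.+ e)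
  lem = solveℤ

*-pres-∣ℤ : ∀ {a b c d} → a ∣ℤ b → c ∣ℤ d → a ℤ.* c ∣ℤ b ℤ.* d
*-pres-∣ℤ {a} {b} {c} {d} h k = ℤ∣.∣-trans (ℤ∣.*-monoˡ-∣ c h) (ℤ∣.*-monoʳ-∣ b k)

-- Lifting the exponent: if u ≡ 1 (mod p), then u^p - 1 is u - 1 times a sum of p terms congruent to
-- 1, so each p-th power gains a factor p.
lift-power : ∀ {p y} → + p ∣ℤ y ℤ.- 1ℤ → ∀ j e → p ^ j ∣ℕ e → (+ p) ℤ.^ suc j ∣ℤ y ℤ.^ e ℤ.- 1ℤ
lift-power {p} {y} h zero e _ = subst₂ _∣ℤ_ (sym (ℤₚ.*-identityʳ (+ p))) (sym (geometric-* y e)) (ℤ∣.∣m⇒∣m*n (geometric y e) h)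
lift-power {p} {y} h (suc j) e (ℕ∣.divides e′ refl) = subst (λ a → (+ p) ℤ.^ suc (suc j) ∣ℤ a ℤ.- 1ℤ) eq
  (subst ((+ p) ℤ.^ suc (suc j) ∣ℤ_) (sym (geometric-* u p))
    (subst (_∣ℤ (u ℤ.- 1ℤ) ℤ.* geometric u p) (ℤₚ.*-comm ((+ p) ℤ.^ suc j) (+ p)) (*-pres-∣ℤ hu p∣geo)))
  where
  u = y ℤ.^ (e′ * p ^ j)
  hu : (+ p) ℤ.^ suc j ∣ℤ u ℤ.- 1ℤ
  hu = lift-power h j (e′ * p ^ j) (ℕ∣.divides e′ refl)
  lem : ∀ g p → g ℤ.- p ℤ.+ p ≡ g
  lem = solveℤ
  p∣geo : + p ∣ℤ geometric u p
  p∣geo = subst (+ p ∣ℤ_) (lem (geometric u p) (+ p))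
    (ℤ∣.∣m∣n⇒∣m+n (geometric-≡ (ℤ∣.∣-trans (ℤ∣.∣m⇒∣m*n ((+ p) ℤ.^ j) ℤ∣.∣-refl) hu) p) ℤ∣.∣-refl)
  lem₂ : ∀ a b c → a * b * c ≡ a * (c * b)
  lem₂ = solve-∀
  eq : u ℤ.^ p ≡ y ℤ.^ (e′ * (p * p ^ j))
  eq = trans (ℤₚ.^-*-assoc y (e′ * p ^ j) p) (cong (y ℤ.^_) (lem₂ e′ (p ^ j) p))

module Roots {p q : ℕ} (o : Order p q) where
  open Order o
  private
    π = + p
    instance q≢0′ = q≢0
    h : ℕ → ℤ
    h n = + (n * 2 ^ n)

  2^-cong-≤ : ∀ {n x} → x ≤ n → n % q ≡ x % q → ∀ j → π ℤ.^ j ∣ℤ + n ℤ.- + x → π ℤ.^ suc j ∣ℤ + (2 ^ n) ℤ.- + (2 ^ x)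
  2^-cong-≤ {n} {x} x≤n n≡x j d = subst (π ℤ.^ suc j ∣ℤ_)
    (trans (lem (+ (2 ^ x)) ((+ 2) ℤ.^ (n ∸ x))) (cong (ℤ._- + (2 ^ x)) (trans (cong (ℤ._* (+ 2) ℤ.^ (n ∸ x)) (pos-^ 2 x))
      (trans (sym (ℤₚ.^-distribˡ-+-* (+ 2) x (n ∸ x))) (trans (cong ((+ 2) ℤ.^_) (ℕₚ.m+[n∸m]≡n x≤n)) (sym (pos-^ 2 n)))))))
    (ℤ∣.∣n⇒∣m*n (+ (2 ^ x)) one)
    where
    lem : ∀ a b → a ℤ.* (b ℤ.- 1ℤ) ≡ a ℤ.* b ℤ.- a
    lem = solveℤ
    diff : + n ℤ.- + x ≡ + (n ∸ x)
    diff = trans (ℤₚ.m-n≡m⊖n n x) (ℤₚ.⊖-≥ x≤n)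
    q∣ : q ∣ℕ n ∸ x
    q∣ = ℤ∣.∣⇒∣ᵤ (subst (+ q ∣ℤ_) diff (%ℕ≡⇒∣ q (+ n) (+ x) n≡x))
    one : π ℤ.^ suc j ∣ℤ (+ 2) ℤ.^ (n ∸ x) ℤ.- 1ℤ
    one with q∣
    ... | ℕ∣.divides e eq = subst (λ a → π ℤ.^ suc j ∣ℤ a ℤ.- 1ℤ)
        (trans (ℤₚ.^-*-assoc (+ 2) q e) (cong ((+ 2) ℤ.^_) (sym eq′)))
        (lift-power 2^q j e (∤-cancel isPrime p∤q j (subst (p ^ j ∣ℕ_) eq′ (∣⇒∣ℕ p j (subst (π ℤ.^ j ∣ℤ_) diff d)))))
      where
      eq′ : n ∸ x ≡ q * e
      eq′ = trans eq (ℕₚ.*-comm e q)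

  neg-sub : ∀ {k} a b → k ∣ℤ a ℤ.- b → k ∣ℤ b ℤ.- a
  neg-sub {k} a b d = subst (k ∣ℤ_) (lem a b) (ℤ∣.∣m⇒∣-m d)
    where
    lem : ∀ a b → ℤ.- (a ℤ.- b) ≡ b ℤ.- a
    lem = solveℤ

  2^-cong : ∀ n x → n % q ≡ x % q → ∀ j → π ℤ.^ j ∣ℤ + n ℤ.- + x → π ℤ.^ suc j ∣ℤ + (2 ^ n) ℤ.- + (2 ^ x)
  2^-cong n x n≡x j d with ℕₚ.≤-total x n
  ... | inj₁ x≤n = 2^-cong-≤ x≤n n≡x j d
  ... | inj₂ n≤x = neg-sub (+ (2 ^ x)) (+ (2 ^ n)) (2^-cong-≤ n≤x (sym n≡x) j (neg-sub (+ n) (+ x) d))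

  -- Bootstrapping: agreement of n and x modulo p^f gives agreement of 2ⁿ and 2ˣ modulo p^(f + 1),
  -- one power more by `2^-cong`. Then n 2ⁿ ≡ x 2ˣ becomes 2ⁿ (n - x) ≡ 0 at that higher level.
  root-unique : ∀ n x → n % q ≡ x % q → ∀ f → π ℤ.^ f ∣ℤ h n ℤ.- h x → π ℤ.^ f ∣ℤ + n ℤ.- + x
  root-unique n x n≡x zero    d = ℤ∣.divides (+ n ℤ.- + x) (sym (ℤₚ.*-identityʳ _))
  root-unique n x n≡x (suc f) d = unit-cancel isPrime {+ (2 ^ n)} p∤2ⁿ (suc f)
    (subst (π ℤ.^ suc f ∣ℤ_) eq (ℤ∣.∣m∣n⇒∣m-n d (ℤ∣.∣n⇒∣m*n (+ x)
      (2^-cong n x n≡x f (root-unique n x n≡x f (ℤ∣.∣-trans (^-monoʳ-∣ π (ℕₚ.n≤1+n f)) d))))))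
    where
    p∤2ⁿ : ¬ p ∣ℕ 2 ^ n
    p∤2ⁿ = subst (λ a → ¬ p ∣ℕ a) (abs-^ (+ 2) n) (∤-^ isPrime {+ 2} p∤2 n)
    lem : ∀ n x a b → n ℤ.* a ℤ.- x ℤ.* b ℤ.- x ℤ.* (a ℤ.- b) ≡ a ℤ.* (n ℤ.- x)
    lem = solveℤ
    eq : h n ℤ.- h x ℤ.- + x ℤ.* (+ (2 ^ n) ℤ.- + (2 ^ x)) ≡ + (2 ^ n) ℤ.* (+ n ℤ.- + x)
    eq = trans (cong₂ (λ a b → a ℤ.- b ℤ.- + x ℤ.* (+ (2 ^ n) ℤ.- + (2 ^ x))) (ℤₚ.pos-* n (2 ^ n)) (ℤₚ.pos-* x (2 ^ x)))
      (lem (+ n) (+ x) (+ (2 ^ n)) (+ (2 ^ x)))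

  -- A certified digit-by-digit search for the p-adic solutions x of x 2ˣ = W with x ≡ r (mod q).
  -- The steps (M , C , m) hold M = q pʲ, C = 2ᴹ mod P and m = pʲ⁺¹, and U is kept equal to 2ˣ mod P.
  data Steps : Set where
    done : Steps
    step : (M C m : ℕ) → Steps → Steps

  module _ (P₁ : ℕ) where
    P = suc P₁

    _%′_ : ℕ → ℕ → ℕ
    a %′ zero  = a
    a %′ suc m = a % suc m

    mkSteps : ℕ → ℕ → ℕ → ℕ → Steps
    mkSteps zero    M C m = done
    mkSteps (suc k) M C m = step M C m (mkSteps k (M * p) (C ^ p % P) (m * p))

    mutual
      search : Steps → (b W r x U : ℕ) → Bool
      search done           b W r x U = (x % q ≡ᵇ r) ∧ ((x * U) % P ≡ᵇ W) ∧ (b ≤ᵇ x % P)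
      search (step M C m s) b W r x U = digit p M C m s b W r x U

      digit : ℕ → (M C m : ℕ) → Steps → (b W r x U : ℕ) → Bool
      digit zero    M C m s b W r x U = false
      digit (suc k) M C m s b W r x U =
        if ((x * U) %′ m) ≡ᵇ (W %′ m) then search s b W r x U else digit k M C m s b W r (x + M) ((U * C) % P)

    allResidues : Steps → (b W : ℕ) → ℕ → Bool
    allResidues s b W zero    = true
    allResidues s b W (suc r) = search s b W r r (2 ^ r % P) ∧ allResidues s b W r

    -- The four targets are -(ε₁ + ε₂ F) modulo P, with `P₁` in the role of -1.
    allSigns : Steps → (b F : ℕ) → Bool
    allSigns s b F = allResidues s b ((P₁ * (1 + F)) % P) q ∧ allResidues s b ((F + P₁) % P) q
                   ∧ allResidues s b ((1 + P₁ * F) % P) q ∧ allResidues s b ((1 + F) % P) q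

    -- Infinitely many m are covered: once the factorial vanishes modulo P it does so for all larger
    -- m, and one test with F = 0 settles these.
    allFactorials : Steps → (b : ℕ) → ℕ → (m F : ℕ) → Bool
    allFactorials s b zero    m F = (F ≡ᵇ 0) ∧ allSigns s b 0
    allFactorials s b (suc k) m F = allSigns s b F ∧ allFactorials s b k (suc m) ((suc m * F) % P)

    certificate : (f b k : ℕ) → Bool
    certificate f b k = allFactorials (mkSteps f q (2 ^ q % P) p) b k 2 2

    -- Only the invariant U ≡ 2ˣ has to be trusted. The tests at `done` verify the root itself, so
    -- an unsuitable m or a wrong class modulo q could only make the search fail.
    Certified : Steps → Set
    Certified done           = ⊤
    Certified (step M C m s) = + P ∣ℤ + C ℤ.- + (2 ^ M) × Certified s

    %-∣ : ∀ a → + P ∣ℤ + (a % P) ℤ.- + a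
    %-∣ a = %ℕ≡⇒∣ P (+ (a % P)) (+ a) (m%n%n≡m%n a P)

    *-cong-∣ : ∀ {k a b c d} → k ∣ℤ a ℤ.- b → k ∣ℤ c ℤ.- d → k ∣ℤ a ℤ.* c ℤ.- b ℤ.* d
    *-cong-∣ {k} {a} {b} {c} {d} x y = subst (k ∣ℤ_) (lem a b c d) (ℤ∣.∣m∣n⇒∣m+n (ℤ∣.∣n⇒∣m*n a y) (ℤ∣.∣m⇒∣m*n d x))
      where
      lem : ∀ a b c d → a ℤ.* (c ℤ.- d) ℤ.+ (a ℤ.- b) ℤ.* d ≡ a ℤ.* c ℤ.- b ℤ.* d
      lem = solveℤ

    trans-∣ : ∀ {k} a b c → k ∣ℤ a ℤ.- b → k ∣ℤ b ℤ.- c → k ∣ℤ a ℤ.- c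
    trans-∣ {k} a b c x y = subst (k ∣ℤ_) (lem a b c) (ℤ∣.∣m∣n⇒∣m+n x y)
      where
      lem : ∀ a b c → a ℤ.- b ℤ.+ (b ℤ.- c) ≡ a ℤ.- c
      lem = solveℤ

    power-step : ∀ {U C x M} → + P ∣ℤ + U ℤ.- + (2 ^ x) → + P ∣ℤ + C ℤ.- + (2 ^ M) →
                 + P ∣ℤ + ((U * C) % P) ℤ.- + (2 ^ (x + M))
    power-step {U} {C} {x} {M} hU hC = trans-∣ (+ ((U * C) % P)) (+ (U * C)) (+ (2 ^ (x + M))) (%-∣ (U * C))
      (subst₂ (λ a b → + P ∣ℤ a ℤ.- b) (sym (ℤₚ.pos-* U C))
        (trans (sym (ℤₚ.pos-* (2 ^ x) (2 ^ M))) (cong +_ (sym (ℕₚ.^-distribˡ-+-* 2 x M)))) (*-cong-∣ {+ P} {+ U} {+ (2 ^ x)} {+ C} {+ (2 ^ M)} hU hC))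

    certified-mkSteps : ∀ k {M C} m → + P ∣ℤ + C ℤ.- + (2 ^ M) → Certified (mkSteps k M C m)
    certified-mkSteps zero    m hC = tt
    certified-mkSteps (suc k) {M} {C} m hC = hC , certified-mkSteps k (m * p)
      (trans-∣ (+ (C ^ p % P)) (+ (C ^ p)) (+ (2 ^ (M * p))) (%-∣ (C ^ p))
        (subst₂ (λ a b → + P ∣ℤ a ℤ.- b) (sym (pos-^ C p))
          (trans (cong (ℤ._^ p) (pos-^ 2 M)) (trans (ℤₚ.^-*-assoc (+ 2) M p) (sym (pos-^ 2 (M * p)))))
          (^-cong-∣ hC p)))

    Root : (b W r : ℕ) → Set
    Root b W r = ∃ λ x → x % q ≡ r × + P ∣ℤ h x ℤ.- + W × b ≤ x % P

    ≡ᵇ-true : ∀ a b → (a ≡ᵇ b) ≡ true → a ≡ b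
    ≡ᵇ-true a b e = ℕₚ.≡ᵇ⇒≡ a b (subst True (sym e) tt)

    mutual
      search-sound : ∀ s {b W r x U} → Certified s → + P ∣ℤ + U ℤ.- + (2 ^ x) → search s b W r x U ≡ true → Root b W r
      search-sound done {b} {W} {r} {x} {U} _ hU e =
        x , ≡ᵇ-true (x % q) r (∧-conicalˡ _ _ e) ,
        trans-∣ (h x) (+ (x * U)) (+ W)
          (subst₂ (λ a b → + P ∣ℤ a ℤ.- b) (sym (ℤₚ.pos-* x (2 ^ x))) (sym (ℤₚ.pos-* x U))
            (*-cong-∣ {+ P} {+ x} {+ x} {+ (2 ^ x)} {+ U} (subst (+ P ∣ℤ_) (sym (ℤₚ.+-inverseʳ (+ x))) ∣-0)
              (neg-sub (+ U) (+ (2 ^ x)) hU)))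
          (subst (λ a → + P ∣ℤ + (x * U) ℤ.- + a) (≡ᵇ-true ((x * U) % P) W (∧-conicalˡ _ _ (∧-conicalʳ (x % q ≡ᵇ r) _ e)))
            (neg-sub (+ ((x * U) % P)) (+ (x * U)) (%-∣ (x * U)))) ,
        ℕₚ.≤ᵇ⇒≤ b (x % P) (subst True (sym (∧-conicalʳ _ _ (∧-conicalʳ (x % q ≡ᵇ r) _ e))) tt)
      search-sound (step M C m s) c hU e = digit-sound p M C m s c hU e

      digit-sound : ∀ k M C m s {b W r x U} → Certified (step M C m s) → + P ∣ℤ + U ℤ.- + (2 ^ x) →
                    digit k M C m s b W r x U ≡ true → Root b W r
      digit-sound (suc k) M C m s {b} {W} {r} {x} {U} c@(hC , cs) hU e with ((x * U) %′ m) ≡ᵇ (W %′ m)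
      ... | true  = search-sound s cs hU e
      ... | false = digit-sound k M C m s c (power-step {U} {C} {x} {M} hU hC) e

    residue-sound : ∀ s {b W} k → Certified s → allResidues s b W k ≡ true → ∀ r → r < k → Root b W r
    residue-sound s (suc k) c e r r<k with r ℕₚ.≟ k
    ... | yes refl = search-sound s c (%-∣ (2 ^ r)) (∧-conicalˡ _ _ e)
    ... | no  r≢k  = residue-sound s k c (∧-conicalʳ _ _ e) r (ℕₚ.≤∧≢⇒< (ℕₚ.≤-pred r<k) r≢k)

    ∣⇒%≡-≤ : ∀ {n x} → x ≤ n → + P ∣ℤ + n ℤ.- + x → n % P ≡ x % P
    ∣⇒%≡-≤ {n} {x} x≤n d with ℤ∣.∣⇒∣ᵤ (subst (+ P ∣ℤ_) (trans (ℤₚ.m-n≡m⊖n n x) (ℤₚ.⊖-≥ x≤n)) d)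
    ... | ℕ∣.divides k eq = trans (cong (_% P) (trans (sym (ℕₚ.m+[n∸m]≡n x≤n)) (cong (_+_ x) eq))) ([m+kn]%n≡m%n x k P)

    ∣⇒%≡ : ∀ n x → + P ∣ℤ + n ℤ.- + x → n % P ≡ x % P
    ∣⇒%≡ n x d with ℕₚ.≤-total x n
    ... | inj₁ x≤n = ∣⇒%≡-≤ x≤n d
    ... | inj₂ n≤x = sym (∣⇒%≡-≤ n≤x (neg-sub (+ n) (+ x) d))

    -- By `root-unique`, n agrees modulo P with the root found in its class modulo q. The least
    -- residue of that root is at least b, while the least residue of n is at most n < b.
    no-root : ∀ f → P ≡ p ^ f → ∀ s {b W} → Certified s → allResidues s b W q ≡ true →
              ∀ n → n < b → ∀ w → + P ∣ℤ + W ℤ.- w → ¬ + P ∣ℤ h n ℤ.- w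
    no-root f P≡ s {b} {W} c e n n<b w W≡w d with residue-sound s q c e (n % q) (m%n<n n q)
    ... | x , x≡n , hx , b≤ = ℕₚ.<⇒≱ n<b (ℕₚ.≤-trans (subst (b ≤_) (sym n≡x) b≤) (m%n≤m n P))
      where
      P≡π : + P ≡ π ℤ.^ f
      P≡π = trans (cong +_ P≡) (pos-^ p f)
      n≡x : n % P ≡ x % P
      n≡x = ∣⇒%≡ n x (subst (_∣ℤ + n ℤ.- + x) (sym P≡π) (root-unique n x (sym x≡n) f (subst (_∣ℤ h n ℤ.- h x) P≡π
        (trans-∣ (h n) w (h x) d (neg-sub (h x) w (trans-∣ (h x) (+ W) w hx W≡w))))))

    module _ (f : ℕ) (P≡ : P ≡ p ^ f) (s : Steps) (c : Certified s) (b : ℕ) where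

      signs-sound : ∀ F → allSigns s b F ≡ true → ∀ n → n < b → ∀ m {ε₁ ε₂} → Sign ε₁ → Sign ε₂ →
                    + P ∣ℤ + F ℤ.- + (m !) → ¬ + P ∣ℤ bigN n ε₁ ε₂ m
      signs-sound F e n n<b m {ε₁} {ε₂} s₁ s₂ hF d = main s₁ s₂ (subst (+ P ∣ℤ_) (lem (h n) ε₁ ε₂ (+ F) (+ (m !)))
          (ℤ∣.∣m∣n⇒∣m+n {m = bigN n ε₁ ε₂ m} d (ℤ∣.∣n⇒∣m*n ε₂ hF)))
        where
        lem : ∀ a e e′ F M → a ℤ.+ e ℤ.+ e′ ℤ.* M ℤ.+ e′ ℤ.* (F ℤ.- M) ≡ a ℤ.- (ℤ.- (e ℤ.+ e′ ℤ.* F))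
        lem = solveℤ
        reduce : ∀ {W w} → + P ∣ℤ + W ℤ.- w → + P ∣ℤ + (W % P) ℤ.- w
        reduce {W} {w} x = trans-∣ (+ (W % P)) (+ W) w (%-∣ W) x
        e₂ = ∧-conicalʳ (allResidues s b ((P₁ * (1 + F)) % P) q) _ e
        e₃ = ∧-conicalʳ (allResidues s b ((F + P₁) % P) q) _ e₂
        target : ℤ → ℤ → ℤ
        target ε₁ ε₂ = ℤ.- (ε₁ ℤ.+ ε₂ ℤ.* + F)
        main : ∀ {ε₁ ε₂} → Sign ε₁ → Sign ε₂ → ¬ + P ∣ℤ h n ℤ.- (ℤ.- (ε₁ ℤ.+ ε₂ ℤ.* + F))
        main (inj₁ refl) (inj₁ refl) = no-root f P≡ s c (∧-conicalˡ _ _ e) n n<b (target (+ 1) (+ 1))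
          (reduce {P₁ * (1 + F)} {target (+ 1) (+ 1)} (ℤ∣.divides (1ℤ ℤ.+ + F) (trans (cong (ℤ._- (ℤ.- (1ℤ ℤ.+ 1ℤ ℤ.* + F))) (ℤₚ.pos-* P₁ (1 + F))) (lem₁ (+ P₁) (+ F)))))
          where
          lem₁ : ∀ P F → P ℤ.* (1ℤ ℤ.+ F) ℤ.- (ℤ.- (1ℤ ℤ.+ 1ℤ ℤ.* F)) ≡ (1ℤ ℤ.+ F) ℤ.* (1ℤ ℤ.+ P)
          lem₁ = solveℤ
        main (inj₁ refl) (inj₂ refl) = no-root f P≡ s c (∧-conicalˡ _ _ e₂) n n<b (target (+ 1) (- (+ 1)))
          (reduce {F + P₁} {target (+ 1) (- (+ 1))} (ℤ∣.divides 1ℤ (lem₂ (+ P₁) (+ F))))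
          where
          lem₂ : ∀ P F → F ℤ.+ P ℤ.- (ℤ.- (1ℤ ℤ.+ (ℤ.- 1ℤ) ℤ.* F)) ≡ 1ℤ ℤ.* (1ℤ ℤ.+ P)
          lem₂ = solveℤ
        main (inj₂ refl) (inj₁ refl) = no-root f P≡ s c (∧-conicalˡ _ _ e₃) n n<b (target (- (+ 1)) (+ 1))
          (reduce {1 + P₁ * F} {target (- (+ 1)) (+ 1)} (ℤ∣.divides (+ F) (trans (cong (λ a → 1ℤ ℤ.+ a ℤ.- (ℤ.- ((ℤ.- 1ℤ) ℤ.+ 1ℤ ℤ.* + F))) (ℤₚ.pos-* P₁ F)) (lem₃ (+ P₁) (+ F)))))
          where
          lem₃ : ∀ P F → 1ℤ ℤ.+ P ℤ.* F ℤ.- (ℤ.- ((ℤ.- 1ℤ) ℤ.+ 1ℤ ℤ.* F)) ≡ F ℤ.* (1ℤ ℤ.+ P)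
          lem₃ = solveℤ
        main (inj₂ refl) (inj₂ refl) = no-root f P≡ s c (∧-conicalʳ (allResidues s b ((1 + P₁ * F) % P) q) _ e₃) n n<b (target (- (+ 1)) (- (+ 1)))
          (reduce {1 + F} {target (- (+ 1)) (- (+ 1))} (ℤ∣.divides 0ℤ (lem₄ (+ P₁) (+ F))))
          where
          lem₄ : ∀ P F → 1ℤ ℤ.+ F ℤ.- (ℤ.- ((ℤ.- 1ℤ) ℤ.+ (ℤ.- 1ℤ) ℤ.* F)) ≡ 0ℤ ℤ.* (1ℤ ℤ.+ P)
          lem₄ = solveℤ

      factorials-sound : ∀ k m₀ F → + P ∣ℤ + F ℤ.- + (m₀ !) → allFactorials s b k m₀ F ≡ true →
        ∀ n → n < b → ∀ m → m₀ ≤ m → ∀ {ε₁ ε₂} → Sign ε₁ → Sign ε₂ → ¬ + P ∣ℤ bigN n ε₁ ε₂ m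
      factorials-sound zero m₀ F hF e n n<b m m₀≤m s₁ s₂ = signs-sound 0 (∧-conicalʳ (F ≡ᵇ 0) _ e) n n<b m s₁ s₂
          (subst (+ P ∣ℤ_) (sym (ℤₚ.+-identityˡ (ℤ.- + (m !)))) (ℤ∣.∣m⇒∣-m (ℤ∣.∣ᵤ⇒∣ (ℕ∣.∣-trans P∣m₀! (!-mono-∣ m₀≤m)))))
        where
        P∣m₀! : P ∣ℕ m₀ !
        P∣m₀! = ℤ∣.∣⇒∣ᵤ (subst (+ P ∣ℤ_) (ℤₚ.+-identityʳ (+ (m₀ !))) (neg-sub (+ 0) (+ (m₀ !))
          (subst (λ a → + P ∣ℤ + a ℤ.- + (m₀ !)) (≡ᵇ-true F 0 (∧-conicalˡ _ _ e)) hF)))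
      factorials-sound (suc k) m₀ F hF e n n<b m m₀≤m s₁ s₂ with m₀ ℕₚ.≟ m
      ... | yes refl = signs-sound F (∧-conicalˡ _ _ e) n n<b m s₁ s₂ hF
      ... | no  m₀≢m = factorials-sound k (suc m₀) ((suc m₀ * F) % P)
        (trans-∣ (+ ((suc m₀ * F) % P)) (+ (suc m₀ * F)) (+ (suc m₀ !)) (%-∣ (suc m₀ * F))
          (subst (+ P ∣ℤ_) (trans (lem (+ suc m₀) (+ F) (+ (m₀ !))) (cong₂ ℤ._-_ (sym (ℤₚ.pos-* (suc m₀) F)) (sym (ℤₚ.pos-* (suc m₀) (m₀ !)))))
            (ℤ∣.∣n⇒∣m*n (+ suc m₀) hF)))
        (∧-conicalʳ (allSigns s b F) _ e) n n<b m (ℕₚ.≤∧≢⇒< m₀≤m m₀≢m) s₁ s₂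
        where
        lem : ∀ a b c → a ℤ.* (b ℤ.- c) ≡ a ℤ.* b ℤ.- a ℤ.* c
        lem = solveℤ

    certificate-sound : ∀ f b k → P ≡ p ^ f → certificate f b k ≡ true →
      ∀ n → n < b → ∀ m → 2 ≤ m → ∀ {ε₁ ε₂} → Sign ε₁ → Sign ε₂ → ¬ p ^ f ∣ℕ ∣ bigN n ε₁ ε₂ m ∣
    certificate-sound f b k P≡ e n n<b m 2≤m s₁ s₂ d =
      factorials-sound f P≡ (mkSteps f q (2 ^ q % P) p) (certified-mkSteps f p (%-∣ (2 ^ q))) b k 2 2
        (subst (+ P ∣ℤ_) (sym (ℤₚ.+-inverseʳ (+ 2))) ∣-0) e n n<b m 2≤m s₁ s₂
        (ℤ∣.∣ᵤ⇒∣ (subst (_∣ℕ _) (sym P≡) d))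

order₃ : Order 3 2
order₃ = record { isPrime = toWitness {a? = prime? 3} _ ; p∤2 = toWitnessFalse {a? = 3 ℕ∣.∣? 2} _
                ; p∤q = toWitnessFalse {a? = 3 ℕ∣.∣? 2} _ ; 2^q = ℤ∣.divides (+ 1) refl }

order₅ : Order 5 4
order₅ = record { isPrime = toWitness {a? = prime? 5} _ ; p∤2 = toWitnessFalse {a? = 5 ℕ∣.∣? 2} _
                ; p∤q = toWitnessFalse {a? = 5 ℕ∣.∣? 4} _ ; 2^q = ℤ∣.divides (+ 3) refl }

order₇ : Order 7 3
order₇ = record { isPrime = toWitness {a? = prime? 7} _ ; p∤2 = toWitnessFalse {a? = 7 ℕ∣.∣? 2} _
                ; p∤q = toWitnessFalse {a? = 7 ℕ∣.∣? 3} _ ; 2^q = ℤ∣.divides (+ 1) refl }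

record Certificate {p q} (o : Order p q) (f b k : ℕ) : Set where
  constructor certify
  field holds : Roots.certificate o (pred (p ^ f)) f b k ≡ true

shallow : ∀ {p q} {o : Order p q} {f b k} → Certificate o f b k → ∀ {n m ε₁ ε₂} → n < b → 2 ≤ m →
          Sign ε₁ → Sign ε₂ → ¬ p ^ f ∣ℕ ∣ bigN n ε₁ ε₂ m ∣
shallow {p} {o = o} {f} {b} {k} (certify e) {n} {m} n<b 2≤m s₁ s₂ =
  Roots.certificate-sound o (pred (p ^ f)) f b k (ℕₚ.suc-pred (p ^ f) {{ℕₚ.m^n≢0 p f {{prime⇒nonZero (Order.isPrime o)}}}})
    e n n<b m 2≤m s₁ s₂

-- Reduction of the bounds on n and m

n2ⁿ-reflects-< : ∀ {n k} → n * 2 ^ n < k * 2 ^ k → n < k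
n2ⁿ-reflects-< {n} {k} h with n ℕₚ.<? k
... | yes n<k = n<k
... | no  n≮k = ⊥-elim (ℕₚ.<⇒≱ h (ℕₚ.*-mono-≤ (ℕₚ.≮⇒≥ n≮k) (ℕₚ.^-monoʳ-≤ 2 (ℕₚ.≮⇒≥ n≮k))))

module Stage {b f₃ f₅ f₇ k₃ k₅ k₇ : ℕ} (cert₃ : Certificate order₃ f₃ b k₃) (cert₅ : Certificate order₅ f₅ b k₅)
  (cert₇ : Certificate order₇ f₇ b k₇) where
  B : ℕ
  B = 3 ^ f₃ * (5 ^ f₅ * 7 ^ f₇)

  ∣N∣<B : ∀ {n m ε₁ ε₂} → n < b → Solution n m ε₁ ε₂ → ∣ bigN n ε₁ ε₂ m ∣ < B
  ∣N∣<B {n} {m} n<b sol@(2≤m , s₁ , s₂ , _) = ∣bigN∣-bound n m f₃ f₅ f₇ sol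
    (shallow cert₃ n<b 2≤m s₁ s₂) (shallow cert₅ n<b 2≤m s₁ s₂) (shallow cert₇ n<b 2≤m s₁ s₂)

  module _ {e m₀ n₁ : ℕ} (b≤ : b ≤ 3 ^ f₃) (B<2^e : B < 2 ^ e) (2∣m₀! : 2 ^ e ∣ℕ m₀ !) (3∣m₀! : 3 ^ f₃ ∣ℕ m₀ !)
    (m₀!-large : B + (1 + e * 2 ^ e) ≤ m₀ !) (n₁-large : B + (1 + m₀ !) ≤ n₁ * 2 ^ n₁) where

    -- If e ≤ n, then 2^e divides both n 2ⁿ and m!, which `large-m-impossible` excludes. If n < e,
    -- then n 2ⁿ and N are both too small to balance m!.
    m-bound : ∀ {n m ε₁ ε₂} → n < b → Solution n m ε₁ ε₂ → m < m₀
    m-bound {n} {m} {ε₁} {ε₂} n<b sol@(2≤m , s₁ , s₂ , _) with m ℕₚ.<? m₀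
    ... | yes m<m₀ = m<m₀
    ... | no  m≮m₀ = ⊥-elim (contra (e ℕₚ.≤? n))
      where
      m₀≤m = ℕₚ.≮⇒≥ m≮m₀
      N<B = ∣N∣<B {n} {m} n<b sol
      N = bigN n ε₁ ε₂ m
      lem : ∀ a e b → b ≡ a ℤ.+ e ℤ.+ b ℤ.- (a ℤ.+ e)
      lem = solveℤ
      m!≤ : m ! ≤ ∣ N ∣ + (n * 2 ^ n + 1)
      m!≤ = begin
        m !                              ≡⟨ sym (sign-*-abs s₂ (+ (m !))) ⟩
        ∣ ε₂ ℤ.* + (m !) ∣               ≡⟨ cong ∣_∣ (lem (+ (n * 2 ^ n)) ε₁ (ε₂ ℤ.* + (m !))) ⟩
        ∣ N ℤ.- (+ (n * 2 ^ n) ℤ.+ ε₁) ∣ ≤⟨ ℤₚ.∣i-j∣≤∣i∣+∣j∣ N (+ (n * 2 ^ n) ℤ.+ ε₁) ⟩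
        ∣ N ∣ + ∣ + (n * 2 ^ n) ℤ.+ ε₁ ∣ ≤⟨ ℕₚ.+-monoʳ-≤ ∣ N ∣ (ℤₚ.∣i+j∣≤∣i∣+∣j∣ (+ (n * 2 ^ n)) ε₁) ⟩
        ∣ N ∣ + (n * 2 ^ n + ∣ ε₁ ∣)     ≡⟨ cong (λ x → ∣ N ∣ + (n * 2 ^ n + x)) (sign-abs s₁) ⟩
        ∣ N ∣ + (n * 2 ^ n + 1)          ∎
        where open ℕₚ.≤-Reasoning
      contra : Dec (e ≤ n) → ⊥
      contra (yes e≤n) = large-m-impossible n m B e f₃ s₁ s₂ N<B B<2^e (ℕ∣.∣n⇒∣m*n n (p^-mono-∣ 2 e≤n))
        (ℕ∣.∣-trans 2∣m₀! (!-mono-∣ m₀≤m)) (ℕ∣.∣-trans 3∣m₀! (!-mono-∣ m₀≤m)) (ℕₚ.<-≤-trans n<b b≤)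
      contra (no e≰n) = ℕₚ.<⇒≱ (ℕₚ.≤-<-trans m!≤ (ℕₚ.+-mono-<-≤ N<B (ℕₚ.≤-trans (ℕₚ.≤-reflexive (ℕₚ.+-comm (n * 2 ^ n) 1))
          (ℕₚ.+-monoʳ-≤ 1 (ℕₚ.*-mono-≤ n≤e (ℕₚ.^-monoʳ-≤ 2 n≤e))))))
        (ℕₚ.≤-trans m₀!-large (ℕ∣.∣⇒≤ {{>-nonZero (ℕₚ.1≤n! m)}} (!-mono-∣ m₀≤m)))
        where
        n≤e = ℕₚ.<⇒≤ (ℕₚ.≰⇒> e≰n)

    n-bound : ∀ {n m ε₁ ε₂} → n < b → Solution n m ε₁ ε₂ → n < n₁
    n-bound {n} {m} n<b sol@(2≤m , s₁ , s₂ , _) = n2ⁿ-reflects-< {n} {n₁} (ℕₚ.≤-<-trans (n2ⁿ≤ n m s₁ s₂)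
      (ℕₚ.<-≤-trans (ℕₚ.+-mono-<-≤ (∣N∣<B {n} {m} n<b sol) (s≤s (ℕ∣.∣⇒≤ {{>-nonZero (ℕₚ.1≤n! m₀)}} (!-mono-∣ (ℕₚ.<⇒≤ (m-bound {n} {m} n<b sol))))))
        n₁-large))

-- 3^144, 5^98 and 7^81 are each more than 2^17 times 2^210, whereas only a few thousand roots arise
-- from the choices of m, signs and class modulo q, so none is expected below 2^210. The number 292
-- is such that 294! is the first factorial divisible by 3^144.
cert₃-210 : Certificate order₃ 144 (2 ^ 210) 292
cert₃-210 = certify refl

cert₅-210 : Certificate order₅ 98 (2 ^ 210) 398
cert₅-210 = certify refl

cert₇-210 : Certificate order₇ 81 (2 ^ 210) 488
cert₇-210 = certify refl

n<5506 : ∀ {n m ε₁ ε₂} → Solution n m ε₁ ε₂ → n < 5506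
-- B is about 2^683, so e = 685 suffices; 690! is the first factorial divisible by 2^685; and 5506 *
-- 2^5506 exceeds B + 1 + 690!.
n<5506 {n} {m} sol = Stage.n-bound cert₃-210 cert₅-210 cert₇-210 {685} {690} {5506}
  (ℕₚ.≤ᵇ⇒≤ (2 ^ 210) (3 ^ 144) _) (ℕₚ.<ᵇ⇒< (3 ^ 144 * (5 ^ 98 * 7 ^ 81)) (2 ^ 685) _)
  (toWitness {a? = 2 ^ 685 ℕ∣.∣? 690 !} _) (toWitness {a? = 3 ^ 144 ℕ∣.∣? 690 !} _)
  (ℕₚ.≤ᵇ⇒≤ (3 ^ 144 * (5 ^ 98 * 7 ^ 81) + (1 + 685 * 2 ^ 685)) (690 !) _)
  (ℕₚ.≤ᵇ⇒≤ (3 ^ 144 * (5 ^ 98 * 7 ^ 81) + (1 + 690 !)) (5506 * 2 ^ 5506) _)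
  {n} {m} (large-n-impossible n m sol) sol

n<337 : ∀ {n m ε₁ ε₂} → Solution n m ε₁ ε₂ → n < 337
n<337 {n} {m} sol = Stage.n-bound {5506} {14} {10} {8} {28} {43} {47} (certify refl) (certify refl) (certify refl) {69} {72} {337}
  (ℕₚ.≤ᵇ⇒≤ 5506 (3 ^ 14) _) (ℕₚ.<ᵇ⇒< (3 ^ 14 * (5 ^ 10 * 7 ^ 8)) (2 ^ 69) _)
  (toWitness {a? = 2 ^ 69 ℕ∣.∣? 72 !} _) (toWitness {a? = 3 ^ 14 ℕ∣.∣? 72 !} _)
  (ℕₚ.≤ᵇ⇒≤ (3 ^ 14 * (5 ^ 10 * 7 ^ 8) + (1 + 69 * 2 ^ 69)) (72 !) _)
  (ℕₚ.≤ᵇ⇒≤ (3 ^ 14 * (5 ^ 10 * 7 ^ 8) + (1 + 72 !)) (337 * 2 ^ 337) _)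
  {n} {m} (n<5506 {n} {m} sol) sol

cert₃-337 : Certificate order₃ 11 337 25
cert₃-337 = certify refl

cert₅-337 : Certificate order₅ 8 337 33
cert₅-337 = certify refl

cert₇-337 : Certificate order₇ 6 337 40
cert₇-337 = certify refl

m<58 : ∀ {n m ε₁ ε₂} → Solution n m ε₁ ε₂ → m < 58
m<58 {n} {m} sol = Stage.m-bound cert₃-337 cert₅-337 cert₇-337 {54} {58} {253}
  (ℕₚ.≤ᵇ⇒≤ 337 (3 ^ 11) _) (ℕₚ.<ᵇ⇒< (3 ^ 11 * (5 ^ 8 * 7 ^ 6)) (2 ^ 54) _)
  (toWitness {a? = 2 ^ 54 ℕ∣.∣? 58 !} _) (toWitness {a? = 3 ^ 11 ℕ∣.∣? 58 !} _)
  (ℕₚ.≤ᵇ⇒≤ (3 ^ 11 * (5 ^ 8 * 7 ^ 6) + (1 + 54 * 2 ^ 54)) (58 !) _)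
  (ℕₚ.≤ᵇ⇒≤ (3 ^ 11 * (5 ^ 8 * 7 ^ 6) + (1 + 58 !)) (253 * 2 ^ 253) _)
  {n} {m} (n<337 {n} {m} sol) sol

-- The remaining finite box

Expected : ℕ → ℕ → ℤ → ℤ → Set
Expected n m ε₁ ε₂ = (n ≤ 8 × m ≤ 7) × (n ≡ 8 → m ≡ 4 × ε₁ ≡ + 1 × ε₂ ≡ - (+ 1)) × (m ≡ 7 → n ≡ 4 × ε₁ ≡ - (+ 1) × ε₂ ≡ + 1)

expected? : ∀ n m ε₁ ε₂ → Dec (Expected n m ε₁ ε₂)
expected? n m ε₁ ε₂ = ((n ℕₚ.≤? 8) ×-dec (m ℕₚ.≤? 7))
  ×-dec ((n ℕₚ.≟ 8) →-dec ((m ℕₚ.≟ 4) ×-dec ((ε₁ ℤₚ.≟ + 1) ×-dec (ε₂ ℤₚ.≟ - (+ 1)))))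
  ×-dec ((m ℕₚ.≟ 7) →-dec ((n ℕₚ.≟ 4) ×-dec ((ε₁ ℤₚ.≟ - (+ 1)) ×-dec (ε₂ ℤₚ.≟ + 1))))

divides? : ℕ → ℕ → Bool
divides? zero    B = false
divides? (suc k) B = B % suc k ≡ᵇ 0

-- For B = 3^11 5^8 7^6 the certificates force ∣N∣ to divide B, so one remainder replaces a
-- factorisation of N, and the conclusion is evaluated only for the few survivors.
testSign : (B n c m F : ℕ) → ℤ → ℤ → Bool
testSign B n c m F ε₁ ε₂ = if divides? ∣ + c ℤ.+ ε₁ ℤ.+ ε₂ ℤ.* + F ∣ B then ⌊ expected? n m ε₁ ε₂ ⌋ else true

testSigns : (B n c m F : ℕ) → Bool
testSigns B n c m F = (testSign B n c m F (+ 1) (+ 1) ∧ testSign B n c m F (+ 1) (- (+ 1)))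
                    ∧ (testSign B n c m F (- (+ 1)) (+ 1) ∧ testSign B n c m F (- (+ 1)) (- (+ 1)))

testFactorials : (B n c k m F : ℕ) → Bool
testFactorials B n c zero    m F = true
testFactorials B n c (suc k) m F = testSigns B n c m F ∧ testFactorials B n c k (suc m) (suc m * F)

testBox : (B N k : ℕ) → Bool
testBox B zero    k = true
testBox B (suc n) k = testFactorials B n (n * 2 ^ n) k 2 2 ∧ testBox B n k

divides?-true : ∀ {M B} .{{_ : NonZero M}} → M ∣ℕ B → divides? M B ≡ true
divides?-true {suc k} {B} d = cong (_≡ᵇ 0) (ℕ∣.n∣m⇒m%n≡0 B (suc k) d)

testSign-sound : ∀ {B n m ε₁ ε₂} → testSign B n (n * 2 ^ n) m (m !) ε₁ ε₂ ≡ true → bigN n ε₁ ε₂ m ≢ 0ℤ →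
                 ∣ bigN n ε₁ ε₂ m ∣ ∣ℕ B → Expected n m ε₁ ε₂
testSign-sound {B} {n} {m} {ε₁} {ε₂} e N≢0 d
  rewrite divides?-true {∣ bigN n ε₁ ε₂ m ∣} {B} {{≢-nonZero (λ z → N≢0 (ℤₚ.∣i∣≡0⇒i≡0 z))}} d
  = toWitness {a? = expected? n m ε₁ ε₂} (subst True (sym e) tt)

testSigns-sound : ∀ {B n m ε₁ ε₂} → testSigns B n (n * 2 ^ n) m (m !) ≡ true → Sign ε₁ → Sign ε₂ →
                  bigN n ε₁ ε₂ m ≢ 0ℤ → ∣ bigN n ε₁ ε₂ m ∣ ∣ℕ B → Expected n m ε₁ ε₂
testSigns-sound {B} {n} {m} e s₁ s₂ = go s₁ s₂
  where
  c = n * 2 ^ n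
  F = m !
  e₊ = ∧-conicalˡ (testSign B n c m F (+ 1) (+ 1) ∧ testSign B n c m F (+ 1) (- (+ 1))) _ e
  e₋ = ∧-conicalʳ (testSign B n c m F (+ 1) (+ 1) ∧ testSign B n c m F (+ 1) (- (+ 1))) _ e
  go : ∀ {ε₁ ε₂} → Sign ε₁ → Sign ε₂ → bigN n ε₁ ε₂ m ≢ 0ℤ → ∣ bigN n ε₁ ε₂ m ∣ ∣ℕ B → Expected n m ε₁ ε₂
  go (inj₁ refl) (inj₁ refl) = testSign-sound (∧-conicalˡ (testSign B n c m F (+ 1) (+ 1)) _ e₊)
  go (inj₁ refl) (inj₂ refl) = testSign-sound (∧-conicalʳ (testSign B n c m F (+ 1) (+ 1)) _ e₊)
  go (inj₂ refl) (inj₁ refl) = testSign-sound (∧-conicalˡ (testSign B n c m F (- (+ 1)) (+ 1)) _ e₋)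
  go (inj₂ refl) (inj₂ refl) = testSign-sound (∧-conicalʳ (testSign B n c m F (- (+ 1)) (+ 1)) _ e₋)

testFactorials-sound : ∀ {B n} k m₀ → testFactorials B n (n * 2 ^ n) k m₀ (m₀ !) ≡ true → ∀ m → m₀ ≤ m → m < m₀ + k →
                       testSigns B n (n * 2 ^ n) m (m !) ≡ true
testFactorials-sound zero m₀ e m m₀≤m m< = ⊥-elim (ℕₚ.<⇒≱ (subst (m <_) (ℕₚ.+-identityʳ m₀) m<) m₀≤m)
testFactorials-sound {B} {n} (suc k) m₀ e m m₀≤m m< with m₀ ℕₚ.≟ m
... | yes refl = ∧-conicalˡ (testSigns B n (n * 2 ^ n) m₀ (m₀ !)) _ e
... | no  m₀≢m = testFactorials-sound k (suc m₀) (∧-conicalʳ (testSigns B n (n * 2 ^ n) m₀ (m₀ !)) _ e) m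
  (ℕₚ.≤∧≢⇒< m₀≤m m₀≢m) (subst (m <_) (ℕₚ.+-suc m₀ k) m<)

testBox-sound : ∀ {B} N k → testBox B N k ≡ true → ∀ n → n < N → testFactorials B n (n * 2 ^ n) k 2 2 ≡ true
testBox-sound {B} (suc N) k e n n<N with n ℕₚ.≟ N
... | yes refl = ∧-conicalˡ (testFactorials B n (n * 2 ^ n) k 2 2) _ e
... | no  n≢N  = testBox-sound N k (∧-conicalʳ (testFactorials B N (N * 2 ^ N) k 2 2) _ e) n (ℕₚ.≤∧≢⇒< (ℕₚ.≤-pred n<N) n≢N)

smooth-∣ : ∀ {f₃ f₅ f₇} M → Smooth357 M → ¬ 3 ^ f₃ ∣ℕ M → ¬ 5 ^ f₅ ∣ℕ M → ¬ 7 ^ f₇ ∣ℕ M →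
           M ∣ℕ 3 ^ f₃ * (5 ^ f₅ * 7 ^ f₇)
smooth-∣ {f₃} {f₅} {f₇} M (a , b , c , refl) n₃ n₅ n₇ = ℕ∣.*-pres-∣ (p^-mono-∣ 3 {a} {f₃} (le 3 n₃ (ℕ∣.m∣m*n (5 ^ b * 7 ^ c))))
  (ℕ∣.*-pres-∣ (p^-mono-∣ 5 {b} {f₅} (le 5 n₅ (ℕ∣.∣n⇒∣m*n (3 ^ a) (ℕ∣.m∣m*n (7 ^ c))))) (p^-mono-∣ 7 {c} {f₇} (le 7 n₇ (ℕ∣.∣n⇒∣m*n (3 ^ a) (ℕ∣.n∣m*n (5 ^ b))))))
  where
  le : ∀ p {f a} → ¬ p ^ f ∣ℕ M → p ^ a ∣ℕ M → a ≤ f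
  le p {f} {a} nd d with a ℕₚ.≤? f
  ... | yes a≤f = a≤f
  ... | no  a≰f = ⊥-elim (nd (ℕ∣.∣-trans (p^-mono-∣ p (ℕₚ.<⇒≤ (ℕₚ.≰⇒> a≰f))) d))

-- The 56 values of m are 2 to 57.
box : testBox (3 ^ 11 * (5 ^ 8 * 7 ^ 6)) 337 56 ≡ true
box = refl

expected : ∀ {n m ε₁ ε₂} → Solution n m ε₁ ε₂ → Expected n m ε₁ ε₂
expected {n} {m} {ε₁} {ε₂} sol@(2≤m , s₁ , s₂ , N≢0 , ≤7) =
  testSigns-sound {3 ^ 11 * (5 ^ 8 * 7 ^ 6)} {n} {m}
    (testFactorials-sound 56 2 (testBox-sound 337 56 box n n<) m 2≤m (m<58 {n} {m} sol)) s₁ s₂ N≢0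
    (smooth-∣ {11} {8} {6} ∣ bigN n ε₁ ε₂ m ∣ (bigN-smooth n m sol)
      (shallow cert₃-337 {n} {m} n< 2≤m s₁ s₂) (shallow cert₅-337 {n} {m} n< 2≤m s₁ s₂) (shallow cert₇-337 {n} {m} n< 2≤m s₁ s₂))
  where
  n< = n<337 {n} {m} sol

-- The two extremal solutions and the conclusion

prime∣^ : ∀ {p} → Prime p → ∀ a k → p ∣ℕ a ^ k → p ∣ℕ a
prime∣^ pp a zero    d = ⊥-elim (prime∤1 pp d)
prime∣^ pp a (suc k) d with euclidsLemma a (a ^ k) pp d
... | inj₁ p∣a = p∣a
... | inj₂ p∣  = prime∣^ pp a k p∣

-- Since 105 = 3 * 5 * 7, dividing a power of 105 is a decidable witness of smoothness for the two
-- explicit values of N.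
prime-divisor-≤7 : ∀ {M} k → M ∣ℕ 105 ^ k → ∀ p → Prime p → p ∣ℕ M → p ≤ 7
prime-divisor-≤7 k d p pp p∣M with euclidsLemma 3 35 pp (prime∣^ pp 105 k (ℕ∣.∣-trans p∣M d))
... | inj₁ p∣3 = ℕₚ.≤-trans (ℕ∣.∣⇒≤ p∣3) (ℕₚ.m≤m+n 3 4)
... | inj₂ p∣35 with euclidsLemma 5 7 pp p∣35
... | inj₁ p∣5 = ℕₚ.≤-trans (ℕ∣.∣⇒≤ p∣5) (ℕₚ.m≤m+n 5 2)
... | inj₂ p∣7 = ℕ∣.∣⇒≤ p∣7

theorem3 : ((n m : ℕ) (ε₁ ε₂ : ℤ) → Solution n m ε₁ ε₂ → n ≤ 8 × m ≤ 7)
    × (Solution 8 4 (+ 1) (- (+ 1)) × bigN 8 (+ 1) (- (+ 1)) 4 ≡ + (3 ^ 4 * 5 ^ 2))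
    × ((m : ℕ) (ε₁ ε₂ : ℤ) → Solution 8 m ε₁ ε₂ → m ≡ 4 × ε₁ ≡ + 1 × ε₂ ≡ - (+ 1))
    × (Solution 4 7 (- (+ 1)) (+ 1) × bigN 4 (- (+ 1)) (+ 1) 7 ≡ + (3 ^ 6 * 7))
    × ((n : ℕ) (ε₁ ε₂ : ℤ) → Solution n 7 ε₁ ε₂ → n ≡ 4 × ε₁ ≡ - (+ 1) × ε₂ ≡ + 1)
theorem3 =
    (λ n m ε₁ ε₂ sol → proj₁ (expected {n} {m} sol))
  , ((s≤s (s≤s z≤n) , inj₁ refl , inj₂ refl , (λ ()) , prime-divisor-≤7 4 (toWitness {a? = 2025 ℕ∣.∣? 105 ^ 4} _)) , refl)
  , (λ m ε₁ ε₂ sol → proj₁ (proj₂ (expected {8} {m} sol)) refl)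
  , ((s≤s (s≤s z≤n) , inj₂ refl , inj₁ refl , (λ ()) , prime-divisor-≤7 6 (toWitness {a? = 5103 ℕ∣.∣? 105 ^ 6} _)) , refl)
  , (λ n ε₁ ε₂ sol → proj₂ (proj₂ (expected {n} {7} sol)) refl)
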